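{- Let $0<\varepsilon\leq 1$. Assuming the Exponential Time Hypothesis ($\mathsf{ETH}$), there is no algorithm that solves $(2-\varepsilon)$-$\mathsf{GapSVP}_{\mathrm{par}}$ in time $2^{2^{o(p)}}\cdot 2^{o(n)}$, where $n$ is the rank of the input lattice and $p\in\mathbb{N}$ is the norm parameter, which is part of the input.
   Context: $\mathbb{N}$ denotes the positive integers. A lattice $\mathcal{L}$ of rank $n$ and dimension $m$ is the set $\mathcal{L}(\mathbf{b}_1,\ldots,\mathbf{b}_n)=\{\sum_{i=1}^n y_i\mathbf{b}_i : y_1,\ldots,y_n\in\mathbb{Z}\}$ of all integer linear combinations of linearly independent vectors $\mathbf{b}_1,\ldots,\mathbf{b}_n\in\mathbb{R}^m$. For $1\le p<\infty$, $\|\mathbf{x}\|_p=(\sum_i |x_i|^p)^{1/p}$. Let $\lambda_{1,p}(\mathcal{L})=\min_{\mathbf{v}\in\mathcal{L}\setminus\{0\}}\|\mathbf{v}\|_p$. For $\gamma\ge 1$, the promise problem $\gamma$-$\mathsf{GapSVP}_{\mathrm{par}}$ is: given a lattice $\mathcal{L}$ of rank $n$, a distance threshold $\delta>0$, and the parameter $p\in\mathbb{N}$, decide whether $\lambda_{1,p}(\mathcal{L})\le\delta$ (YES-instance) or $\lambda_{1,p}(\mathcal{L})>\gamma\delta$ (NO-instance), when one of these cases is promised to hold. $\mathsf{ETH}$ is the hypothesis that 3-SAT on formulas with $n$ variables cannot be solved in time $2^{o(n)}$. Cost convention: all running times treat arithmetic and bitwise operations on $O(L)$-bit integers as unit-cost,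 where $L$ is the maximum bit-length of any integer appearing in the instance encoding. -}

module Defs where

open import Level using (Level; 0ℓ) renaming (suc to lsuc)
open import Data.Bool using (Bool; true; false; if_then_else_; _∧_; _∨_; _xor_)
open import Data.Fin using (Fin; toℕ)
open import Data.Integer as ℤ using (ℤ; +_; -[1+_]; 0ℤ; 1ℤ)
import Data.Integer.Properties as ℤ
open import Data.List as List using (List; []; _∷_; _++_; length)
open import Data.List.Relation.Unary.All using (All)
open import Data.List.Relation.Unary.Unique.Propositional using (Unique)
open import Data.Nat as ℕ using (ℕ; zero; suc; _⊔_; ⌊_/2⌋; _≡ᵇ_)
import Data.Nat.ListAction as ListSum
open import Data.Nat.Logarithm using (⌈log₂_⌉)
import Data.Nat.Properties as ℕ
open import Data.Product using (Σ; ∃; ∃₂; _×_; _,_; proj₁; proj₂)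
open import Data.Rational as ℚ
  using (ℚ; 0ℚ; 1ℚ; _+_; _-_; _*_; _÷_; -_; 1/_; _<_; _≤_; Positive; ↥_; ↧_)
import Data.Rational.Properties as ℚ
open import Data.Sum using (_⊎_; inj₁; inj₂; [_,_]′)
open import Data.Vec as Vec using (Vec)
open import Data.Vec.Relation.Unary.Any using (Any)
open import Relation.Binary.Definitions using (tri<; tri≈; tri>)
open import Relation.Binary.PropositionalEquality hiding ([_])
open import Relation.Nullary using (¬_; yes; no; does; contradiction)
open import Algebra.Definitions.RawMonoid ℚ.+-0-rawMonoid using (sum)
open import Algebra.Definitions.RawSemiring ℚ.+-*-rawSemiring using (_^_)

private variable
  ℓ : Level
  n m : ℕ

------------------------------------------------------------------------
-- Real numbers (two-sided Dedekind cuts)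

record ℝ : Set₁ where
  field
    L U       : ℚ → Set          -- L q : "q < x",  U q : "x < q"
    L-inhab   : ∃ L
    U-inhab   : ∃ U
    L-lower   : ∀ {q r} → q < r → L r → L q
    U-upper   : ∀ {q r} → q < r → U q → U r
    L-rounded : ∀ {q} → L q → ∃ λ r → q < r × L r
    U-rounded : ∀ {r} → U r → ∃ λ q → q < r × U q
    disjoint  : ∀ {q} → ¬ (L q × U q)
    located   : ∀ {q r} → q < r → L q ⊎ U r

open ℝ

infix 4 _<ℝ_ _≤ℝ_ _≃ℝ_

_<ℝ_ _≤ℝ_ _≃ℝ_ : ℝ → ℝ → Set
x <ℝ y = ∃ λ q → U x q × L y q
x ≤ℝ y = ∀ q → L x q → L y q
x ≃ℝ y = x ≤ℝ y × y ≤ℝ x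

private
  q-1<q : ∀ q → q - 1ℚ < q
  q-1<q q = subst (q - 1ℚ <_) (ℚ.+-identityʳ q)
    (ℚ.+-monoʳ-< q (ℚ.negative⁻¹ (- 1ℚ)))

  q<q+1 : ∀ q → q < q + 1ℚ
  q<q+1 q = subst (_< q + 1ℚ) (ℚ.+-identityʳ q)
    (ℚ.+-monoʳ-< q (ℚ.positive⁻¹ 1ℚ))

fromℚ : ℚ → ℝ
fromℚ a .L q = q < a
fromℚ a .U q = a < q
fromℚ a .L-inhab = a - 1ℚ , q-1<q a
fromℚ a .U-inhab = a + 1ℚ , q<q+1 a
fromℚ a .L-lower = ℚ.<-trans
fromℚ a .U-upper q<r a<q = ℚ.<-trans a<q q<r
fromℚ a .L-rounded q<a = ℚ.<-dense q<a
fromℚ a .U-rounded a<r = let t , a<t , t<r = ℚ.<-dense a<r in t , t<r , a<t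
fromℚ a .disjoint (q<a , a<q) = ℚ.<-asym q<a a<q
fromℚ a .located {q} {r} q<r with ℚ.<-cmp q a
... | tri< q<a _ _ = inj₁ q<a
... | tri≈ _ refl _ = inj₂ q<r
... | tri> _ _ a<q = inj₂ (ℚ.<-trans a<q q<r)

private
  flip-< : ∀ a {q r} → q < r → a - r < a - q
  flip-< a q<r = ℚ.+-monoʳ-< a (ℚ.neg-antimono-< q<r)

  flip-flip : ∀ a q → a - (a - q) ≡ q
  flip-flip a q = begin
    a + - (a + - q)       ≡⟨ cong (λ t → a + t) (ℚ.neg-distrib-+ a (- q)) ⟩
    a + (- a + - (- q))   ≡⟨ ℚ.+-assoc a (- a) (- (- q)) ⟨
    (a + - a) + - (- q)   ≡⟨ cong₂ _+_ (ℚ.+-inverseʳ a) (neg-neg q) ⟩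
    0ℚ + q                ≡⟨ ℚ.+-identityˡ q ⟩
    q                     ∎
    where
    open ≡-Reasoning
    neg-neg : ∀ q → - (- q) ≡ q
    neg-neg q = ℚ.neg-injective (ℚ.neg-injective (cong -_ (go q)))
      where
      go : ∀ q → - (- (- q)) ≡ - q
      go (ℚ.mkℚ ℤ.+[1+ _ ] _ _) = refl
      go (ℚ.mkℚ ℤ.+0 _ _)       = refl
      go (ℚ.mkℚ -[1+ _ ] _ _)   = refl

infixl 6 _⊝_
infixl 7 _⊛_

_⊝_ : ℚ → ℝ → ℝ
(a ⊝ x) .L q = U x (a - q)
(a ⊝ x) .U q = L x (a - q)
(a ⊝ x) .L-inhab = let u , Uu = U-inhab x in
  a - u , subst (U x) (sym (flip-flip a u)) Uu
(a ⊝ x) .U-inhab = let l , Ll = L-inhab x in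
  a - l , subst (L x) (sym (flip-flip a l)) Ll
(a ⊝ x) .L-lower q<r = U-upper x (flip-< a q<r)
(a ⊝ x) .U-upper q<r = L-lower x (flip-< a q<r)
(a ⊝ x) .L-rounded {q} Lq = let t , t<a-q , Ut = U-rounded x Lq in
  a - t , subst (_< a - t) (flip-flip a q) (flip-< a t<a-q)
        , subst (U x) (sym (flip-flip a t)) Ut
(a ⊝ x) .U-rounded {r} Ur = let t , a-r<t , Lt = L-rounded x Ur in
  a - t , subst (a - t <_) (flip-flip a r) (flip-< a a-r<t)
        , subst (L x) (sym (flip-flip a t)) Lt
(a ⊝ x) .disjoint (Lq , Uq) = disjoint x (Uq , Lq)
(a ⊝ x) .located q<r = [ inj₂ , inj₁ ]′ (located x (flip-< a q<r))

private
  module _ (d : ℚ) .{{d>0 : Positive d}} where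
    instance
      d≢0 : ℚ.NonZero d
      d≢0 = ℚ.pos⇒nonZero d

      1/d>0 : Positive (1/ d)
      1/d>0 = ℚ.1/pos⇒pos d

    ÷-mono : ∀ {q r} → q < r → q * 1/ d < r * 1/ d
    ÷-mono = ℚ.*-monoˡ-<-pos (1/ d)

    *-mono : ∀ {q r} → q < r → q * d < r * d
    *-mono = ℚ.*-monoˡ-<-pos d

    *-÷ : ∀ q → q * d * 1/ d ≡ q
    *-÷ q = trans (ℚ.*-assoc q d (1/ d))
      (trans (cong (q *_) (ℚ.*-inverseʳ d)) (ℚ.*-identityʳ q))

    ÷-* : ∀ q → q * 1/ d * d ≡ q
    ÷-* q = trans (ℚ.*-assoc q (1/ d) d)
      (trans (cong (q *_) (ℚ.*-inverseˡ d)) (ℚ.*-identityʳ q))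

_⊛_ : ℝ → (d : ℚ) → .{{Positive d}} → ℝ
(x ⊛ d) .L q = L x ((q ÷ d) {{d≢0 d}})
(x ⊛ d) .U q = U x ((q ÷ d) {{d≢0 d}})
(x ⊛ d) .L-inhab = let l , Ll = L-inhab x in
  l * d , subst (L x) (sym (*-÷ d l)) Ll
(x ⊛ d) .U-inhab = let u , Uu = U-inhab x in
  u * d , subst (U x) (sym (*-÷ d u)) Uu
(x ⊛ d) .L-lower q<r = L-lower x (÷-mono d q<r)
(x ⊛ d) .U-upper q<r = U-upper x (÷-mono d q<r)
(x ⊛ d) .L-rounded {q} Lq = let t , q/d<t , Lt = L-rounded x Lq in
  t * d , subst (_< t * d) (÷-* d q) (*-mono d q/d<t)
        , subst (L x) (sym (*-÷ d t)) Lt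
(x ⊛ d) .U-rounded {r} Ur = let t , t<r/d , Ut = U-rounded x Ur in
  t * d , subst (t * d <_) (÷-* d r) (*-mono d t<r/d)
        , subst (U x) (sym (*-÷ d t)) Ut
(x ⊛ d) .disjoint = disjoint x
(x ⊛ d) .located q<r = located x (÷-mono d q<r)

^-nonNeg : ∀ {q} k → 0ℚ ≤ q → 0ℚ ≤ q ^ k
^-nonNeg zero 0≤q = ℚ.nonNegative⁻¹ 1ℚ
^-nonNeg {q} (suc k) 0≤q =
  subst (_≤ q * q ^ k) (ℚ.*-zeroʳ q)
    (ℚ.*-monoˡ-≤-nonNeg q {{ℚ.nonNegative 0≤q}} (^-nonNeg k 0≤q))

^-mono-≤ : ∀ {q r} k → 0ℚ ≤ q → q ≤ r → q ^ k ≤ r ^ k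
^-mono-≤ zero 0≤q q≤r = ℚ.≤-refl
^-mono-≤ {q} {r} (suc k) 0≤q q≤r = ℚ.≤-trans
  (ℚ.*-monoʳ-≤-nonNeg (q ^ k) {{ℚ.nonNegative (^-nonNeg k 0≤q)}} q≤r)
  (ℚ.*-monoˡ-≤-nonNeg r {{ℚ.nonNegative (ℚ.≤-trans 0≤q q≤r)}}
    (^-mono-≤ k 0≤q q≤r))

^-pos : ∀ {q} k → 0ℚ < q → 0ℚ < q ^ k
^-pos zero 0<q = ℚ.positive⁻¹ 1ℚ
^-pos {q} (suc k) 0<q =
  subst (_< q * q ^ k) (ℚ.*-zeroʳ q)
    (ℚ.*-monoʳ-<-pos q {{ℚ.positive 0<q}} (^-pos k 0<q))

^-mono-< : ∀ {q r} k .{{_ : ℕ.NonZero k}} → 0ℚ ≤ q → q < r → q ^ k < r ^ k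
^-mono-< {q} {r} (suc k) 0≤q q<r = ℚ.≤-<-trans
  (ℚ.*-monoˡ-≤-nonNeg q {{ℚ.nonNegative 0≤q}}
    (^-mono-≤ k 0≤q (ℚ.<⇒≤ q<r)))
  (ℚ.*-monoˡ-<-pos (r ^ k) {{ℚ.positive (^-pos k (ℚ.≤-<-trans 0≤q q<r))}} q<r)

s≤[s+1]^k : ∀ {s} k .{{_ : ℕ.NonZero k}} → 0ℚ ≤ s → s ≤ (s + 1ℚ) ^ k
s≤[s+1]^k {s} (suc k) 0≤s = ℚ.≤-trans (ℚ.<⇒≤ (q<q+1 s))
  (subst (_≤ (s + 1ℚ) * (s + 1ℚ) ^ k) (ℚ.*-identityʳ (s + 1ℚ))
    (ℚ.*-monoˡ-≤-nonNeg (s + 1ℚ)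
      {{ℚ.nonNegative (ℚ.≤-trans 0≤s (ℚ.<⇒≤ (q<q+1 s)))}} (1≤ k)))
  where
  1≤s+1 : 1ℚ ≤ s + 1ℚ
  1≤s+1 = subst (_≤ s + 1ℚ) (ℚ.+-identityˡ 1ℚ) (ℚ.+-monoˡ-≤ 1ℚ 0≤s)
  1^ : ∀ k → 1ℚ ^ k ≡ 1ℚ
  1^ zero = refl
  1^ (suc k) = trans (ℚ.*-identityˡ (1ℚ ^ k)) (1^ k)
  1≤ : ∀ k → 1ℚ ≤ (s + 1ℚ) ^ k
  1≤ k = subst (_≤ (s + 1ℚ) ^ k) (1^ k)
    (^-mono-≤ k (ℚ.nonNegative⁻¹ 1ℚ) 1≤s+1)

-- The real k-th root of s ≥ 0.  The conditions "r ≤ 0 or r ^ k ≤ s" and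
-- "0 ≤ r and s ≤ r ^ k" say that r is a weak lower, respectively upper, bound
-- of the root; the strict inequality with r makes the cut rounded.
root : (k : ℕ) .{{_ : ℕ.NonZero k}} (s : ℚ) → 0ℚ ≤ s → ℝ
root k s 0≤s .L q = ∃ λ r → q < r × (r ≤ 0ℚ ⊎ r ^ k ≤ s)
root k s 0≤s .U q = ∃ λ r → r < q × 0ℚ ≤ r × s ≤ r ^ k
root k s 0≤s .L-inhab = - 1ℚ , 0ℚ , ℚ.negative⁻¹ (- 1ℚ) , inj₁ ℚ.≤-refl
root k s 0≤s .U-inhab =
  s + 1ℚ + 1ℚ , s + 1ℚ , q<q+1 (s + 1ℚ)
    , ℚ.≤-trans 0≤s (ℚ.<⇒≤ (q<q+1 s)) , s≤[s+1]^k k 0≤s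
root k s 0≤s .L-lower q<r (t , r<t , h) = t , ℚ.<-trans q<r r<t , h
root k s 0≤s .U-upper q<r (t , t<q , h) = t , ℚ.<-trans t<q q<r , h
root k s 0≤s .L-rounded (t , q<t , h) =
  let u , q<u , u<t = ℚ.<-dense q<t in u , q<u , t , u<t , h
root k s 0≤s .U-rounded (t , t<r , h) =
  let u , t<u , u<r = ℚ.<-dense t<r in u , u<r , t , t<u , h
root k s 0≤s .disjoint ((l , q<l , inj₁ l≤0) , u , u<q , 0≤u , _) =
  ℚ.<-irrefl refl (ℚ.<-≤-trans (ℚ.<-trans u<q q<l) (ℚ.≤-trans l≤0 0≤u))
root k s 0≤s .disjoint ((l , q<l , inj₂ l^k≤s) , u , u<q , 0≤u , s≤u^k) =
  ℚ.<-irrefl refl (ℚ.<-≤-trans (^-mono-< k 0≤u (ℚ.<-trans u<q q<l))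
    (ℚ.≤-trans l^k≤s s≤u^k))
root k s 0≤s .located q<r with ℚ.<-dense q<r
... | t , q<t , t<r with ℚ.≤-total t 0ℚ | ℚ.≤-total (t ^ k) s
... | inj₁ t≤0 | _          = inj₁ (t , q<t , inj₁ t≤0)
... | inj₂ 0≤t | inj₁ t^k≤s = inj₁ (t , q<t , inj₂ t^k≤s)
... | inj₂ 0≤t | inj₂ s≤t^k = inj₂ (t , t<r , 0≤t , s≤t^k)

------------------------------------------------------------------------
-- Lattices and ℓₚ norms

Vector : ℕ → Set
Vector m = Fin m → ℚ

0ᵥ : Vector m
0ᵥ _ = 0ℚ

Basis : ℕ → ℕ → Set
Basis n m = Fin n → Vector m

_∙_ : (Fin n → ℚ) → Basis n m → Vector m
(c ∙ B) j = sum λ i → c i * B i j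

-- For rational vectors, independence over ℚ and over ℝ coincide.
LinearlyIndependent : Basis n m → Set
LinearlyIndependent {n} B = (c : Fin n → ℚ) → (c ∙ B) ≗ 0ᵥ → c ≗ λ _ → 0ℚ

infix 4 _∈ℒ_
_∈ℒ_ : Vector m → Basis n m → Set
_∈ℒ_ {n = n} v B = ∃ λ (y : Fin n → ℤ) → v ≗ ((λ i → y i ℚ./ 1) ∙ B)

powerSum : ℕ → Vector m → ℚ
powerSum p x = sum λ i → ℚ.∣ x i ∣ ^ p

private
  sum-nonNeg : ∀ {m} (f : Vector m) → (∀ i → 0ℚ ≤ f i) → 0ℚ ≤ sum f
  sum-nonNeg {zero} f 0≤f = ℚ.≤-refl
  sum-nonNeg {suc m} f 0≤f = ℚ.+-mono-≤ (0≤f Fin.zero)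
    (sum-nonNeg (λ i → f (Fin.suc i)) (λ i → 0≤f (Fin.suc i)))

∥_∥ : Vector m → (p : ℕ) .{{_ : ℕ.NonZero p}} → ℝ
∥ x ∥ p = root p (powerSum p x)
  (sum-nonNeg _ λ i → ^-nonNeg p (ℚ.0≤∣p∣ (x i)))

record Isλ₁ (p : ℕ) .{{_ : ℕ.NonZero p}} (B : Basis n m) (r : ℝ) : Set where
  field
    attained : ∃ λ v → v ∈ℒ B × ¬ (v ≗ 0ᵥ) × ∥ v ∥ p ≃ℝ r
    minimal  : ∀ v → v ∈ℒ B → ¬ (v ≗ 0ᵥ) → r ≤ℝ ∥ v ∥ p

------------------------------------------------------------------------
-- Random-access programs

-- The memory is a collection of integer arrays; a program names finitely many
-- of them.
Memory : Set
Memory = ℕ → ℤ → ℤ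

_[_,_↦_] : Memory → ℕ → ℤ → ℤ → Memory
(σ [ a , i ↦ z ]) b j =
  if does (a ℕ.≟ b) ∧ does (i ℤ.≟ j) then z else σ b j

data Op : Set where
  add sub mul div mod less equal band bor bxor shiftˡ shiftʳ : Op

private
  bit : Bool → ℕ
  bit b = if b then 1 else 0

  odd : ℕ → Bool
  odd k = (k ℕ.% 2) ≡ᵇ 1

  -- Correct once the number of rounds reaches the larger of x and y, provided
  -- f false false ≡ false.
  bitwiseℕ : (Bool → Bool → Bool) → (rounds : ℕ) → ℕ → ℕ → ℕ
  bitwiseℕ f zero    x y = 0
  bitwiseℕ f (suc k) x y =
    bit (f (odd x) (odd y)) ℕ.+ 2 ℕ.* bitwiseℕ f k ⌊ x /2⌋ ⌊ y /2⌋

  negative : ℤ → Bool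
  negative (+ _)    = false
  negative -[1+ _ ] = true

  digits : ℤ → ℕ
  digits (+ k)    = k
  digits -[1+ k ] = k

-- Two's complement: the binary digits of -[1+ k ] are those of k, complemented.
bitwise : (Bool → Bool → Bool) → ℤ → ℤ → ℤ
bitwise f x y = if s then -[1+ r ] else + r
  where
  s = f (negative x) (negative y)
  g : Bool → Bool → Bool
  g a b = f (a xor negative x) (b xor negative y) xor s
  r = bitwiseℕ g (digits x ⊔ digits y) (digits x) (digits y)

-- Division rounds so that the remainder is nonnegative; dividing by 0 gives 0.
-- Shifts are by the absolute value of the second operand.
⟦_⟧ : Op → ℤ → ℤ → ℤ
⟦ add ⟧ x y              = x ℤ.+ y
⟦ sub ⟧ x y              = x ℤ.- y
⟦ mul ⟧ x y              = x ℤ.* y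
⟦ div ⟧ x ℤ.+0           = 0ℤ
⟦ div ⟧ x y@(ℤ.+[1+ _ ]) = x ℤ./ y
⟦ div ⟧ x y@(-[1+ _ ])   = x ℤ./ y
⟦ mod ⟧ x ℤ.+0           = 0ℤ
⟦ mod ⟧ x y@(ℤ.+[1+ _ ]) = + (x ℤ.% y)
⟦ mod ⟧ x y@(-[1+ _ ])   = + (x ℤ.% y)
⟦ less ⟧ x y             = if does (x ℤ.<? y) then 1ℤ else 0ℤ
⟦ equal ⟧ x y            = if does (x ℤ.≟ y) then 1ℤ else 0ℤ
⟦ band ⟧ x y             = bitwise _∧_ x y
⟦ bor ⟧ x y              = bitwise _∨_ x y
⟦ bxor ⟧ x y             = bitwise _xor_ x y
⟦ shiftˡ ⟧ x y           = x ℤ.* + (2 ℕ.^ ℤ.∣ y ∣)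
⟦ shiftʳ ⟧ x y           = (x ℤ./ℕ (2 ℕ.^ ℤ.∣ y ∣)) {{ℕ.m^n≢0 2 ℤ.∣ y ∣}}

infix  6 _[_]≔_
infix  5 if_then_else′_ while_do′_
infixr 4 _⨾_

data Expr : Set where
  const : ℤ → Expr
  _[_]  : (array : ℕ) (index : Expr) → Expr
  op    : Op → Expr → Expr → Expr

data Program : Set where
  skip           : Program
  _[_]≔_         : (array : ℕ) (index value : Expr) → Program
  _⨾_            : Program → Program → Program
  if_then_else′_ : Expr → Program → Program → Program
  while_do′_     : Expr → Program → Program

eval : Memory → Expr → ℤ
eval σ (const z)    = z
eval σ (a [ e ])    = σ a (eval σ e)
eval σ (op o e₁ e₂) = ⟦ o ⟧ (eval σ e₁) (eval σ e₂)

-- Number of binary digits of the absolute value.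
bits : ℤ → ℕ
bits z = ⌈log₂ suc ℤ.∣ z ∣ ⌉

-- Every primitive step is charged 1 + ⌊ b / W ⌋ for each b-bit integer it
-- involves, so it takes constant time on O(W)-bit integers and correspondingly
-- longer on larger ones (including results and addresses).
module Timed (W : ℕ) .{{_ : ℕ.NonZero W}} where

  charge : ℤ → ℕ
  charge z = suc (bits z ℕ./ W)

  cost : Memory → Expr → ℕ
  cost σ (const z)        = charge z
  cost σ (a [ e ])        = cost σ e ℕ.+ charge (eval σ e) ℕ.+ charge (eval σ (a [ e ]))
  cost σ e@(op o e₁ e₂)   =
    cost σ e₁ ℕ.+ cost σ e₂
      ℕ.+ charge (eval σ e₁) ℕ.+ charge (eval σ e₂) ℕ.+ charge (eval σ e)

  data Run : Program → Memory → Memory → (time : ℕ) → Set where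
    skip : ∀ {σ} → Run skip σ σ 1
    assign : ∀ {σ a e₁ e₂} →
      Run (a [ e₁ ]≔ e₂) σ (σ [ a , eval σ e₁ ↦ eval σ e₂ ])
        (cost σ e₁ ℕ.+ cost σ e₂ ℕ.+ charge (eval σ e₁) ℕ.+ charge (eval σ e₂))
    seq : ∀ {P Q σ σ′ σ″ t t′} →
      Run P σ σ′ t → Run Q σ′ σ″ t′ → Run (P ⨾ Q) σ σ″ (t ℕ.+ t′)
    if-true : ∀ {e P Q σ σ′ t} → eval σ e ≢ 0ℤ →
      Run P σ σ′ t → Run (if e then P else′ Q) σ σ′ (cost σ e ℕ.+ t)
    if-false : ∀ {e P Q σ σ′ t} → eval σ e ≡ 0ℤ →
      Run Q σ σ′ t → Run (if e then P else′ Q) σ σ′ (cost σ e ℕ.+ t)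
    while-true : ∀ {e P σ σ′ σ″ t t′} → eval σ e ≢ 0ℤ →
      Run P σ σ′ t → Run (while e do′ P) σ′ σ″ t′ →
      Run (while e do′ P) σ σ″ (cost σ e ℕ.+ t ℕ.+ t′)
    while-false : ∀ {e P σ} → eval σ e ≡ 0ℤ →
      Run (while e do′ P) σ σ (cost σ e)

------------------------------------------------------------------------
-- Promise problems and running times

record PromiseProblem (ℓ : Level) : Set (lsuc ℓ) where
  field
    Instance : Set
    encode   : Instance → List ℤ
    Yes No   : Instance → Set ℓ

nth : List ℤ → ℕ → ℤ
nth []       _       = 0ℤ
nth (z ∷ zs) zero    = z
nth (z ∷ zs) (suc i) = nth zs i

-- The input occupies array 0 from index 0 on; all other cells are 0.
load : List ℤ → Memory
load zs zero (+ i) = nth zs i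
load zs _    _     = 0ℤ

-- Maximal bit-length of the integers in the list, counting a sign bit.
wordLength : List ℤ → ℕ
wordLength zs = suc (List.foldr _⊔_ 0 (List.map bits zs))

totalLength : List ℤ → ℕ
totalLength zs = ListSum.sum (List.map (λ z → suc (bits z)) zs)

-- The output is cell 0 of array 1.
Outputs_within : Program → List ℤ → ℤ → ℕ → Set
Outputs_within P input z T =
  ∃₂ λ σ t → Run P (load input) σ t × σ 1 0ℤ ≡ z × t ℕ.≤ T
  where open Timed (wordLength input)

SolvesInTime : Program → (Π : PromiseProblem ℓ) →
  (PromiseProblem.Instance Π → ℕ) → Set ℓ
SolvesInTime P Π T = ∀ I →
  (Yes I → Outputs_within P (encode I) 1ℤ (T I)) ×
  (No I  → Outputs_within P (encode I) 0ℤ (T I))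
  where open PromiseProblem Π

-- f(n) = o(n).  Taking f integer-valued loses nothing: round up.
Sublinear : (ℕ → ℕ) → Set
Sublinear f = ∀ c → ∃ λ N → ∀ n → N ℕ.≤ n → c ℕ.* f n ℕ.≤ n

------------------------------------------------------------------------
-- 3-SAT and ETH

Literal : ℕ → Set
Literal n = Fin n × Bool

Clause : ℕ → Set
Clause n = Vec (Literal n) 3

-- A formula is a set of clauses, listed without repetition, so that its length
-- is polynomial in the number of variables.  A clause may repeat a literal.
record Formula : Set where
  field
    vars    : ℕ
    clauses : List (Clause vars)
    unique  : Unique clauses

Satisfiable : Formula → Set
Satisfiable φ = ∃ λ (α : Fin vars → Bool) →
  All (Any λ (i , b) → α i ≡ b) clauses
  where open Formula φ

encodeLiteral : Literal n → ℤ
encodeLiteral (i , true)  = + suc (toℕ i)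
encodeLiteral (i , false) = -[1+ toℕ i ]

3-SAT : PromiseProblem 0ℓ
3-SAT = record
  { Instance = Formula
  ; encode   = λ φ → let open Formula φ in
      + vars ∷ + length clauses ∷
      List.concatMap (λ c → List.map encodeLiteral (Vec.toList c)) clauses
  ; Yes      = Satisfiable
  ; No       = λ φ → ¬ Satisfiable φ
  }

ETH : Set
ETH = ¬ ∃₂ λ (A : Program) (f : ℕ → ℕ) →
  Sublinear f × SolvesInTime A 3-SAT (λ φ → 2 ℕ.^ f (Formula.vars φ))

------------------------------------------------------------------------
-- γ-GapSVP with the norm as part of the input

record SVPInstance : Set where
  field
    rank dim    : ℕ
    basis       : Basis rank dim
    independent : LinearlyIndependent basis
    δ           : ℚ
    p           : ℕ
    {{δ>0}}     : Positive δ
    {{p>0}}     : ℕ.NonZero p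

encodeℚ : ℚ → List ℤ
encodeℚ q = ↥ q ∷ ↧ q ∷ []

encodeSVP : SVPInstance → List ℤ
encodeSVP I = + rank ∷ + dim ∷ + p ∷ encodeℚ δ ++
  List.concat (List.tabulate λ i → List.concat (List.tabulate λ j →
    encodeℚ (basis i j)))
  where open SVPInstance I

GapSVPpar : ℝ → PromiseProblem (lsuc 0ℓ)
GapSVPpar γ = record
  { Instance = SVPInstance
  ; encode   = encodeSVP
  ; Yes      = λ I → let open SVPInstance I in
      ∃ λ r → Isλ₁ p basis r × r ≤ℝ fromℚ δ
  ; No       = λ I → let open SVPInstance I in
      ∃ λ r → Isλ₁ p basis r × γ ⊛ δ <ℝ r
  }

-- 2^(2^f(p)) · 2^g(n), up to a factor polynomial in the length of the input:
-- without it the bound would be constant for fixed p and n, too small even to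
-- read a basis of unbounded dimension.
svpTime : (f g : ℕ → ℕ) (d : ℕ) → SVPInstance → ℕ
svpTime f g d I =
  2 ℕ.^ (2 ℕ.^ f p) ℕ.* 2 ℕ.^ g rank ℕ.* totalLength (encodeSVP I) ℕ.^ d
  where open SVPInstance I

{-# OPTIONS --safe #-}

-- A formula with n variables becomes a lattice of rank n + 2 with integer
-- coordinates: in terms of coefficients x₀, …, xₙ and z, they are z, the 2 xᵢ − z,
-- and for every clause the sum of its literals (x_v or z − x_v) minus 2 z.  If all
-- coordinates have absolute value at most 1, then z = 0 forces the vector to vanish,
-- and otherwise, up to sign, z = 1, every xᵢ is 0 or 1, and every clause contains a
-- true literal.  So satisfiable formulas give a nonzero vector with all coordinates
-- in {−1, 0, 1}, whereas for the others every nonzero vector has a coordinate of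
-- absolute value at least 2.
--
-- A formula lists no clause twice, so the dimension M is at most 8 (n + 2)³.  Choose
-- 2 h < ε with h = 1 / k.  By Bernoulli (1 + h)ᵏ ≥ 2, so p = k (3 + 3 log₂ (n + 2))
-- gives M ≤ (1 + h)ᵖ, and satisfiable formulas have λ₁ ≤ δ = 1 + h, whereas the
-- others have λ₁ ≥ 2 > (2 − 2 h) (1 + h) ≥ (2 − ε) δ.  As p = O(log n), the bound
-- 2^(2^o(p)) · 2^o(n) is 2^o(n), contradicting ETH.
module Submission where

open import Defs
open import Algebra.Bundles using (module CommutativeRing)
open import Data.Bool as Bool using (Bool; true; false; if_then_else_; _∧_; _∨_)
import Data.Bool.Properties as Bool
open import Data.Empty using (⊥)
open import Data.Fin as Fin using (Fin; toℕ; _↑ˡ_; _↑ʳ_)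
import Data.Fin.Properties as Fin
open import Data.Integer as ℤ using (ℤ; +_; -[1+_]; 0ℤ; 1ℤ)
import Data.Integer.Properties as ℤ
open import Data.Integer.Tactic.RingSolver using () renaming (solve-∀ to solve-ℤ)
open import Data.List as List using (List; []; _∷_; _++_; _∷ʳ_; length)
import Data.List.Properties as List
open import Data.List.Relation.Unary.All using (All; []; _∷_)
open import Data.List.Relation.Unary.AllPairs using ([]; _∷_)
open import Data.List.Relation.Unary.Unique.Propositional using (Unique)
open import Data.Nat as ℕ using (ℕ; zero; suc; z≤n; s≤s)
import Data.Nat.Coprimality as Coprimality
open import Data.Nat.DivMod using (m/n≤m; m≡m%n+[m/n]*n; m%n<n)
open import Data.Nat.Logarithm using (⌈log₂_⌉; ⌈log₂⌉-mono-≤; ⌈log₂2^n⌉≡n)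
import Data.Nat.Properties as ℕ
open import Data.Nat.Tactic.RingSolver using (solve-∀)
open import Data.Product using (∃; ∃₂; _×_; _,_; proj₁; proj₂)
open import Data.Rational as ℚ using (ℚ; 0ℚ; 1ℚ; Positive; _÷_; 1/_)
import Data.Rational.Properties as ℚ
open import Data.Rational.Solver using (module +-*-Solver)
import Data.Rational.Unnormalised as ℚᵘ
import Data.Rational.Unnormalised.Properties as ℚᵘ
open import Data.Sum using (_⊎_; inj₁; inj₂; [_,_]′)
open import Data.Unit using (⊤)
open import Data.Vec as Vec using (Vec; []; _∷_)
import Data.Vec.Properties as Vec
open import Data.Vec.Relation.Unary.Any using (Any; here; there)
open import Function using (_∘_; _⇔_; mk⇔)
open import Relation.Binary.PropositionalEquality hiding ([_])
open import Relation.Nullary using (¬_; Dec; yes; no; does; contradiction)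
open import Relation.Nullary.Decidable using (dec-true; dec-false; does-⇔)
open import Algebra.Definitions.RawMonoid ℕ.+-0-rawMonoid using () renaming (sum to sumℕ)
open import Algebra.Definitions.RawMonoid ℚ.+-0-rawMonoid using (sum)
open import Algebra.Properties.CommutativeMonoid.Sum ℚ.+-0-commutativeMonoid
  using (∑-distrib-+; sum-cong-≗; sum-replicate-zero)
open import Algebra.Properties.Semiring.Exp (CommutativeRing.semiring ℚ.+-*-commutativeRing)
  using (^-assocʳ)
open import Algebra.Properties.Semiring.Sum (CommutativeRing.semiring ℚ.+-*-commutativeRing)
  using (*-distribˡ-sum)

-- `ETH` speaks of programs, so the reduction must itself be one, timed with the word length of the
-- formula, whereas `A` is timed with that of the lattice. It writes the encoded lattice into array
-- 5, runs `A` with all array numbers raised by 5, and copies the answer. All time beyond the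
-- exponential factor of `A` is polynomial in n + 2, hence at most 2^(c log (n + 2)), and c log (n +
-- 2) is again sublinear.
--
-- Both `Yes` and `No` ask for λ₁ as an attained minimum and not only for a bound on it. This
-- accounts for the rank n + 2, where n + 1 would encode the formula: the additional basis vector
-- provides an explicit shortest vector when there is no satisfying assignment. In the satisfiable
-- case a shortest vector is found by searching finitely many bit vectors, and vectors with a
-- coordinate of absolute value at least 2 cannot be shorter since M ≤ 2ᵖ.
--
-- Norms are compared through their p-th powers, which are natural numbers on this lattice; the cuts
-- are unfolded only at the ends.

-- Relocating programs in memory, and rules that bound running times

module Programs where
  open import Data.Nat using (_+_; _*_; _^_; _≤_; _<_; _⊔_)

  n≤2^n : ∀ n → n ≤ 2 ^ n
  n≤2^n zero    = z≤n
  n≤2^n (suc n) = ℕ.+-mono-≤ (ℕ.m^n>0 2 n)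
    (ℕ.≤-trans (n≤2^n n) (ℕ.≤-reflexive (sym (ℕ.+-identityʳ (2 ^ n)))))

  ⌈log₂⌉≤ : ∀ n → ⌈log₂ n ⌉ ≤ n
  ⌈log₂⌉≤ n = ℕ.≤-trans (⌈log₂⌉-mono-≤ (n≤2^n n)) (ℕ.≤-reflexive (⌈log₂2^n⌉≡n n))

  bits≤ : ∀ z → bits z ≤ suc ℤ.∣ z ∣
  bits≤ z = ⌈log₂⌉≤ (suc ℤ.∣ z ∣)

  -- Renumbering lets a whole program run as a subroutine: array `k` takes the place of its input
  -- array, and the arrays below `k` are never touched.
  shiftᴱ : ℕ → Expr → Expr
  shiftᴱ k (const z)  = const z
  shiftᴱ k (a [ e ])  = (k + a) [ shiftᴱ k e ]
  shiftᴱ k (op o e f) = op o (shiftᴱ k e) (shiftᴱ k f)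

  shiftᴾ : ℕ → Program → Program
  shiftᴾ k skip                    = skip
  shiftᴾ k (a [ e ]≔ f)            = (k + a) [ shiftᴱ k e ]≔ shiftᴱ k f
  shiftᴾ k (P ⨾ Q)                 = shiftᴾ k P ⨾ shiftᴾ k Q
  shiftᴾ k (if e then P else′ Q)   = if shiftᴱ k e then shiftᴾ k P else′ shiftᴾ k Q
  shiftᴾ k (while e do′ P)         = while shiftᴱ k e do′ shiftᴾ k P

  Embeds : ℕ → Memory → Memory → Set
  Embeds k σ τ = ∀ a i → σ (k + a) i ≡ τ a i

  +-cancelˡ-≡ᵇ : ∀ k a b → does (k + a ℕ.≟ k + b) ≡ does (a ℕ.≟ b)
  +-cancelˡ-≡ᵇ zero    a b = refl
  +-cancelˡ-≡ᵇ (suc k) a b = +-cancelˡ-≡ᵇ k a b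

  Embeds-update : ∀ k {σ τ} → Embeds k σ τ → ∀ a i z →
    Embeds k (σ [ k + a , i ↦ z ]) (τ [ a , i ↦ z ])
  Embeds-update k σ~τ a i z b j
    rewrite +-cancelˡ-≡ᵇ k a b | σ~τ b j = refl

  eval-shift : ∀ k {σ τ} → Embeds k σ τ → ∀ e → eval σ (shiftᴱ k e) ≡ eval τ e
  eval-shift k σ~τ (const z)  = refl
  eval-shift k {σ} σ~τ (a [ e ]) =
    trans (cong (σ (k + a)) (eval-shift k {σ} σ~τ e)) (σ~τ a _)
  eval-shift k {σ} σ~τ (op o e f) =
    cong₂ ⟦ o ⟧ (eval-shift k {σ} σ~τ e) (eval-shift k {σ} σ~τ f)

  module _ (V W : ℕ) .{{_ : ℕ.NonZero V}} .{{_ : ℕ.NonZero W}} where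

    private
      module V = Timed V
      module W = Timed W

    -- Changing the word length from W costs a factor of at most W, which is
    -- polynomial in the length of the input.
    charge-change : ∀ z → V.charge z ≤ W * W.charge z
    charge-change z = begin
      suc (b ℕ./ V)                 ≤⟨ s≤s (m/n≤m b V) ⟩
      suc b                         ≡⟨ cong suc (m≡m%n+[m/n]*n b W) ⟩
      suc (b ℕ.% W) + b ℕ./ W * W   ≤⟨ ℕ.+-monoˡ-≤ _ (m%n<n b W) ⟩
      suc (b ℕ./ W) * W             ≡⟨ ℕ.*-comm _ W ⟩
      W * suc (b ℕ./ W)             ∎
      where
      open ℕ.≤-Reasoning
      b = bits z

    private
      infixl 6 _⊕_
      _⊕_ : ∀ {a b c d} → a ≤ W * c → b ≤ W * d → a + b ≤ W * (c + d)
      _⊕_ {c = c} {d} p q =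
        ℕ.≤-trans (ℕ.+-mono-≤ p q) (ℕ.≤-reflexive (sym (ℕ.*-distribˡ-+ W c d)))

      charge-shift : ∀ k {σ τ} → Embeds k σ τ → ∀ e →
        V.charge (eval σ (shiftᴱ k e)) ≤ W * W.charge (eval τ e)
      charge-shift k {σ} {τ} σ~τ e = subst (λ z → V.charge z ≤ W * W.charge (eval τ e))
        (sym (eval-shift k {σ} σ~τ e)) (charge-change (eval τ e))

    cost-shift : ∀ k {σ τ} → Embeds k σ τ → ∀ e →
      V.cost σ (shiftᴱ k e) ≤ W * W.cost τ e
    cost-shift k σ~τ (const z) = charge-change z
    cost-shift k {σ} σ~τ e@(a [ f ]) = cost-shift k {σ} σ~τ f
      ⊕ charge-shift k {σ} σ~τ f ⊕ charge-shift k {σ} σ~τ e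
    cost-shift k {σ} σ~τ e@(op o f g) = cost-shift k {σ} σ~τ f ⊕ cost-shift k {σ} σ~τ g
      ⊕ charge-shift k {σ} σ~τ f ⊕ charge-shift k {σ} σ~τ g
      ⊕ charge-shift k {σ} σ~τ e

    -- The derivation is copied step by step. Only the arrays from `k` on have to agree with `τ`, so
    -- the lower ones may hold leftovers of an earlier computation.
    Run-shift : ∀ k {P σ τ τ′ t} → Embeds k σ τ → W.Run P τ τ′ t →
      ∃₂ λ σ′ t′ → V.Run (shiftᴾ k P) σ σ′ t′ × t′ ≤ W * t × Embeds k σ′ τ′
    Run-shift k {σ = σ} σ~τ W.skip =
      σ , 1 , V.skip , ℕ.*-mono-≤ (ℕ.>-nonZero⁻¹ W) (s≤s z≤n) , σ~τ
    Run-shift k {σ = σ} {τ} σ~τ (W.assign {a = a} {e₁} {e₂}) =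
      _ , _ , V.assign
      , cost-shift k {σ} σ~τ e₁ ⊕ cost-shift k {σ} σ~τ e₂
          ⊕ charge-shift k {σ} σ~τ e₁ ⊕ charge-shift k {σ} σ~τ e₂
      , subst₂ (λ i z → Embeds k (σ [ k + a , i ↦ z ]) (τ [ a , eval τ e₁ ↦ eval τ e₂ ]))
          (sym (eval-shift k {σ} σ~τ e₁)) (sym (eval-shift k {σ} σ~τ e₂))
          (Embeds-update k {σ} σ~τ a (eval τ e₁) (eval τ e₂))
    Run-shift k {σ = σ} σ~τ (W.seq P Q) =
      let _ , _ , P′ , p , σ~τ₁ = Run-shift k σ~τ P
          _ , _ , Q′ , q , σ~τ₂ = Run-shift k σ~τ₁ Q
      in _ , _ , V.seq P′ Q′ , p ⊕ q , σ~τ₂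
    Run-shift k {σ = σ} σ~τ (W.if-true {e} e≢0 P) =
      let _ , _ , P′ , p , σ~τ₁ = Run-shift k σ~τ P
      in _ , _ , V.if-true (λ eq → e≢0 (trans (sym (eval-shift k {σ} σ~τ e)) eq)) P′
       , cost-shift k {σ} σ~τ e ⊕ p , σ~τ₁
    Run-shift k {σ = σ} σ~τ (W.if-false {e} e≡0 Q) =
      let _ , _ , Q′ , q , σ~τ₁ = Run-shift k σ~τ Q
      in _ , _ , V.if-false (trans (eval-shift k {σ} σ~τ e) e≡0) Q′
       , cost-shift k {σ} σ~τ e ⊕ q , σ~τ₁
    Run-shift k {σ = σ} σ~τ (W.while-true {e} e≢0 P Q) =
      let _ , _ , P′ , p , σ~τ₁ = Run-shift k σ~τ P
          _ , _ , Q′ , q , σ~τ₂ = Run-shift k σ~τ₁ Q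
      in _ , _ , V.while-true (λ eq → e≢0 (trans (sym (eval-shift k {σ} σ~τ e)) eq)) P′ Q′
       , cost-shift k {σ} σ~τ e ⊕ p ⊕ q , σ~τ₂
    Run-shift k {σ = σ} σ~τ (W.while-false {e} e≡0) =
      _ , _ , V.while-false (trans (eval-shift k {σ} σ~τ e) e≡0) , cost-shift k {σ} σ~τ e , σ~τ

  -- Results of these operations have absolute value polynomial in those of the operands, unlike
  -- results of `shiftˡ`, so one bound on all memory cells bounds every value and cost. On a
  -- concrete expression the predicate computes to a product of unit types, so eta fills in its
  -- proofs.
  Arithmetic : Expr → Set
  Arithmetic (const z)       = ⊤
  Arithmetic (a [ e ])       = Arithmetic e
  Arithmetic (op o e f)      = ArithmeticOp o × Arithmetic e × Arithmetic f
    where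
    ArithmeticOp : Op → Set
    ArithmeticOp add   = ⊤
    ArithmeticOp sub   = ⊤
    ArithmeticOp mul   = ⊤
    ArithmeticOp less  = ⊤
    ArithmeticOp equal = ⊤
    ArithmeticOp _     = ⊥

  Bounded : ℕ → Memory → Set
  Bounded B σ = ∀ a i → ℤ.∣ σ a i ∣ ≤ B

  Bounded-update : ∀ {B σ z} → Bounded B σ → ∀ a i → ℤ.∣ z ∣ ≤ B →
    Bounded B (σ [ a , i ↦ z ])
  Bounded-update b a i z≤B c j with does (a ℕ.≟ c) ∧ does (i ℤ.≟ j)
  ... | true  = z≤B
  ... | false = b c j

  opBound : Op → ℕ → ℕ → ℕ
  opBound mul   u v = u * v
  opBound less  u v = 1
  opBound equal u v = 1
  opBound _     u v = u + v

  valueBound costBound : Expr → ℕ → ℕ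
  valueBound (const z)  B = ℤ.∣ z ∣
  valueBound (a [ e ])  B = B
  valueBound (op o e f) B = opBound o (valueBound e B) (valueBound f B)

  -- A step is charged at most 1 + ⌈log₂ (1 + |z|)⌉ ≤ 2 + |z| for the integer z.
  costBound (const z)     B = 2 + ℤ.∣ z ∣
  costBound (a [ e ])     B = costBound e B + (2 + valueBound e B) + (2 + B)
  costBound e@(op o f g)  B = costBound f B + costBound g B
    + (2 + valueBound f B) + (2 + valueBound g B) + (2 + valueBound e B)

  assignBound : Expr → Expr → ℕ → ℕ
  assignBound e f B =
    costBound e B + costBound f B + (2 + valueBound e B) + (2 + valueBound f B)

  eval-bound : ∀ {B σ} → Bounded B σ → ∀ e → Arithmetic e →
    ℤ.∣ eval σ e ∣ ≤ valueBound e B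
  eval-bound b (const z) _ = ℕ.≤-refl
  eval-bound b (a [ e ]) _ = b a _
  eval-bound {σ = σ} b (op add e f) (_ , p , q) =
    ℕ.≤-trans (ℤ.∣i+j∣≤∣i∣+∣j∣ (eval σ e) (eval σ f))
      (ℕ.+-mono-≤ (eval-bound {σ = σ} b e p) (eval-bound {σ = σ} b f q))
  eval-bound {σ = σ} b (op sub e f) (_ , p , q) =
    ℕ.≤-trans (ℤ.∣i-j∣≤∣i∣+∣j∣ (eval σ e) (eval σ f))
      (ℕ.+-mono-≤ (eval-bound {σ = σ} b e p) (eval-bound {σ = σ} b f q))
  eval-bound {σ = σ} b (op mul e f) (_ , p , q) =
    ℕ.≤-trans (ℕ.≤-reflexive (ℤ.abs-* (eval σ e) (eval σ f)))
      (ℕ.*-mono-≤ (eval-bound {σ = σ} b e p) (eval-bound {σ = σ} b f q))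
  eval-bound {σ = σ} b (op less e f) _ with does (eval σ e ℤ.<? eval σ f)
  ... | true  = ℕ.≤-refl
  ... | false = z≤n
  eval-bound {σ = σ} b (op equal e f) _ with does (eval σ e ℤ.≟ eval σ f)
  ... | true  = ℕ.≤-refl
  ... | false = z≤n

  module Rules (V : ℕ) .{{_ : ℕ.NonZero V}} where
    open Timed V public

    charge≤ : ∀ z → charge z ≤ 2 + ℤ.∣ z ∣
    charge≤ z = s≤s (ℕ.≤-trans (m/n≤m (bits z) V) (bits≤ z))

    private
      charge-eval : ∀ {B σ} → Bounded B σ → ∀ e → Arithmetic e →
        charge (eval σ e) ≤ 2 + valueBound e B
      charge-eval {σ = σ} b e p =
        ℕ.≤-trans (charge≤ (eval σ e)) (s≤s (s≤s (eval-bound {σ = σ} b e p)))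

    cost-bound : ∀ {B σ} → Bounded B σ → ∀ e → Arithmetic e →
      cost σ e ≤ costBound e B
    cost-bound b (const z) _ = charge≤ z
    cost-bound {σ = σ} b e@(a [ f ]) p = ℕ.+-mono-≤ (ℕ.+-mono-≤ (cost-bound {σ = σ} b f p)
      (charge-eval {σ = σ} b f p)) (charge-eval {σ = σ} b e p)
    cost-bound {σ = σ} b e@(op o f g) p@(_ , q , r) =
      ℕ.+-mono-≤ (ℕ.+-mono-≤ (ℕ.+-mono-≤ (ℕ.+-mono-≤
        (cost-bound {σ = σ} b f q) (cost-bound {σ = σ} b g r))
        (charge-eval {σ = σ} b f q)) (charge-eval {σ = σ} b g r))
        (charge-eval {σ = σ} b e p)

    -- Total correctness with a time bound: the semantic content of a Hoare triple, composed below
    -- along the text of the program.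
    Reaches : Program → Memory → ℕ → (Memory → Set) → Set
    Reaches P σ T Q = ∃₂ λ σ′ t → Run P σ σ′ t × t ≤ T × Q σ′

    assign-rule : ∀ {B σ} {Q : Memory → Set} a e f {_ : Arithmetic e} {_ : Arithmetic f} →
      Bounded B σ → Q (σ [ a , eval σ e ↦ eval σ f ]) →
      Reaches (a [ e ]≔ f) σ (assignBound e f B) Q
    assign-rule {σ = σ} a e f {p} {q} b post = _ , _ , assign ,
      ℕ.+-mono-≤ (ℕ.+-mono-≤ (ℕ.+-mono-≤ (cost-bound {σ = σ} b e p) (cost-bound {σ = σ} b f q))
        (charge-eval {σ = σ} b e p)) (charge-eval {σ = σ} b f q) , post

    infixr 4 _then_
    _then_ : ∀ {P R σ T T′} {Q Q′ : Memory → Set} → Reaches P σ T Q →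
      (∀ {σ′} → Q σ′ → Reaches R σ′ T′ Q′) → Reaches (P ⨾ R) σ (T + T′) Q′
    (_ , _ , run , t≤T , q) then rest =
      let _ , _ , run′ , t′≤T′ , q′ = rest q
      in _ , _ , seq run run′ , ℕ.+-mono-≤ t≤T t′≤T′ , q′

    weaken : ∀ {P σ T} {Q Q′ : Memory → Set} → (∀ {σ′} → Q σ′ → Q′ σ′) →
      Reaches P σ T Q → Reaches P σ T Q′
    weaken f (_ , _ , run , t≤T , q) = _ , _ , run , t≤T , f q

    relax : ∀ {P σ T T′} {Q : Memory → Set} → T ≤ T′ → Reaches P σ T Q → Reaches P σ T′ Q
    relax T≤T′ (_ , _ , run , t≤T , q) = _ , _ , run , ℕ.≤-trans t≤T T≤T′ , q

    -- `i` counts finished rounds, and the invariant decides the guard: true below `n`, false at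
    -- `n`. The factor is `suc k` because the guard is evaluated once more than the body.
    while-rule : ∀ {e P C T} (Inv : ℕ → Memory → Set) n →
      (∀ {i σ} → Inv i σ → cost σ e ≤ C) →
      (∀ {i σ} → i < n → Inv i σ → eval σ e ≢ 0ℤ × Reaches P σ T (Inv (suc i))) →
      (∀ {σ} → Inv n σ → eval σ e ≡ 0ℤ) →
      ∀ {σ} k i → i + k ≡ n → Inv i σ →
      Reaches (while e do′ P) σ (suc k * (C + T)) (Inv n)
    while-rule {C = C} {T} Inv n cost≤C step done zero i eq inv
      rewrite ℕ.+-identityʳ i | eq = _ , _ , while-false (done inv) ,
        ℕ.≤-trans (cost≤C inv) (ℕ.≤-trans (ℕ.m≤m+n C T) (ℕ.≤-reflexive (sym (ℕ.+-identityʳ (C + T))))) , inv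
    while-rule Inv n cost≤C step done (suc k) i eq inv =
      let i<n = ℕ.≤-trans (ℕ.m<m+n i (s≤s z≤n)) (ℕ.≤-reflexive eq)
          e≢0 , _ , _ , run , t≤T , inv′ = step i<n inv
          _ , _ , run′ , t′≤ , inv″ =
            while-rule Inv n cost≤C step done k (suc i) (trans (sym (ℕ.+-suc i k)) eq) inv′
      in _ , _ , while-true e≢0 run run′ , ℕ.+-mono-≤ (ℕ.+-mono-≤ (cost≤C inv) t≤T) t′≤ , inv″

open Programs

-- The program that writes the lattice of a formula, and its correctness

module LatticeProgram where
  open import Data.Nat using (_+_; _*_; _^_; _≤_; _<_; _⊔_)

  -- The logarithm rounded up, in the form that a doubling loop with guard "power < N" needs: the
  -- guard holds before round `L` and fails there.
  log-spec : ∀ N → ∃ λ L → N ≤ 2 ^ L × (∀ {i} → i < L → 2 ^ i < N)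
  log-spec zero    = 0 , z≤n , λ ()
  log-spec (suc N) with log-spec N
  ... | L , N≤ , <N with suc N ℕ.≤? 2 ^ L
  ... | yes N<  = L , N< , λ i<L → ℕ.m<n⇒m<1+n (<N i<L)
  ... | no  N≮  = suc L
    , ℕ.≤-trans (ℕ.+-mono-≤ (ℕ.m^n>0 2 L) N≤)
        (ℕ.≤-reflexive (cong (λ t → 2 ^ L + t) (sym (ℕ.+-identityʳ (2 ^ L)))))
    , λ { {i} (s≤s i≤L) → ℕ.≤-<-trans (ℕ.^-monoʳ-≤ 2 i≤L) (ℕ.≰⇒> N≮) }

  log : ℕ → ℕ
  log N = proj₁ (log-spec N)

  ≤2^log : ∀ N → N ≤ 2 ^ log N
  ≤2^log N = proj₁ (proj₂ (log-spec N))

  <log : ∀ N {i} → i < log N → 2 ^ i < N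
  <log N = proj₂ (proj₂ (log-spec N))

  2^log≤ : ∀ N .{{_ : ℕ.NonZero N}} → 2 ^ log N ≤ 2 * N
  2^log≤ N = go (log N) refl
    where
    go : ∀ l → l ≡ log N → 2 ^ l ≤ 2 * N
    go zero    eq = ℕ.*-mono-≤ {1} {2} (s≤s z≤n) (ℕ.>-nonZero⁻¹ N)
    go (suc i) eq = ℕ.*-monoʳ-≤ 2 (ℕ.<⇒≤ (<log N (ℕ.≤-reflexive eq)))

  log≤ : ∀ N .{{_ : ℕ.NonZero N}} → log N ≤ N
  log≤ N = go (log N) refl
    where
    go : ∀ l → l ≡ log N → l ≤ N
    go zero    eq = z≤n
    go (suc i) eq = ℕ.≤-<-trans (n≤2^n i) (<log N (ℕ.≤-reflexive eq))

  -- Appending to a loaded list is one update of the cell just past its end, because `nth` is 0 out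
  -- of range.
  nth-∷ʳ : ∀ xs z y → nth (xs ∷ʳ z) y ≡ (if does (length xs ℕ.≟ y) then z else nth xs y)
  nth-∷ʳ []       z zero    = refl
  nth-∷ʳ []       z (suc y) = refl
  nth-∷ʳ (x ∷ xs) z zero    = refl
  nth-∷ʳ (x ∷ xs) z (suc y) = nth-∷ʳ xs z y

  -- The recursion appends at the end, as a loop does, whereas the encoding of an instance tabulates
  -- from the front; `concats-tabulate` reconciles the two.
  concats : (ℕ → List ℤ) → ℕ → List ℤ
  concats h zero    = []
  concats h (suc n) = concats h n ++ h n

  concats-suc : ∀ h n → concats h (suc n) ≡ h 0 ++ concats (h ∘ suc) n
  concats-suc h zero    = sym (List.++-identityʳ (h 0))
  concats-suc h (suc n) = trans (cong (_++ h (suc n)) (concats-suc h n))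
    (List.++-assoc (h 0) (concats (h ∘ suc) n) (h (suc n)))

  concats-tabulate : ∀ n h (f : Fin n → List ℤ) → (∀ i → h (toℕ i) ≡ f i) →
    concats h n ≡ List.concat (List.tabulate f)
  concats-tabulate zero    h f eq = refl
  concats-tabulate (suc n) h f eq = trans (concats-suc h n)
    (cong₂ _++_ (eq Fin.zero) (concats-tabulate n (h ∘ suc) (f ∘ Fin.suc) (eq ∘ Fin.suc)))

  length-concats : ∀ {c} h → (∀ i → length (h i) ≡ c) → ∀ n → length (concats h n) ≡ n * c
  length-concats h eq zero = refl
  length-concats {c} h eq (suc n) = trans (List.length-++ (concats h n))
    (trans (cong₂ _+_ (length-concats h eq n) (eq n)) (ℕ.+-comm (n * c) c))

  less-< : ∀ {m n} → m < n → ⟦ less ⟧ (+ m) (+ n) ≡ 1ℤ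
  less-< {m} {n} m<n = cong (if_then 1ℤ else 0ℤ) (dec-true (+ m ℤ.<? + n) (ℤ.+<+ m<n))

  less-≥ : ∀ {m n} → n ≤ m → ⟦ less ⟧ (+ m) (+ n) ≡ 0ℤ
  less-≥ {m} {n} n≤m = cong (if_then 1ℤ else 0ℤ)
    (dec-false (+ m ℤ.<? + n) λ { (ℤ.+<+ m<n) → ℕ.<⇒≱ m<n n≤m })

  infixl 8 _⊞_ _⊟_
  infixl 9 _⊠_
  _⊞_ _⊟_ _⊠_ : Expr → Expr → Expr
  _⊞_ = op add
  _⊟_ = op sub
  _⊠_ = op mul

  infix 30 #_
  #_ : ℕ → Expr
  # n = const (+ n)

  cell : ℕ → Expr
  cell a = a [ # 0 ]

  -- Write x₀, …, xₙ₊₁ for the coefficients of a lattice vector and z for xₙ₊₁.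
  -- Coordinate j < n + 2 is 2 xⱼ − z.  A later coordinate belongs to a clause with
  -- literals ℓ₀, ℓ₁, ℓ₂ and is the sum of their values minus 2 z, where v has the
  -- value x_v and ¬ v the value z − x_v.
  litEntry : (n i ℓ : ℤ) → ℤ
  litEntry n i ℓ = ⟦ equal ⟧ ℓ (i ℤ.+ + 1) ℤ.- ⟦ equal ⟧ (ℓ ℤ.+ (i ℤ.+ + 1)) (+ 0)
    ℤ.+ ⟦ equal ⟧ (i ℤ.+ + 1) (n ℤ.+ + 2) ℤ.* ⟦ less ⟧ ℓ (+ 0)

  -- The kind of column is selected by multiplying with the 0/1 value of `less`, so that a
  -- branch-free expression of the program can compute the entry. The row with i + 1 = n + 2 is that
  -- of z.
  entryFrom : (n i j ℓ₀ ℓ₁ ℓ₂ : ℤ) → ℤ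
  entryFrom n i j ℓ₀ ℓ₁ ℓ₂ =
    ⟦ less ⟧ j (n ℤ.+ + 2) ℤ.*
      (+ 2 ℤ.* ⟦ equal ⟧ i j ℤ.- ⟦ equal ⟧ (i ℤ.+ + 1) (n ℤ.+ + 2))
    ℤ.+ (+ 1 ℤ.- ⟦ less ⟧ j (n ℤ.+ + 2)) ℤ.*
      (litEntry n i ℓ₀ ℤ.+ litEntry n i ℓ₁ ℤ.+ litEntry n i ℓ₂
        ℤ.- + 2 ℤ.* ⟦ equal ⟧ (i ℤ.+ + 1) (n ℤ.+ + 2))

  cong₃ : ∀ {A B C D : Set} (f : A → B → C → D) {a a′ b b′ c c′} →
    a ≡ a′ → b ≡ b′ → c ≡ c′ → f a b c ≡ f a′ b′ c′
  cong₃ f refl refl refl = refl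

  -- Two cells with the numbers of variables and clauses precede the literals, so `r` is 2, 3 or 4.
  -- For j < n + 2 the index is meaningless, but what is read there only enters a term that is
  -- multiplied by 0.
  literalIndex : (n j : ℤ) → ℕ → ℤ
  literalIndex n j r = (j ℤ.- (n ℤ.+ + 2)) ℤ.* + 3 ℤ.+ + r

  entryAt : (ℤ → ℤ) → (n i j : ℤ) → ℤ
  entryAt look n i j = entryFrom n i j
    (look (literalIndex n j 2)) (look (literalIndex n j 3)) (look (literalIndex n j 4))

  entryAt-cong : ∀ {f g} → (∀ x → f x ≡ g x) → ∀ n i j → entryAt f n i j ≡ entryAt g n i j
  entryAt-cong f≗g n i j = cong₃ (entryFrom n i j)
    (f≗g (literalIndex n j 2)) (f≗g (literalIndex n j 3)) (f≗g (literalIndex n j 4))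

  entry : List ℤ → (n i j : ℕ) → ℤ
  entry input n i j = entryAt (load input 0) (+ n) (+ i) (+ j)

  rankᴱ dimᴱ lastᴱ entryᴱ : Expr
  rankᴱ  = cell 0 ⊞ # 2
  dimᴱ   = rankᴱ ⊞ 0 [ # 1 ]
  lastᴱ  = op equal (cell 3 ⊞ # 1) rankᴱ
  entryᴱ =
    op less (cell 4) rankᴱ ⊠ (# 2 ⊠ op equal (cell 3) (cell 4) ⊟ lastᴱ)
    ⊞ (# 1 ⊟ op less (cell 4) rankᴱ) ⊠ (lit 2 ⊞ lit 3 ⊞ lit 4 ⊟ # 2 ⊠ lastᴱ)
    where
    lit : ℕ → Expr
    lit r = op equal ℓ (cell 3 ⊞ # 1) ⊟ op equal (ℓ ⊞ (cell 3 ⊞ # 1)) (# 0) ⊞ lastᴱ ⊠ op less ℓ (# 0)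
      where ℓ = 0 [ (cell 4 ⊟ rankᴱ) ⊠ # 3 ⊞ # r ]

  -- Array 0 holds the formula, 1 a power of two and 2 its exponent, 3 and 4 the row
  -- and column counters, and 5 the lattice: a program shifted by 5 finds it in its
  -- own array 0.
  module Build (k : ℕ) (a b : ℤ) where

    normᴱ : Expr
    normᴱ = # k ⊠ (# 3 ⊞ # 3 ⊠ cell 2)

    -- Five header cells (rank, dimension, norm, numerator and denominator of the threshold) come
    -- before the matrix, which takes two cells per entry: `r` is 0 for the numerator and 1 for the
    -- denominator.
    posᴱ : ℕ → Expr
    posᴱ r = # (5 + r) ⊞ # 2 ⊠ (cell 3 ⊠ dimᴱ ⊞ cell 4)

    writeRow buildLog buildHeader buildRows build : Program
    writeRow =
      while op less (cell 4) dimᴱ do′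
        (5 [ posᴱ 0 ]≔ entryᴱ ⨾ 5 [ posᴱ 1 ]≔ # 1 ⨾ 4 [ # 0 ]≔ cell 4 ⊞ # 1)
    buildLog = 1 [ # 0 ]≔ # 1 ⨾
      while op less (cell 1) rankᴱ do′
        (1 [ # 0 ]≔ cell 1 ⊞ cell 1 ⨾ 2 [ # 0 ]≔ cell 2 ⊞ # 1)
    buildHeader = 5 [ # 0 ]≔ rankᴱ ⨾ 5 [ # 1 ]≔ dimᴱ ⨾ 5 [ # 2 ]≔ normᴱ ⨾
      5 [ # 3 ]≔ const a ⨾ 5 [ # 4 ]≔ const b
    buildRows =
      while op less (cell 3) rankᴱ do′
        (4 [ # 0 ]≔ # 0 ⨾ writeRow ⨾ 3 [ # 0 ]≔ cell 3 ⊞ # 1)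
    build = buildLog ⨾ buildHeader ⨾ buildRows

    -- Each mirrors the text of its program, with up to `B` rounds for every loop. Being sums and
    -- products of `costBound` and `assignBound`, they are visibly polynomial.
    logTime headerTime rowTime rowsTime buildTime : ℕ → ℕ
    logTime B = assignBound (# 0) (# 1) B + suc B *
      (costBound (op less (cell 1) rankᴱ) B +
        (assignBound (# 0) (cell 1 ⊞ cell 1) B + assignBound (# 0) (cell 2 ⊞ # 1) B))
    headerTime B = assignBound (# 0) rankᴱ B + (assignBound (# 1) dimᴱ B +
      (assignBound (# 2) normᴱ B + (assignBound (# 3) (const a) B + assignBound (# 4) (const b) B)))
    rowTime B = suc B * (costBound (op less (cell 4) dimᴱ) B +
      (assignBound (posᴱ 0) entryᴱ B + (assignBound (posᴱ 1) (# 1) B +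
        assignBound (# 0) (cell 4 ⊞ # 1) B)))
    rowsTime B = suc B * (costBound (op less (cell 3) rankᴱ) B +
      (assignBound (# 0) (# 0) B + (rowTime B + assignBound (# 0) (cell 3 ⊞ # 1) B)))
    buildTime B = logTime B + (headerTime B + rowsTime B)

    -- 25 is valueBound entryᴱ B, which does not depend on B.
    module Correct (V : ℕ) .{{_ : ℕ.NonZero V}} (input : List ℤ) (n m B : ℕ)
      (n≡ : load input 0 (+ 0) ≡ + n) (m≡ : load input 0 (+ 1) ≡ + m)
      (input≤B : Bounded B (load input))
      (25≤B : 25 ≤ B) (2N≤B : 2 * (n + 2) ≤ B) (M≤B : n + 2 + m ≤ B)
      (p≤B : k * (3 + 3 * log (n + 2)) ≤ B) (a≤B : ℤ.∣ a ∣ ≤ B) (b≤B : ℤ.∣ b ∣ ≤ B)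
      where

      open Rules V

      N M L : ℕ
      N = n + 2
      M = N + m
      L = log N

      rowᴸ : ℕ → ℕ → List ℤ
      rowᴸ i = concats (λ j → entry input n i j ∷ + 1 ∷ [])

      header output : List ℤ
      header = + N ∷ + M ∷ + (k * (3 + 3 * L)) ∷ a ∷ b ∷ []
      output = header ++ concats (λ i → rowᴸ i M) N

      -- `out` fixes array 5 completely, zeros included, and `rest` keeps all later arrays blank: a
      -- program shifted by 5 must find exactly the memory that `load` would give it.
      record State (pw l i j : ℕ) (xs : List ℤ) (σ : Memory) : Set where
        field
          reads : ∀ x → σ 0 x ≡ load input 0 x
          at-pw : σ 1 0ℤ ≡ + pw
          at-l  : σ 2 0ℤ ≡ + l
          at-i  : σ 3 0ℤ ≡ + i
          at-j  : σ 4 0ℤ ≡ + j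
          out   : ∀ x → σ 5 x ≡ load xs 0 x
          rest  : ∀ c x → σ (6 + c) x ≡ 0ℤ
          bound : Bounded B σ

      open State

      private variable
        pw pw′ l l′ i i′ j j′ : ℕ
        xs : List ℤ
        σ : Memory
        z : ℤ

      recast : ∀ {ys} → xs ≡ ys → State pw l i j xs σ → State pw l i j ys σ
      recast refl s = s

      -- The array number is a literal, so reading another array of the updated memory computes back
      -- to `σ` and the other fields carry over unchanged.
      set-pw : State pw l i j xs σ → z ≡ + pw′ → pw′ ≤ B →
        State pw′ l i j xs (σ [ 1 , 0ℤ ↦ z ])
      set-pw {σ = σ} s refl ≤B = record
        { reads = reads s ; at-pw = refl ; at-l = at-l s ; at-i = at-i s ; at-j = at-j s
        ; out = out s ; rest = rest s ; bound = Bounded-update {σ = σ} (bound s) 1 0ℤ ≤B }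

      set-l : State pw l i j xs σ → z ≡ + l′ → l′ ≤ B →
        State pw l′ i j xs (σ [ 2 , 0ℤ ↦ z ])
      set-l {σ = σ} s refl ≤B = record
        { reads = reads s ; at-pw = at-pw s ; at-l = refl ; at-i = at-i s ; at-j = at-j s
        ; out = out s ; rest = rest s ; bound = Bounded-update {σ = σ} (bound s) 2 0ℤ ≤B }

      set-i : State pw l i j xs σ → z ≡ + i′ → i′ ≤ B →
        State pw l i′ j xs (σ [ 3 , 0ℤ ↦ z ])
      set-i {σ = σ} s refl ≤B = record
        { reads = reads s ; at-pw = at-pw s ; at-l = at-l s ; at-i = refl ; at-j = at-j s
        ; out = out s ; rest = rest s ; bound = Bounded-update {σ = σ} (bound s) 3 0ℤ ≤B }

      set-j : State pw l i j xs σ → z ≡ + j′ → j′ ≤ B →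
        State pw l i j′ xs (σ [ 4 , 0ℤ ↦ z ])
      set-j {σ = σ} s refl ≤B = record
        { reads = reads s ; at-pw = at-pw s ; at-l = at-l s ; at-i = at-i s ; at-j = refl
        ; out = out s ; rest = rest s ; bound = Bounded-update {σ = σ} (bound s) 4 0ℤ ≤B }

      emit : ∀ {x} → State pw l i j xs σ → x ≡ + length xs → ℤ.∣ z ∣ ≤ B →
        State pw l i j (xs ∷ʳ z) (σ [ 5 , x ↦ z ])
      emit {xs = xs} {σ = σ} {z = z} s refl ≤B = record
        { reads = reads s ; at-pw = at-pw s ; at-l = at-l s ; at-i = at-i s ; at-j = at-j s
        ; out = out′ ; rest = rest s
        ; bound = Bounded-update {σ = σ} (bound s) 5 (+ length xs) ≤B }
        where
        out′ : ∀ x → (σ [ 5 , + length xs ↦ z ]) 5 x ≡ load (xs ∷ʳ z) 0 x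
        out′ -[1+ y ] = out s -[1+ y ]
        out′ (+ y) = trans (cong (if does (length xs ℕ.≟ y) then z else_) (out s (+ y)))
          (sym (nth-∷ʳ xs z y))

      N≤B : N ≤ B
      N≤B = ℕ.≤-trans (ℕ.m≤m+n N (N + 0)) 2N≤B

      eval-rank : State pw l i j xs σ → eval σ rankᴱ ≡ + N
      eval-rank s = cong (ℤ._+ + 2) (trans (reads s (+ 0)) n≡)

      eval-dim : State pw l i j xs σ → eval σ dimᴱ ≡ + M
      eval-dim s = cong₂ ℤ._+_ (eval-rank s) (trans (reads s (+ 1)) m≡)

      eval-less : ∀ {u v} σ e f → eval σ e ≡ + u → eval σ f ≡ + v → u < v →
        eval σ (op less e f) ≢ 0ℤ
      eval-less σ e f e≡ f≡ u<v eq
        with trans (sym (trans (cong₂ ⟦ less ⟧ e≡ f≡) (less-< u<v))) eq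
      ... | ()

      eval-not-less : ∀ {u v} σ e f → eval σ e ≡ + u → eval σ f ≡ + v → v ≤ u →
        eval σ (op less e f) ≡ 0ℤ
      eval-not-less σ e f e≡ f≡ v≤u = trans (cong₂ ⟦ less ⟧ e≡ f≡) (less-≥ v≤u)

      log-correct : State 0 0 0 0 [] σ →
        Reaches buildLog σ (logTime B) (State (2 ^ L) L 0 0 [])
      log-correct s =
        assign-rule {Q = State 1 0 0 0 []} 1 (# 0) (# 1) (bound s)
          (set-pw s refl (ℕ.≤-trans (s≤s z≤n) 25≤B))
        then λ s₁ → relax (ℕ.*-monoˡ-≤ _ (s≤s L≤B))
          (while-rule (λ i → State (2 ^ i) i 0 0 []) L
            (λ {_} {σ} s → cost-bound {σ = σ} (bound s) (op less (cell 1) rankᴱ) _)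
            (λ {_} {σ} i<L s → eval-less σ (cell 1) rankᴱ (at-pw s) (eval-rank s) (<log N i<L) , double i<L s)
            (λ {σ} s → eval-not-less σ (cell 1) rankᴱ (at-pw s) (eval-rank s) (≤2^log N))
            L 0 refl s₁)
        where
        instance
          N≢0 : ℕ.NonZero N
          N≢0 = ℕ.>-nonZero (ℕ.≤-trans (s≤s z≤n) (ℕ.m≤n+m 2 n))
        L≤B : L ≤ B
        L≤B = ℕ.≤-trans (log≤ N) N≤B
        double : ∀ {i σ} → i < L → State (2 ^ i) i 0 0 [] σ →
          Reaches _ σ _ (State (2 ^ suc i) (suc i) 0 0 [])
        double {i} i<L s =
          assign-rule {Q = State (2 ^ suc i) i 0 0 []} 1 (# 0) (cell 1 ⊞ cell 1) (bound s)
            (set-pw s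
              (trans (cong₂ ℤ._+_ (at-pw s) (at-pw s))
                (cong (λ t → + ((2 ^ i) + t)) (sym (ℕ.+-identityʳ (2 ^ i)))))
              -- The last power of two may exceed `N`, but not 2 `N`; this is what the hypothesis
              -- `2N≤B` provides for.
              (ℕ.≤-trans (ℕ.^-monoʳ-≤ 2 i<L) (ℕ.≤-trans (2^log≤ N) 2N≤B)))
          then λ s → assign-rule 2 (# 0) (cell 2 ⊞ # 1) (bound s)
            (set-l s (trans (cong (ℤ._+ + 1) (at-l s)) (cong +_ (ℕ.+-comm i 1)))
              (ℕ.≤-trans i<L L≤B))

      header-correct : State pw L 0 0 [] σ →
        Reaches buildHeader σ (headerTime B) (State pw L 0 0 header)
      header-correct {pw} s =
        assign-rule {Q = State pw L 0 0 (+ N ∷ [])} 5 (# 0) rankᴱ (bound s)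
          (emit′ s refl (eval-rank s) N≤B)
        then λ s → assign-rule {Q = State pw L 0 0 (+ N ∷ + M ∷ [])} 5 (# 1) dimᴱ (bound s)
          (emit′ s refl (eval-dim s) M≤B)
        then λ s → assign-rule {Q = State pw L 0 0 (+ N ∷ + M ∷ + (k * (3 + 3 * L)) ∷ [])}
          5 (# 2) normᴱ (bound s) (emit′ s refl (eval-norm s) p≤B)
        then λ s → assign-rule {Q = State pw L 0 0 (+ N ∷ + M ∷ + (k * (3 + 3 * L)) ∷ a ∷ [])}
          5 (# 3) (const a) (bound s) (emit s refl a≤B)
        then λ s → assign-rule 5 (# 4) (const b) (bound s) (emit s refl b≤B)
        where
        emit′ : ∀ {pw l i j xs σ x y z} → State pw l i j xs σ → x ≡ + length xs → z ≡ y →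
          ℤ.∣ y ∣ ≤ B → State pw l i j (xs ∷ʳ y) (σ [ 5 , x ↦ z ])
        emit′ s x≡ refl y≤B = emit s x≡ y≤B
        eval-norm : State pw L i j xs σ → eval σ normᴱ ≡ + (k * (3 + 3 * L))
        eval-norm s rewrite at-l s | sym (ℤ.pos-* 3 L) | sym (ℤ.pos-* k (3 + 3 * L)) = refl

      length-row : ∀ i j → length (rowᴸ i j) ≡ j * 2
      length-row i = length-concats _ (λ _ → refl)

      written : ℕ → ℕ → List ℤ
      written i j = (header ++ concats (λ i → rowᴸ i M) i) ++ rowᴸ i j

      length-written : ∀ i j → length (written i j) ≡ 5 + 2 * (i * M + j)
      length-written i j = begin
        length (written i j)
          ≡⟨ List.length-++ (header ++ concats (λ i → rowᴸ i M) i) ⟩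
        length (header ++ concats (λ i → rowᴸ i M) i) + length (rowᴸ i j)
          ≡⟨ cong₂ (λ s t → 5 + s + t) (length-concats (λ i → rowᴸ i M) (λ i → length-row i M) i) (length-row i j) ⟩
        5 + i * (M * 2) + j * 2
          ≡⟨ arith i M j ⟩
        5 + 2 * (i * M + j) ∎
        where
        open ≡-Reasoning
        arith : ∀ i M j → 5 + i * (M * 2) + j * 2 ≡ 5 + 2 * (i * M + j)
        arith = solve-∀

      eval-pos : ∀ r → State pw l i j xs σ → eval σ (posᴱ r) ≡ + (5 + r + 2 * (i * M + j))
      eval-pos {i = i} {j} r s
        rewrite eval-dim s | at-i s | at-j s | sym (ℤ.pos-* i M) | sym (ℤ.pos-* 2 (i * M + j)) = refl

      emit-entry : ∀ {i j} → j < M → State pw l i j (written i j) σ →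
        Reaches (5 [ posᴱ 0 ]≔ entryᴱ ⨾ 5 [ posᴱ 1 ]≔ # 1 ⨾ 4 [ # 0 ]≔ cell 4 ⊞ # 1) σ
          (assignBound (posᴱ 0) entryᴱ B + (assignBound (posᴱ 1) (# 1) B +
            assignBound (# 0) (cell 4 ⊞ # 1) B))
          (State pw l i (suc j) (written i (suc j)))
      emit-entry {pw = pw} {l} {σ} {i} {j} j<M s =
        assign-rule {Q = State pw l i j (written i j ∷ʳ entry input n i j)} 5 (posᴱ 0) entryᴱ (bound s)
          (recast (cong (written i j ∷ʳ_) entry≡)
            (emit s (trans (eval-pos 0 s) (cong +_ (sym (length-written i j))))
              (ℕ.≤-trans (eval-bound {σ = σ} (bound s) entryᴱ _) 25≤B)))
        then λ s → assign-rule {Q = State pw l i j (written i (suc j))} 5 (posᴱ 1) (# 1) (bound s)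
          (recast append
            (emit s (trans (eval-pos 1 s) (cong +_ (sym length₁))) (ℕ.≤-trans (s≤s z≤n) 25≤B)))
        then λ s → assign-rule 4 (# 0) (cell 4 ⊞ # 1) (bound s)
          (set-j s (trans (cong (ℤ._+ + 1) (at-j s)) (cong +_ (ℕ.+-comm j 1)))
            (ℕ.≤-trans j<M M≤B))
        where
        entry≡ : eval σ entryᴱ ≡ entry input n i j
        -- By computation alone, `eval σ entryᴱ` is `entryAt (σ 0)` at the contents of the three
        -- cells.
        entry≡ = trans (cong₃ (entryAt (σ 0)) (trans (reads s (+ 0)) n≡) (at-i s) (at-j s))
          (entryAt-cong (reads s) (+ n) (+ i) (+ j))
        length₁ : length (written i j ∷ʳ entry input n i j) ≡ 6 + 2 * (i * M + j)
        length₁ = trans (List.length-++ (written i j))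
          (trans (ℕ.+-comm (length (written i j)) 1) (cong suc (length-written i j)))
        append : (written i j ∷ʳ entry input n i j) ∷ʳ + 1 ≡ written i (suc j)
        append = trans (List.++-assoc (written i j) _ _)
          (List.++-assoc (header ++ concats (λ i → rowᴸ i M) i) (rowᴸ i j) _)

      row-correct : ∀ {i} → State pw l i 0 (written i 0) σ →
        Reaches writeRow σ (rowTime B) (State pw l i M (written i M))
      row-correct {pw = pw} {l} {i = i} s = relax (ℕ.*-monoˡ-≤ _ (s≤s M≤B))
        (while-rule (λ j → State pw l i j (written i j)) M
          (λ {_} {σ} s → cost-bound {σ = σ} (bound s) (op less (cell 4) dimᴱ) _)
          (λ {_} {σ} j<M s → eval-less σ (cell 4) dimᴱ (at-j s) (eval-dim s) j<M , emit-entry j<M s)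
          (λ {σ} s → eval-not-less σ (cell 4) dimᴱ (at-j s) (eval-dim s) ℕ.≤-refl)
          M 0 refl s)

      -- Between rows the column counter is left existential: it is 0 before the first row and `M`
      -- after each one.
      rows-correct : State pw l 0 0 header σ →
        Reaches buildRows σ (rowsTime B) (λ σ → ∃ λ j → State pw l N j output σ)
      rows-correct {pw} {l} s = relax (ℕ.*-monoˡ-≤ _ (s≤s N≤B))
        (while-rule Inv N
          (λ {_} {σ} (_ , s) → cost-bound {σ = σ} (bound s) (op less (cell 3) rankᴱ) _)
          (λ {_} {σ} i<N (_ , s) → eval-less σ (cell 3) rankᴱ (at-i s) (eval-rank s) i<N , one-row i<N s)
          (λ {σ} (_ , s) → eval-not-less σ (cell 3) rankᴱ (at-i s) (eval-rank s) ℕ.≤-refl)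
          N 0 refl (0 , s))
        where
        done : ℕ → List ℤ
        done i = header ++ concats (λ i → rowᴸ i M) i
        Inv : ℕ → Memory → Set
        Inv i σ = ∃ λ j → State pw l i j (done i) σ
        one-row : ∀ {i j σ} → i < N → State pw l i j (done i) σ → Reaches _ σ _ (Inv (suc i))
        one-row {i} i<N s =
          assign-rule {Q = State pw l i 0 (written i 0)} 4 (# 0) (# 0) (bound s)
            (set-j (recast (sym (List.++-identityʳ (done i))) s) refl z≤n)
          then λ s → row-correct s
          then λ s → assign-rule 3 (# 0) (cell 3 ⊞ # 1) (bound s)
            (M , set-i (recast
                   (List.++-assoc header (concats (λ i → rowᴸ i M) i) (rowᴸ i M)) s)
                 (trans (cong (ℤ._+ + 1) (at-i s)) (cong +_ (ℕ.+-comm i 1)))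
                 (ℕ.≤-trans i<N N≤B))

      build-correct : Reaches build (load input) (buildTime B)
        (λ σ → Bounded B σ × Embeds 5 σ (load output))
      build-correct =
        log-correct initial then λ s → header-correct s then λ s →
        weaken (λ (_ , s) → bound s , λ { zero x → out s x ; (suc c) x → rest s c x })
          (rows-correct s)
        where
        initial : State 0 0 0 0 [] (load input)
        initial = record
          { reads = λ _ → refl ; at-pw = refl ; at-l = refl ; at-i = refl ; at-j = refl
          ; out = λ { (+ y) → refl ; -[1+ y ] → refl } ; rest = λ _ _ → refl
          ; bound = input≤B }

open LatticeProgram

-- Coordinates of lattice vectors as linear forms, and linear independence

module LatticeColumns where

  ι : ℤ → ℚ
  ι z = z ℚ./ 1

  -- `z / 1` is stuck on a gcd when `z` is a variable; the laws of `ι` are therefore proved on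
  -- unnormalised fractions.
  toℚᵘ-ι : ∀ z → ℚ.toℚᵘ (ι z) ℚᵘ.≃ ℚᵘ.mkℚᵘ z 0
  toℚᵘ-ι z = ℚ.toℚᵘ-fromℚᵘ (ℚᵘ.mkℚᵘ z 0)

  ι-+ : ∀ a b → ι (a ℤ.+ b) ≡ ι a ℚ.+ ι b
  ι-+ a b = ℚ.toℚᵘ-injective (begin
    ℚ.toℚᵘ (ι (a ℤ.+ b))             ≈⟨ toℚᵘ-ι (a ℤ.+ b) ⟩
    ℚᵘ.mkℚᵘ (a ℤ.+ b) 0             ≈⟨ ℚᵘ.*≡* (arith a b) ⟩
    ℚᵘ.mkℚᵘ a 0 ℚᵘ.+ ℚᵘ.mkℚᵘ b 0   ≈⟨ ℚᵘ.+-cong (toℚᵘ-ι a) (toℚᵘ-ι b) ⟨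
    ℚ.toℚᵘ (ι a) ℚᵘ.+ ℚ.toℚᵘ (ι b) ≈⟨ ℚ.toℚᵘ-homo-+ (ι a) (ι b) ⟨
    ℚ.toℚᵘ (ι a ℚ.+ ι b)            ∎)
    where
    open import Relation.Binary.Reasoning.Setoid ℚᵘ.≃-setoid
    arith : ∀ a b → (a ℤ.+ b) ℤ.* + 1 ≡ (a ℤ.* + 1 ℤ.+ b ℤ.* + 1) ℤ.* + 1
    arith = solve-ℤ

  ι-* : ∀ a b → ι (a ℤ.* b) ≡ ι a ℚ.* ι b
  ι-* a b = ℚ.toℚᵘ-injective (begin
    ℚ.toℚᵘ (ι (a ℤ.* b))             ≈⟨ toℚᵘ-ι (a ℤ.* b) ⟩
    ℚᵘ.mkℚᵘ (a ℤ.* b) 0             ≈⟨ ℚᵘ.*≡* refl ⟩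
    ℚᵘ.mkℚᵘ a 0 ℚᵘ.* ℚᵘ.mkℚᵘ b 0   ≈⟨ ℚᵘ.*-cong (toℚᵘ-ι a) (toℚᵘ-ι b) ⟨
    ℚ.toℚᵘ (ι a) ℚᵘ.* ℚ.toℚᵘ (ι b) ≈⟨ ℚ.toℚᵘ-homo-* (ι a) (ι b) ⟨
    ℚ.toℚᵘ (ι a ℚ.* ι b)            ∎)
    where open import Relation.Binary.Reasoning.Setoid ℚᵘ.≃-setoid

  -- A fraction with denominator 1 is already in lowest terms. This is why the program writes each
  -- entry followed by 1.
  encodeℚ-ι : ∀ z → encodeℚ (ι z) ≡ z ∷ + 1 ∷ []
  encodeℚ-ι z = cong encodeℚ
    (ℚ.↥p/↧p≡p (ℚ.mkℚ z 0 (Coprimality.sym (Coprimality.1-coprimeTo ℤ.∣ z ∣))))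

  ι-neg : ∀ a → ι (ℤ.- a) ≡ ℚ.- ι a
  ι-neg (+ zero)  = refl
  ι-neg ℤ.+[1+ n ] = refl
  ι-neg -[1+ n ] = sym (neg-involutive _)
    where
    neg-involutive : ∀ q → ℚ.- (ℚ.- q) ≡ q
    neg-involutive (ℚ.mkℚ ℤ.+[1+ _ ] _ _) = refl
    neg-involutive (ℚ.mkℚ ℤ.+0 _ _)       = refl
    neg-involutive (ℚ.mkℚ -[1+ _ ] _ _)   = refl

  ι-- : ∀ a b → ι (a ℤ.- b) ≡ ι a ℚ.- ι b
  ι-- a b = trans (ι-+ a (ℤ.- b)) (cong (ι a ℚ.+_) (ι-neg b))

  ι-mono-≤ : ∀ {a b} → a ℤ.≤ b → ι a ℚ.≤ ι b
  ι-mono-≤ {a} {b} a≤b = ℚ.toℚᵘ-cancel-≤ (ℚᵘ.≤-respʳ-≃ (ℚᵘ.≃-sym (toℚᵘ-ι b))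
    (ℚᵘ.≤-respˡ-≃ (ℚᵘ.≃-sym (toℚᵘ-ι a)) (ℚᵘ.*≤* (ℤ.*-monoʳ-≤-nonNeg (+ 1) a≤b))))

  ∣ι∣ : ∀ z → ℚ.∣ ι z ∣ ≡ ι (+ ℤ.∣ z ∣)
  ∣ι∣ (+ n)    = ℚ.0≤p⇒∣p∣≡p (ι-mono-≤ {0ℤ} {+ n} (ℤ.+≤+ z≤n))
  ∣ι∣ -[1+ n ] = trans (ℚ.∣-p∣≡∣p∣ (ι ℤ.+[1+ n ])) (∣ι∣ ℤ.+[1+ n ])

  κ : ℕ → ℕ → ℤ
  κ a b = if does (a ℕ.≟ b) then 1ℤ else 0ℤ

  equal-κ : ∀ {x y a b} → (x ≡ y ⇔ a ≡ b) → ⟦ equal ⟧ x y ≡ κ a b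
  equal-κ {x} {y} {a} {b} iff = cong (if_then 1ℤ else 0ℤ) (does-⇔ iff (x ℤ.≟ y) (a ℕ.≟ b))

  equal-≢ : ∀ {x y} → x ≢ y → ⟦ equal ⟧ x y ≡ 0ℤ
  equal-≢ {x} {y} x≢y = cong (if_then 1ℤ else 0ℤ) (dec-false (x ℤ.≟ y) x≢y)

  last-κ : ∀ n i → ⟦ equal ⟧ (+ i ℤ.+ + 1) (+ n ℤ.+ + 2) ≡ κ i (suc n)
  last-κ n i = equal-κ {a = i} {suc n} (mk⇔
    (λ eq → ℕ.suc-injective (trans (ℕ.+-comm 1 i) (trans (ℤ.+-injective eq) (ℕ.+-comm n 2))))
    (λ { refl → cong +_ (trans (ℕ.+-comm i 1) (ℕ.+-comm 2 n)) }))

  -- Variables are numbered from 1 in encoded literals, so that variable 0 has a sign too; hence the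
  -- comparisons with i + 1.
  litEntry-pos : ∀ n i v → litEntry (+ n) (+ i) (+ suc v) ≡ κ i v
  litEntry-pos n i v = trans (cong₂ ℤ._+_
    (cong₂ ℤ._-_ (equal-κ {a = i} {v} (mk⇔
        (λ eq → sym (ℕ.suc-injective (trans (ℤ.+-injective eq) (ℕ.+-comm i 1))))
        (λ { refl → cong +_ (ℕ.+-comm 1 i) })))
      (equal-≢ {+ suc v ℤ.+ (+ i ℤ.+ + 1)} {0ℤ} λ ()))
    (trans (cong (⟦ equal ⟧ (+ i ℤ.+ + 1) (+ n ℤ.+ + 2) ℤ.*_) (less-≥ {suc v} {0} z≤n))
      (ℤ.*-zeroʳ (⟦ equal ⟧ (+ i ℤ.+ + 1) (+ n ℤ.+ + 2)))))
    (trans (ℤ.+-identityʳ (κ i v ℤ.- 0ℤ)) (ℤ.+-identityʳ (κ i v)))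

  litEntry-neg : ∀ n i v → litEntry (+ n) (+ i) -[1+ v ] ≡ κ i (suc n) ℤ.- κ i v
  litEntry-neg n i v = trans (cong₂ ℤ._+_
    (cong₂ ℤ._-_ (equal-≢ { -[1+ v ]} {+ i ℤ.+ + 1} λ ())
      (equal-κ {a = i} {v} (mk⇔ to from)))
    (cong (ℤ._* + 1) (last-κ n i)))
    (arith (κ i v) (κ i (suc n)))
    where
    arith : ∀ a b → (0ℤ ℤ.- a) ℤ.+ b ℤ.* + 1 ≡ b ℤ.- a
    arith = solve-ℤ
    to : -[1+ v ] ℤ.+ (+ i ℤ.+ + 1) ≡ + 0 → i ≡ v
    to eq = ℕ.suc-injective (trans (ℕ.+-comm 1 i) (sym (ℤ.+-injective
      (ℤ.i-j≡0⇒i≡j (+ suc v) (+ i ℤ.+ + 1) (trans (flip (+ suc v) (+ i ℤ.+ + 1)) (cong ℤ.-_ eq))))))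
      where
      flip : ∀ a b → a ℤ.- b ≡ ℤ.- (ℤ.- a ℤ.+ b)
      flip = solve-ℤ
    from : i ≡ v → -[1+ v ] ℤ.+ (+ i ℤ.+ + 1) ≡ + 0
    from refl = trans (cong (λ t → -[1+ i ] ℤ.+ + t) (ℕ.+-comm i 1)) (ℤ.+-inverseˡ (+ suc i))

  entry-diagonal : ∀ input n i j → j ℕ.< n ℕ.+ 2 →
    entry input n i j ≡ + 2 ℤ.* κ i j ℤ.- κ i (suc n)
  entry-diagonal input n i j j<N = trans
    (cong (λ t → t ℤ.* (+ 2 ℤ.* ⟦ equal ⟧ (+ i) (+ j) ℤ.- ⟦ equal ⟧ (+ i ℤ.+ + 1) (+ n ℤ.+ + 2))
       ℤ.+ (+ 1 ℤ.- t) ℤ.* rest) (less-< j<N))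
    (trans (arith (+ 2 ℤ.* ⟦ equal ⟧ (+ i) (+ j) ℤ.- ⟦ equal ⟧ (+ i ℤ.+ + 1) (+ n ℤ.+ + 2)) rest) (cong₂ (λ s t → + 2 ℤ.* s ℤ.- t)
      (equal-κ {a = i} {j} (mk⇔ ℤ.+-injective (cong +_))) (last-κ n i)))
    where
    rest : ℤ
    rest = litEntry (+ n) (+ i) (load input 0 (literalIndex (+ n) (+ j) 2))
      ℤ.+ litEntry (+ n) (+ i) (load input 0 (literalIndex (+ n) (+ j) 3))
      ℤ.+ litEntry (+ n) (+ i) (load input 0 (literalIndex (+ n) (+ j) 4))
      ℤ.- + 2 ℤ.* ⟦ equal ⟧ (+ i ℤ.+ + 1) (+ n ℤ.+ + 2)
    arith : ∀ a r → + 1 ℤ.* a ℤ.+ (+ 1 ℤ.- + 1) ℤ.* r ≡ a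
    arith = solve-ℤ

  entry-clause : ∀ input n i c →
    entry input n i (n ℕ.+ 2 ℕ.+ c) ≡
      litEntry (+ n) (+ i) (nth input (c ℕ.* 3 ℕ.+ 2))
      ℤ.+ litEntry (+ n) (+ i) (nth input (c ℕ.* 3 ℕ.+ 3))
      ℤ.+ litEntry (+ n) (+ i) (nth input (c ℕ.* 3 ℕ.+ 4))
      ℤ.- + 2 ℤ.* κ i (suc n)
  entry-clause input n i c = trans
    (cong (λ t → t ℤ.* first ℤ.+ (+ 1 ℤ.- t) ℤ.* rest) (less-≥ (ℕ.m≤m+n (n ℕ.+ 2) c)))
    (trans (arith first rest)
      (cong₂ (λ s t → s ℤ.- + 2 ℤ.* t)
        (cong₃ (λ a b c → litEntry (+ n) (+ i) a ℤ.+ litEntry (+ n) (+ i) b ℤ.+ litEntry (+ n) (+ i) c)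
          (cong (load input 0) (index 2)) (cong (load input 0) (index 3)) (cong (load input 0) (index 4)))
        (last-κ n i)))
    where
    first rest : ℤ
    first = + 2 ℤ.* ⟦ equal ⟧ (+ i) (+ (n ℕ.+ 2 ℕ.+ c)) ℤ.- ⟦ equal ⟧ (+ i ℤ.+ + 1) (+ n ℤ.+ + 2)
    rest = litEntry (+ n) (+ i) (load input 0 (literalIndex (+ n) (+ (n ℕ.+ 2 ℕ.+ c)) 2))
      ℤ.+ litEntry (+ n) (+ i) (load input 0 (literalIndex (+ n) (+ (n ℕ.+ 2 ℕ.+ c)) 3))
      ℤ.+ litEntry (+ n) (+ i) (load input 0 (literalIndex (+ n) (+ (n ℕ.+ 2 ℕ.+ c)) 4))
      ℤ.- + 2 ℤ.* ⟦ equal ⟧ (+ i ℤ.+ + 1) (+ n ℤ.+ + 2)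
    arith : ∀ a r → + 0 ℤ.* a ℤ.+ (+ 1 ℤ.- + 0) ℤ.* r ≡ r
    arith = solve-ℤ
    index : ∀ r → literalIndex (+ n) (+ (n ℕ.+ 2 ℕ.+ c)) r ≡ + (c ℕ.* 3 ℕ.+ r)
    index r = trans (shift (+ n ℤ.+ + 2) (+ c) (+ r)) (cong (ℤ._+ + r) (sym (ℤ.pos-* c 3)))
      where
      shift : ∀ N c r → ((N ℤ.+ c) ℤ.- N) ℤ.* + 3 ℤ.+ r ≡ c ℤ.* + 3 ℤ.+ r
      shift = solve-ℤ

  private variable
    N M : ℕ

  sum-κ : ∀ (c : Fin N → ℚ) v → sum (λ i → c i ℚ.* ι (κ (toℕ i) (toℕ v))) ≡ c v
  sum-κ {suc N} c Fin.zero = trans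
    (cong₂ ℚ._+_ (ℚ.*-identityʳ (c Fin.zero))
      (trans (sum-cong-≗ (λ i → ℚ.*-zeroʳ (c (Fin.suc i)))) (sum-replicate-zero N)))
    (ℚ.+-identityʳ (c Fin.zero))
  sum-κ {suc N} c (Fin.suc v) = trans
    (cong₂ ℚ._+_ (ℚ.*-zeroʳ (c Fin.zero)) (sum-κ (c ∘ Fin.suc) v))
    (ℚ.+-identityˡ (c (Fin.suc v)))

  module _ {N} (c : Fin N → ℚ) where

    -- A coordinate of `c ∙ basis` is by definition such a form of the column, and linearity in the
    -- column splits it into Kronecker deltas. The coefficients are rational since independence
    -- quantifies over those.
    form : (Fin N → ℤ) → ℚ
    form e = sum λ i → c i ℚ.* ι (e i)

    form-cong : ∀ {e f} → (∀ i → e i ≡ f i) → form e ≡ form f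
    form-cong e≗f = sum-cong-≗ λ i → cong (λ t → c i ℚ.* ι t) (e≗f i)

    form-+ : ∀ e f → form (λ i → e i ℤ.+ f i) ≡ form e ℚ.+ form f
    form-+ e f = trans
      (sum-cong-≗ λ i → trans (cong (c i ℚ.*_) (ι-+ (e i) (f i)))
        (ℚ.*-distribˡ-+ (c i) (ι (e i)) (ι (f i))))
      (∑-distrib-+ (λ i → c i ℚ.* ι (e i)) (λ i → c i ℚ.* ι (f i)))

    form-* : ∀ a e → form (λ i → a ℤ.* e i) ≡ ι a ℚ.* form e
    form-* a e = trans
      (sum-cong-≗ λ i → trans (cong (c i ℚ.*_) (ι-* a (e i))) (swap (c i) (ι a) (ι (e i))))
      (sym (*-distribˡ-sum (ι a) (λ i → c i ℚ.* ι (e i))))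
      where
      open +-*-Solver
      swap : ∀ x y z → x ℚ.* (y ℚ.* z) ≡ y ℚ.* (x ℚ.* z)
      swap = solve 3 (λ x y z → x :* (y :* z) := y :* (x :* z)) refl

    form-- : ∀ e f → form (λ i → e i ℤ.- f i) ≡ form e ℚ.- form f
    form-- e f = trans (form-cong λ i → cong (λ t → e i ℤ.+ t) (sym (ℤ.-1*i≡-i (f i))))
      (trans (form-+ e (λ i → ℤ.-1ℤ ℤ.* f i))
        (cong (form e ℚ.+_) (trans (form-* ℤ.-1ℤ f) (minus (form f)))))
      where
      open +-*-Solver
      minus : ∀ x → ι ℤ.-1ℤ ℚ.* x ≡ ℚ.- x
      minus = solve 1 (λ x → con (ι ℤ.-1ℤ) :* x := :- x) refl

  module Columns (φ : Formula) where
    open Formula φ renaming (vars to n)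

    m : ℕ
    m = length clauses

    input : List ℤ
    input = PromiseProblem.encode 3-SAT φ

    basis : Basis (n ℕ.+ 2) (n ℕ.+ 2 ℕ.+ m)
    basis i j = ι (entry input n (toℕ i) (toℕ j))

    var : Fin n → Fin (n ℕ.+ 2)
    var v = v ↑ˡ 2

    -- dummy occurs in no clause; its lattice vector has norm exactly 2, so it attains
    -- λ₁ if φ is unsatisfiable.  unit stands for the constant 1.
    dummy unit : Fin (n ℕ.+ 2)
    dummy = n ↑ʳ Fin.zero
    unit  = n ↑ʳ Fin.suc Fin.zero

    diagonal : Fin (n ℕ.+ 2) → Fin (n ℕ.+ 2 ℕ.+ m)
    diagonal j = j ↑ˡ m

    column : Fin m → Fin (n ℕ.+ 2 ℕ.+ m)
    column k = n ℕ.+ 2 ↑ʳ k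

    every-column : ∀ {P : Fin (n ℕ.+ 2 ℕ.+ m) → Set} →
      (∀ j → P (diagonal j)) → (∀ k → P (column k)) → ∀ j → P j
    every-column {P = P} diag clause j = subst P (Fin.join-splitAt (n ℕ.+ 2) m j)
      (go (Fin.splitAt (n ℕ.+ 2) j))
      where
      go : ∀ s → P (Fin.join (n ℕ.+ 2) m s)
      go (inj₁ j) = diag j
      go (inj₂ k) = clause k

    module _ (c : Fin (n ℕ.+ 2) → ℚ) where

      form-κ : ∀ {v} (x : Fin (n ℕ.+ 2)) → toℕ x ≡ v → form c (λ i → κ (toℕ i) v) ≡ c x
      form-κ x refl = sum-κ c x

      toℕ-unit : toℕ unit ≡ suc n
      toℕ-unit = trans (Fin.toℕ-↑ʳ n (Fin.suc Fin.zero)) (ℕ.+-comm n 1)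

      ∙-diagonal : ∀ j → (c ∙ basis) (diagonal j) ≡ ι (+ 2) ℚ.* c j ℚ.- c unit
      ∙-diagonal j = begin
        form c (λ i → entry input n (toℕ i) (toℕ (diagonal j)))
          ≡⟨ form-cong c (λ i → trans (cong (entry input n (toℕ i)) (Fin.toℕ-↑ˡ j m))
               (entry-diagonal input n (toℕ i) (toℕ j) (Fin.toℕ<n j))) ⟩
        form c (λ i → + 2 ℤ.* κ (toℕ i) (toℕ j) ℤ.- κ (toℕ i) (suc n))
          ≡⟨ form-- c (λ i → + 2 ℤ.* κ (toℕ i) (toℕ j)) (λ i → κ (toℕ i) (suc n)) ⟩
        form c (λ i → + 2 ℤ.* κ (toℕ i) (toℕ j)) ℚ.- form c (λ i → κ (toℕ i) (suc n))
          ≡⟨ cong₂ ℚ._-_ (trans (form-* c (+ 2) (λ i → κ (toℕ i) (toℕ j)))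
               (cong (ι (+ 2) ℚ.*_) (form-κ j refl))) (form-κ unit toℕ-unit) ⟩
        ι (+ 2) ℚ.* c j ℚ.- c unit ∎
        where open ≡-Reasoning

      literal : Literal n → ℚ
      literal (v , true)  = c (var v)
      literal (v , false) = c unit ℚ.- c (var v)

      form-literal : ∀ l →
        form c (λ i → litEntry (+ n) (+ toℕ i) (encodeLiteral l)) ≡ literal l
      form-literal (v , true) = trans
        (form-cong c (λ i → litEntry-pos n (toℕ i) (toℕ v)))
        (form-κ (var v) (Fin.toℕ-↑ˡ v 2))
      form-literal (v , false) = trans
        (form-cong c (λ i → litEntry-neg n (toℕ i) (toℕ v)))
        (trans (form-- c (λ i → κ (toℕ i) (suc n)) (λ i → κ (toℕ i) (toℕ v)))
          (cong₂ ℚ._-_ (form-κ unit toℕ-unit) (form-κ (var v) (Fin.toℕ-↑ˡ v 2))))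

    encodeClauses : List (Clause n) → List ℤ
    encodeClauses = List.concatMap (λ c → List.map encodeLiteral (Vec.toList c))

    nth-clause : ∀ cs (k : Fin (length cs)) r →
      nth (encodeClauses cs) (toℕ k ℕ.* 3 ℕ.+ toℕ {3} r) ≡
        encodeLiteral (Vec.lookup (List.lookup cs k) r)
    nth-clause ((l₀ ∷ l₁ ∷ l₂ ∷ []) ∷ cs) Fin.zero Fin.zero = refl
    nth-clause ((l₀ ∷ l₁ ∷ l₂ ∷ []) ∷ cs) Fin.zero (Fin.suc Fin.zero) = refl
    nth-clause ((l₀ ∷ l₁ ∷ l₂ ∷ []) ∷ cs) Fin.zero (Fin.suc (Fin.suc Fin.zero)) = refl
    nth-clause ((l₀ ∷ l₁ ∷ l₂ ∷ []) ∷ cs) (Fin.suc k) r = nth-clause cs k r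

    clauseLiteral : Fin m → Fin 3 → Literal n
    clauseLiteral k = Vec.lookup (List.lookup clauses k)

    lit₀ lit₁ lit₂ : Fin m → Literal n
    lit₀ k = clauseLiteral k Fin.zero
    lit₁ k = clauseLiteral k (Fin.suc Fin.zero)
    lit₂ k = clauseLiteral k (Fin.suc (Fin.suc Fin.zero))

    nth-input : ∀ k r → nth input (toℕ k ℕ.* 3 ℕ.+ (2 ℕ.+ toℕ {3} r)) ≡
      encodeLiteral (clauseLiteral k r)
    nth-input k r = trans
      (cong (nth input) (trans (ℕ.+-suc (toℕ k ℕ.* 3) _) (cong suc (ℕ.+-suc (toℕ k ℕ.* 3) _))))
      (nth-clause clauses k r)

    ∙-column : ∀ c k → (c ∙ basis) (column k) ≡
      literal c (lit₀ k) ℚ.+ literal c (lit₁ k)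
        ℚ.+ literal c (lit₂ k) ℚ.- ι (+ 2) ℚ.* c unit
    ∙-column c k = begin
      form c (λ i → entry input n (toℕ i) (toℕ (column k)))
        ≡⟨ form-cong c (λ i → trans (cong (entry input n (toℕ i)) (Fin.toℕ-↑ʳ (n ℕ.+ 2) k))
             (trans (entry-clause input n (toℕ i) (toℕ k))
               (cong (λ t → t ℤ.- + 2 ℤ.* κ (toℕ i) (suc n))
                 (cong₃ (λ x y z → lit i x ℤ.+ lit i y ℤ.+ lit i z)
                   (nth-input k Fin.zero) (nth-input k (Fin.suc Fin.zero))
                   (nth-input k (Fin.suc (Fin.suc Fin.zero))))))) ⟩
      form c (λ i → lit i ℓ₀ ℤ.+ lit i ℓ₁ ℤ.+ lit i ℓ₂ ℤ.- + 2 ℤ.* κ (toℕ i) (suc n))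
        ≡⟨ form-- c (λ i → lit i ℓ₀ ℤ.+ lit i ℓ₁ ℤ.+ lit i ℓ₂) (λ i → + 2 ℤ.* κ (toℕ i) (suc n)) ⟩
      form c (λ i → lit i ℓ₀ ℤ.+ lit i ℓ₁ ℤ.+ lit i ℓ₂) ℚ.- form c (λ i → + 2 ℤ.* κ (toℕ i) (suc n))
        ≡⟨ cong₂ ℚ._-_
             (trans (form-+ c (λ i → lit i ℓ₀ ℤ.+ lit i ℓ₁) (λ i → lit i ℓ₂))
               (cong₂ ℚ._+_
                 (trans (form-+ c (λ i → lit i ℓ₀) (λ i → lit i ℓ₁))
                   (cong₂ ℚ._+_ (form-literal c (lit₀ k))
                     (form-literal c (lit₁ k))))
                 (form-literal c (lit₂ k))))
             (trans (form-* c (+ 2) (λ i → κ (toℕ i) (suc n)))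
               (cong (ι (+ 2) ℚ.*_) (form-κ c unit (toℕ-unit c)))) ⟩
      _ ∎
      where
      open ≡-Reasoning
      lit : Fin (n ℕ.+ 2) → ℤ → ℤ
      lit i = litEntry (+ n) (+ toℕ i)
      ℓ₀ ℓ₁ ℓ₂ : ℤ
      ℓ₀ = encodeLiteral (lit₀ k)
      ℓ₁ = encodeLiteral (lit₁ k)
      ℓ₂ = encodeLiteral (lit₂ k)

    -- The columns `diagonal` suffice: at `unit` the coordinate is 2 z - z = z, so z vanishes, and
    -- the others become 2 `c i`.
    independent : LinearlyIndependent basis
    independent c cB≗0 i = halve (c i) (trans (solve₂ (c i) (c unit))
      (trans (cong₂ ℚ._+_ (trans (sym (∙-diagonal c i)) (cB≗0 (diagonal i))) unit≡0) refl))
      where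
      open +-*-Solver
      solve₁ : ∀ x → x ≡ ι (+ 2) ℚ.* x ℚ.- x
      solve₁ = solve 1 (λ x → x := con (ι (+ 2)) :* x :- x) refl
      solve₂ : ∀ x y → ι (+ 2) ℚ.* x ≡ ι (+ 2) ℚ.* x ℚ.- y ℚ.+ y
      solve₂ = solve 2 (λ x y → con (ι (+ 2)) :* x := con (ι (+ 2)) :* x :- y :+ y) refl
      unit≡0 : c unit ≡ 0ℚ
      unit≡0 = trans (solve₁ (c unit)) (trans (sym (∙-diagonal c unit)) (cB≗0 (diagonal unit)))
      halve : ∀ x → ι (+ 2) ℚ.* x ≡ 0ℚ → x ≡ 0ℚ
      halve x 2x≡0 = trans (solve 1 (λ x → x := con ℚ.½ :* (con (ι (+ 2)) :* x)) refl x)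
        (cong (ℚ.½ ℚ.*_) 2x≡0)

open LatticeColumns

-- Short lattice vectors and satisfying assignments

module ShortVectors where
  open import Algebra.Definitions.RawSemiring ℚ.+-*-rawSemiring using (_^_)

  private variable
    d : ℕ

  bit : Bool → ℤ
  bit b = if b then 1ℤ else 0ℤ

  sumℕ-≤ : ∀ (f : Fin d → ℕ) → (∀ i → f i ℕ.≤ 1) → sumℕ f ℕ.≤ d
  sumℕ-≤ {zero}  f f≤1 = z≤n
  sumℕ-≤ {suc d} f f≤1 = ℕ.+-mono-≤ (f≤1 Fin.zero) (sumℕ-≤ (f ∘ Fin.suc) (f≤1 ∘ Fin.suc))

  ≤-sumℕ : ∀ (f : Fin d → ℕ) i → f i ℕ.≤ sumℕ f
  ≤-sumℕ f Fin.zero    = ℕ.m≤m+n _ _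
  ≤-sumℕ f (Fin.suc i) = ℕ.≤-trans (≤-sumℕ (f ∘ Fin.suc) i) (ℕ.m≤n+m _ _)

  sumℕ-zero : ∀ (f : Fin d → ℕ) → (∀ i → f i ≡ 0) → sumℕ f ≡ 0
  sumℕ-zero {zero}  f f≡0 = refl
  sumℕ-zero {suc d} f f≡0 = cong₂ ℕ._+_ (f≡0 Fin.zero) (sumℕ-zero (f ∘ Fin.suc) (f≡0 ∘ Fin.suc))

  sumℕ-single : ∀ (f : Fin d → ℕ) i → (∀ j → j ≢ i → f j ≡ 0) → sumℕ f ≡ f i
  sumℕ-single {suc d} f Fin.zero f≡0 = trans
    (cong (λ t → f Fin.zero ℕ.+ t) (sumℕ-zero (f ∘ Fin.suc) λ j → f≡0 (Fin.suc j) λ ()))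
    (ℕ.+-identityʳ (f Fin.zero))
  sumℕ-single {suc d} f (Fin.suc i) f≡0 = trans
    (cong (ℕ._+ sumℕ (f ∘ Fin.suc)) (f≡0 Fin.zero λ ()))
    (sumℕ-single (f ∘ Fin.suc) i λ j j≢i → f≡0 (Fin.suc j) λ { refl → j≢i refl })

  sum-ι : ∀ (f : Fin d → ℕ) → sum (λ i → ι (+ f i)) ≡ ι (+ sumℕ f)
  sum-ι {zero}  f = refl
  sum-ι {suc d} f = trans (cong (ι (+ f Fin.zero) ℚ.+_) (sum-ι (f ∘ Fin.suc)))
    (sym (ι-+ (+ f Fin.zero) (+ sumℕ (f ∘ Fin.suc))))

  ι-^ : ∀ a k → ι (+ a) ^ k ≡ ι (+ (a ℕ.^ k))
  ι-^ a zero    = refl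
  ι-^ a (suc k) = trans (cong (ι (+ a) ℚ.*_) (ι-^ a k))
    (trans (sym (ι-* (+ a) (+ (a ℕ.^ k)))) (cong ι (sym (ℤ.pos-* a (a ℕ.^ k)))))

  -- Supplies the attained minimum that `Isλ₁` demands. Vectors of bits replace functions because a
  -- case split on them determines them, with no appeal to extensionality.
  argmin : ∀ n {P : Vec Bool n → Set} → (∀ v → Dec (P v)) → (f : Vec Bool n → ℕ) →
    (∃ λ v → P v × ∀ w → P w → f v ℕ.≤ f w) ⊎ (∀ v → ¬ P v)
  argmin zero P? f with P? []
  ... | yes p = inj₁ ([] , p , λ { [] _ → ℕ.≤-refl })
  ... | no ¬p = inj₂ λ { [] → ¬p }
  argmin (suc n) P? f
    with argmin n (P? ∘ (true ∷_)) (f ∘ (true ∷_)) | argmin n (P? ∘ (false ∷_)) (f ∘ (false ∷_))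
  ... | inj₂ ¬t | inj₂ ¬f = inj₂ λ { (true ∷ v) → ¬t v ; (false ∷ v) → ¬f v }
  ... | inj₁ (t , pt , mt) | inj₂ ¬f = inj₁ (true ∷ t , pt ,
    λ { (true ∷ w) pw → mt w pw ; (false ∷ w) pw → contradiction pw (¬f w) })
  ... | inj₂ ¬t | inj₁ (u , pu , mu) = inj₁ (false ∷ u , pu ,
    λ { (true ∷ w) pw → contradiction pw (¬t w) ; (false ∷ w) pw → mu w pw })
  ... | inj₁ (t , pt , mt) | inj₁ (u , pu , mu) with ℕ.≤-total (f (true ∷ t)) (f (false ∷ u))
  ...   | inj₁ t≤u = inj₁ (true ∷ t , pt ,
    λ { (true ∷ w) pw → mt w pw ; (false ∷ w) pw → ℕ.≤-trans t≤u (mu w pw) })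
  ...   | inj₂ u≤t = inj₁ (false ∷ u , pu ,
    λ { (true ∷ w) pw → ℕ.≤-trans u≤t (mt w pw) ; (false ∷ w) pw → mu w pw })

  All-lookup : ∀ {A : Set} {P : A → Set} {xs} → All P xs → ∀ i → P (List.lookup xs i)
  All-lookup (p ∷ ps) Fin.zero    = p
  All-lookup (p ∷ ps) (Fin.suc i) = All-lookup ps i

  All-tabulate : ∀ {A : Set} {P : A → Set} xs → (∀ i → P (List.lookup xs i)) → All P xs
  All-tabulate []       p = []
  All-tabulate (x ∷ xs) p = p Fin.zero ∷ All-tabulate xs (p ∘ Fin.suc)

  ∣∣≤1-cases : ∀ a → ℤ.∣ a ∣ ℕ.≤ 1 → a ≡ 0ℤ ⊎ a ≡ 1ℤ ⊎ a ≡ ℤ.-1ℤ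
  ∣∣≤1-cases (+ 0)          _ = inj₁ refl
  ∣∣≤1-cases (+ 1)          _ = inj₂ (inj₁ refl)
  ∣∣≤1-cases -[1+ 0 ]       _ = inj₂ (inj₂ refl)
  ∣∣≤1-cases (+ (suc (suc _)))  (s≤s ())
  ∣∣≤1-cases -[1+ suc _ ]       (s≤s ())

  ∣2a-u∣≤1⇒∣a∣≤1 : ∀ a u → ℤ.∣ u ∣ ℕ.≤ 1 → ℤ.∣ + 2 ℤ.* a ℤ.- u ∣ ℕ.≤ 1 → ℤ.∣ a ∣ ℕ.≤ 1
  ∣2a-u∣≤1⇒∣a∣≤1 a u u≤1 r≤1 = ℕ.*-cancelˡ-≤ 2 (begin
    2 ℕ.* ℤ.∣ a ∣                        ≡⟨ ℤ.abs-* (+ 2) a ⟨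
    ℤ.∣ + 2 ℤ.* a ∣                      ≡⟨ cong ℤ.∣_∣ (split (+ 2 ℤ.* a) u) ⟩
    ℤ.∣ + 2 ℤ.* a ℤ.- u ℤ.+ u ∣          ≤⟨ ℤ.∣i+j∣≤∣i∣+∣j∣ (+ 2 ℤ.* a ℤ.- u) u ⟩
    ℤ.∣ + 2 ℤ.* a ℤ.- u ∣ ℕ.+ ℤ.∣ u ∣    ≤⟨ ℕ.+-mono-≤ r≤1 u≤1 ⟩
    2                                    ∎)
    where
    open ℕ.≤-Reasoning
    split : ∀ x u → x ≡ x ℤ.- u ℤ.+ u
    split = solve-ℤ

  digit-0 : ∀ a → ℤ.∣ + 2 ℤ.* a ℤ.- 0ℤ ∣ ℕ.≤ 1 → a ≡ 0ℤ
  digit-0 a r≤1 with ∣∣≤1-cases a (∣2a-u∣≤1⇒∣a∣≤1 a 0ℤ z≤n r≤1)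
  ... | inj₁ a≡0 = a≡0
  ... | inj₂ (inj₁ refl) = contradiction r≤1 λ { (s≤s ()) }
  ... | inj₂ (inj₂ refl) = contradiction r≤1 λ { (s≤s ()) }

  -- Of the candidates -1, 0 and 1, the first gives -3.
  digit-1 : ∀ a → ℤ.∣ + 2 ℤ.* a ℤ.- 1ℤ ∣ ℕ.≤ 1 → a ≡ bit (does (a ℤ.≟ 1ℤ))
  digit-1 a r≤1 with ∣∣≤1-cases a (∣2a-u∣≤1⇒∣a∣≤1 a 1ℤ (s≤s z≤n) r≤1)
  ... | inj₁ refl = refl
  ... | inj₂ (inj₁ refl) = refl
  ... | inj₂ (inj₂ refl) = contradiction r≤1 λ { (s≤s ()) }

  clause-small : ∀ a b c → a ∨ b ∨ c ≡ true →
    ℤ.∣ bit a ℤ.+ bit b ℤ.+ bit c ℤ.- + 2 ∣ ℕ.≤ 1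
  clause-small true  true  true  _ = ℕ.≤-refl
  clause-small true  true  false _ = z≤n
  clause-small true  false true  _ = z≤n
  clause-small true  false false _ = ℕ.≤-refl
  clause-small false true  true  _ = z≤n
  clause-small false true  false _ = ℕ.≤-refl
  clause-small false false true  _ = ℕ.≤-refl
  clause-small false false false ()

  clause-small⁻¹ : ∀ a b c → ℤ.∣ bit a ℤ.+ bit b ℤ.+ bit c ℤ.- + 2 ∣ ℕ.≤ 1 →
    a ∨ b ∨ c ≡ true
  clause-small⁻¹ true  b     c     _ = refl
  clause-small⁻¹ false true  c     _ = refl
  clause-small⁻¹ false false true  _ = refl
  clause-small⁻¹ false false false (s≤s ())

  norm-mono : ∀ {d} (x y : Vector d) p .{{_ : ℕ.NonZero p}} →
    powerSum p x ℚ.≤ powerSum p y → ∥ x ∥ p ≤ℝ ∥ y ∥ p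
  norm-mono x y p x≤y q (r , q<r , inj₁ r≤0) = r , q<r , inj₁ r≤0
  norm-mono x y p x≤y q (r , q<r , inj₂ r^p≤) = r , q<r , inj₂ (ℚ.≤-trans r^p≤ x≤y)

  norm≤ : ∀ {d} (x : Vector d) p .{{_ : ℕ.NonZero p}} {δ} →
    0ℚ ℚ.≤ δ → powerSum p x ℚ.≤ δ ^ p → ∥ x ∥ p ≤ℝ fromℚ δ
  norm≤ x p 0≤δ x≤δ^p q (r , q<r , inj₁ r≤0) = ℚ.<-≤-trans q<r (ℚ.≤-trans r≤0 0≤δ)
  norm≤ x p {δ} 0≤δ x≤δ^p q (r , q<r , inj₂ r^p≤) = ℚ.<-≤-trans q<r (ℚ.≮⇒≥ λ δ<r →
    ℚ.<-irrefl refl (ℚ.<-≤-trans (^-mono-< p 0≤δ δ<r) (ℚ.≤-trans r^p≤ x≤δ^p)))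

  module Rows (φ : Formula) where
    open Formula φ renaming (vars to n)
    open Columns φ public

    private
      N R : ℕ
      N = n ℕ.+ 2
      R = N ℕ.+ m

    literalℤ : (Fin N → ℤ) → Literal n → ℤ
    literalℤ y (v , true)  = y (var v)
    literalℤ y (v , false) = y unit ℤ.- y (var v)

    clauseℤ : (Fin N → ℤ) → Fin m → ℤ
    clauseℤ y k = literalℤ y (lit₀ k)
      ℤ.+ literalℤ y (lit₁ k)
      ℤ.+ literalℤ y (lit₂ k) ℤ.- + 2 ℤ.* y unit

    -- The coordinates as integers, which makes smallness decidable and turns power sums into
    -- natural numbers; `∙-coord` links them to the rational ones.
    coord : (Fin N → ℤ) → Fin R → ℤ
    coord y j = [ (λ j → + 2 ℤ.* y j ℤ.- y unit) , clauseℤ y ]′ (Fin.splitAt N j)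

    coord-diagonal : ∀ y j → coord y (diagonal j) ≡ + 2 ℤ.* y j ℤ.- y unit
    coord-diagonal y j = cong [ _ , clauseℤ y ]′ (Fin.splitAt-↑ˡ N j m)

    coord-column : ∀ y k → coord y (column k) ≡ clauseℤ y k
    coord-column y k = cong [ (λ j → + 2 ℤ.* y j ℤ.- y unit) , _ ]′ (Fin.splitAt-↑ʳ N m k)

    ι-literal : ∀ y l → literal (ι ∘ y) l ≡ ι (literalℤ y l)
    ι-literal y (v , true)  = refl
    ι-literal y (v , false) = sym (ι-- (y unit) (y (var v)))

    ∙-coord : ∀ y j → ((ι ∘ y) ∙ basis) j ≡ ι (coord y j)
    ∙-coord y = every-column diag col
      where
      open ≡-Reasoning
      diag : ∀ j → ((ι ∘ y) ∙ basis) (diagonal j) ≡ ι (coord y (diagonal j))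
      diag j = begin
        ((ι ∘ y) ∙ basis) (diagonal j)          ≡⟨ ∙-diagonal (ι ∘ y) j ⟩
        ι (+ 2) ℚ.* ι (y j) ℚ.- ι (y unit)      ≡⟨ cong (ℚ._- ι (y unit)) (ι-* (+ 2) (y j)) ⟨
        ι (+ 2 ℤ.* y j) ℚ.- ι (y unit)          ≡⟨ ι-- (+ 2 ℤ.* y j) (y unit) ⟨
        ι (+ 2 ℤ.* y j ℤ.- y unit)              ≡⟨ cong ι (coord-diagonal y j) ⟨
        ι (coord y (diagonal j))                ∎
      col : ∀ k → ((ι ∘ y) ∙ basis) (column k) ≡ ι (coord y (column k))
      col k = begin
        ((ι ∘ y) ∙ basis) (column k)
          ≡⟨ ∙-column (ι ∘ y) k ⟩
        literal (ι ∘ y) l₀ ℚ.+ literal (ι ∘ y) l₁ ℚ.+ literal (ι ∘ y) l₂ ℚ.- ι (+ 2) ℚ.* ι (y unit)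
          ≡⟨ cong₂ ℚ._-_ (cong₂ ℚ._+_ (cong₂ ℚ._+_ (ι-literal y l₀) (ι-literal y l₁)) (ι-literal y l₂))
               (sym (ι-* (+ 2) (y unit))) ⟩
        ι x₀ ℚ.+ ι x₁ ℚ.+ ι x₂ ℚ.- ι (+ 2 ℤ.* y unit)
          ≡⟨ cong (ℚ._- ι (+ 2 ℤ.* y unit))
               (trans (ι-+ (x₀ ℤ.+ x₁) x₂) (cong (ℚ._+ ι x₂) (ι-+ x₀ x₁))) ⟨
        ι (x₀ ℤ.+ x₁ ℤ.+ x₂) ℚ.- ι (+ 2 ℤ.* y unit)
          ≡⟨ ι-- (x₀ ℤ.+ x₁ ℤ.+ x₂) (+ 2 ℤ.* y unit) ⟨
        ι (clauseℤ y k)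
          ≡⟨ cong ι (coord-column y k) ⟨
        ι (coord y (column k)) ∎
        where
        l₀ l₁ l₂ : Literal n
        l₀ = lit₀ k
        l₁ = lit₁ k
        l₂ = lit₂ k
        x₀ x₁ x₂ : ℤ
        x₀ = literalℤ y l₀
        x₁ = literalℤ y l₁
        x₂ = literalℤ y l₂

    literalℤ-cong : ∀ {y z} → y ≗ z → ∀ l → literalℤ y l ≡ literalℤ z l
    literalℤ-cong y≗z (v , true)  = y≗z (var v)
    literalℤ-cong y≗z (v , false) = cong₂ ℤ._-_ (y≗z unit) (y≗z (var v))

    coord-cong : ∀ {y z} → y ≗ z → coord y ≗ coord z
    coord-cong {y} {z} y≗z = every-column
      (λ j → trans (coord-diagonal y j) (trans
        (cong₂ (λ a u → + 2 ℤ.* a ℤ.- u) (y≗z j) (y≗z unit)) (sym (coord-diagonal z j))))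
      (λ k → trans (coord-column y k) (trans
        (cong₂ (λ a u → a ℤ.- + 2 ℤ.* u)
          (cong₃ (λ a b c → a ℤ.+ b ℤ.+ c) (literalℤ-cong y≗z (lit₀ k)) (literalℤ-cong y≗z (lit₁ k)) (literalℤ-cong y≗z (lit₂ k)))
          (y≗z unit))
        (sym (coord-column z k))))

    coord-neg : ∀ y j → coord (ℤ.-_ ∘ y) j ≡ ℤ.- coord y j
    coord-neg y = every-column
      (λ j → trans (coord-diagonal (ℤ.-_ ∘ y) j) (trans (negate₁ (y j) (y unit))
        (cong ℤ.-_ (sym (coord-diagonal y j)))))
      (λ k → trans (coord-column (ℤ.-_ ∘ y) k) (trans
        (cong (ℤ._- + 2 ℤ.* (ℤ.- y unit))
          (cong₃ (λ a b c → a ℤ.+ b ℤ.+ c) (lit-neg (lit₀ k)) (lit-neg (lit₁ k)) (lit-neg (lit₂ k))))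
        (trans (negate₂ (literalℤ y (lit₀ k)) (literalℤ y (lit₁ k)) (literalℤ y (lit₂ k)) (y unit))
          (cong ℤ.-_ (sym (coord-column y k))))))
      where
      negate₁ : ∀ a u → + 2 ℤ.* (ℤ.- a) ℤ.- (ℤ.- u) ≡ ℤ.- (+ 2 ℤ.* a ℤ.- u)
      negate₁ = solve-ℤ
      negate₂ : ∀ a b c u → (ℤ.- a) ℤ.+ (ℤ.- b) ℤ.+ (ℤ.- c) ℤ.- + 2 ℤ.* (ℤ.- u)
        ≡ ℤ.- (a ℤ.+ b ℤ.+ c ℤ.- + 2 ℤ.* u)
      negate₂ = solve-ℤ
      negate₃ : ∀ a u → (ℤ.- u) ℤ.- (ℤ.- a) ≡ ℤ.- (u ℤ.- a)
      negate₃ = solve-ℤ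
      lit-neg : ∀ l → literalℤ (ℤ.-_ ∘ y) l ≡ ℤ.- literalℤ y l
      lit-neg (v , true)  = refl
      lit-neg (v , false) = negate₃ (y (var v)) (y unit)

    literalℤ-zero : ∀ l → literalℤ (λ _ → 0ℤ) l ≡ 0ℤ
    literalℤ-zero (v , true)  = refl
    literalℤ-zero (v , false) = refl

    coord-zero : ∀ j → coord (λ _ → 0ℤ) j ≡ 0ℤ
    coord-zero = every-column (coord-diagonal (λ _ → 0ℤ)) λ k →
      trans (coord-column (λ _ → 0ℤ) k)
        (cong₃ (λ a b c → a ℤ.+ b ℤ.+ c ℤ.- 0ℤ)
          (literalℤ-zero (lit₀ k)) (literalℤ-zero (lit₁ k)) (literalℤ-zero (lit₂ k)))

    coord-unit : ∀ y → coord y (diagonal unit) ≡ y unit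
    coord-unit y = trans (coord-diagonal y unit) (arith (y unit))
      where
      arith : ∀ u → + 2 ℤ.* u ℤ.- u ≡ u
      arith = solve-ℤ

    Small : (Fin N → ℤ) → Set
    Small y = ∀ j → ℤ.∣ coord y j ∣ ℕ.≤ 1

    small? : ∀ y → Dec (Small y)
    small? y = Fin.all? λ j → ℤ.∣ coord y j ∣ ℕ.≤? 1

    holds : (Fin N → Bool) → Literal n → Bool
    holds β (v , b) = does (β (var v) Bool.≟ b)

    literalℤ-bit : ∀ β → β unit ≡ true → ∀ l → literalℤ (bit ∘ β) l ≡ bit (holds β l)
    literalℤ-bit β u (v , true) with β (var v)
    ... | true  = refl
    ... | false = refl
    literalℤ-bit β u (v , false) rewrite u with β (var v)
    ... | true  = refl
    ... | false = refl

    clauseℤ-bit : ∀ β → β unit ≡ true → ∀ k → clauseℤ (bit ∘ β) k ≡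
      bit (holds β (lit₀ k))
      ℤ.+ bit (holds β (lit₁ k))
      ℤ.+ bit (holds β (lit₂ k)) ℤ.- + 2
    clauseℤ-bit β u k = cong₂ (λ a t → a ℤ.- + 2 ℤ.* bit t)
      (cong₃ (λ a b c → a ℤ.+ b ℤ.+ c) (literalℤ-bit β u (lit₀ k)) (literalℤ-bit β u (lit₁ k)) (literalℤ-bit β u (lit₂ k))) u

    -- The coefficient vectors of the short lattice vectors, up to sign.
    Solution : Vec Bool N → Set
    Solution β = Vec.lookup β unit ≡ true × Small (bit ∘ Vec.lookup β)

    solution? : ∀ β → Dec (Solution β)
    solution? β with Vec.lookup β unit Bool.≟ true | small? (bit ∘ Vec.lookup β)
    ... | yes u | yes s = yes (u , s)
    ... | no ¬u | _     = no λ (u , _) → ¬u u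
    ... | _     | no ¬s = no λ (_ , s) → ¬s s

    Satisfies : (Fin n → Bool) → Clause n → Set
    Satisfies α = Any (λ (i , b) → α i ≡ b)

    solution⇒satisfiable : ∀ {β} → Solution β → Satisfiable φ
    solution⇒satisfiable {β} (u , small) = Vec.lookup β ∘ var , All-tabulate clauses λ k →
      satisfies (List.lookup clauses k) (clause-small⁻¹ (b (lit₀ k)) (b (lit₁ k)) (b (lit₂ k))
        (subst (λ z → ℤ.∣ z ∣ ℕ.≤ 1)
          (trans (coord-column (bit ∘ Vec.lookup β) k) (clauseℤ-bit (Vec.lookup β) u k)) (small (column k))))
      where
      b : Literal n → Bool
      b = holds (Vec.lookup β)
      b-sound : ∀ l → b l ≡ true → Vec.lookup β (var (proj₁ l)) ≡ proj₂ l
      b-sound (v , c) eq with Vec.lookup β (var v) Bool.≟ c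
      ... | yes p = p
      satisfies : ∀ c → b (Vec.lookup c Fin.zero) ∨ b (Vec.lookup c (Fin.suc Fin.zero))
        ∨ b (Vec.lookup c (Fin.suc (Fin.suc Fin.zero))) ≡ true → Satisfies (Vec.lookup β ∘ var) c
      satisfies (l₀ ∷ l₁ ∷ l₂ ∷ []) eq with b l₀ in e₀ | b l₁ in e₁ | b l₂ in e₂
      ... | true  | _     | _    = here (b-sound l₀ e₀)
      ... | false | true  | _    = there (here (b-sound l₁ e₁))
      ... | false | false | true = there (there (here (b-sound l₂ e₂)))

    satisfiable⇒solution : Satisfiable φ → ∃ Solution
    satisfiable⇒solution (α , sat) = β , unit-true , every-column
      (λ j → subst (λ z → ℤ.∣ z ∣ ℕ.≤ 1)
        (sym (trans (coord-diagonal (bit ∘ Vec.lookup β) j) (cong (λ t → + 2 ℤ.* bit (Vec.lookup β j) ℤ.- bit t) unit-true)))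
        (bit-small (Vec.lookup β j)))
      (λ k → subst (λ z → ℤ.∣ z ∣ ℕ.≤ 1)
        (sym (trans (coord-column (bit ∘ Vec.lookup β) k) (clauseℤ-bit (Vec.lookup β) unit-true k)))
        (clause-small (holds (Vec.lookup β) (lit₀ k)) (holds (Vec.lookup β) (lit₁ k))
          (holds (Vec.lookup β) (lit₂ k)) (satisfied (List.lookup clauses k) (All-lookup sat k))))
      where
      b : Fin N → Bool
      -- The bit at `dummy` could be either one, its coordinate 2 x - 1 being ±1 in both cases; the
      -- bit at `unit` makes z = 1.
      b i = [ α , (λ { Fin.zero → false ; (Fin.suc _) → true }) ]′ (Fin.splitAt n i)
      β : Vec Bool N
      β = Vec.tabulate b
      lookup-β : ∀ i → Vec.lookup β i ≡ b i
      lookup-β = Vec.lookup∘tabulate b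
      unit-true : Vec.lookup β unit ≡ true
      unit-true = trans (lookup-β unit) (cong [ α , _ ]′ (Fin.splitAt-↑ʳ n 2 (Fin.suc Fin.zero)))
      var-α : ∀ v → Vec.lookup β (var v) ≡ α v
      var-α v = trans (lookup-β (var v)) (cong [ α , _ ]′ (Fin.splitAt-↑ˡ n v 2))
      bit-small : ∀ t → ℤ.∣ + 2 ℤ.* bit t ℤ.- 1ℤ ∣ ℕ.≤ 1
      bit-small true  = ℕ.≤-refl
      bit-small false = ℕ.≤-refl
      holds-complete : ∀ l → α (proj₁ l) ≡ proj₂ l → holds (Vec.lookup β) l ≡ true
      holds-complete (v , c) eq = dec-true (Vec.lookup β (var v) Bool.≟ c) (trans (var-α v) eq)
      satisfied : ∀ c → Satisfies α c →
        holds (Vec.lookup β) (Vec.lookup c Fin.zero)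
        ∨ holds (Vec.lookup β) (Vec.lookup c (Fin.suc Fin.zero))
        ∨ holds (Vec.lookup β) (Vec.lookup c (Fin.suc (Fin.suc Fin.zero))) ≡ true
      satisfied (l₀ ∷ l₁ ∷ l₂ ∷ []) (here p) = cong (_∨ (holds (Vec.lookup β) l₁ ∨ holds (Vec.lookup β) l₂)) (holds-complete l₀ p)
      satisfied (l₀ ∷ l₁ ∷ l₂ ∷ []) (there (here p)) = trans
        (cong (λ t → holds (Vec.lookup β) l₀ ∨ t ∨ holds (Vec.lookup β) l₂) (holds-complete l₁ p))
        (Bool.∨-zeroʳ (holds (Vec.lookup β) l₀))
      satisfied (l₀ ∷ l₁ ∷ l₂ ∷ []) (there (there (here p))) = trans
        (cong (λ t → holds (Vec.lookup β) l₀ ∨ holds (Vec.lookup β) l₁ ∨ t) (holds-complete l₂ p))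
        (trans (cong (holds (Vec.lookup β) l₀ ∨_) (Bool.∨-zeroʳ (holds (Vec.lookup β) l₁)))
          (Bool.∨-zeroʳ (holds (Vec.lookup β) l₀)))

    small-unit-1 : ∀ y → Small y → y unit ≡ 1ℤ →
      ∃ λ β → Solution β × ∀ j → ℤ.∣ coord y j ∣ ≡ ℤ.∣ coord (bit ∘ Vec.lookup β) j ∣
    small-unit-1 y small u≡1 = β
      , (trans (Vec.lookup∘tabulate b unit) (dec-true (y unit ℤ.≟ 1ℤ) u≡1)
        , λ j → subst (ℕ._≤ 1) (abs≡ j) (small j))
      , abs≡
      where
      b : Fin N → Bool
      b i = does (y i ℤ.≟ 1ℤ)
      β : Vec Bool N
      β = Vec.tabulate b
      y≗bit : y ≗ bit ∘ Vec.lookup β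
      y≗bit i = trans (digit-1 (y i) (subst (λ z → ℤ.∣ z ∣ ℕ.≤ 1)
          (trans (coord-diagonal y i) (cong (λ u → + 2 ℤ.* y i ℤ.- u) u≡1)) (small (diagonal i))))
        (cong bit (sym (Vec.lookup∘tabulate b i)))
      abs≡ : ∀ j → ℤ.∣ coord y j ∣ ≡ ℤ.∣ coord (bit ∘ Vec.lookup β) j ∣
      abs≡ j = cong ℤ.∣_∣ (coord-cong y≗bit j)

    -- Only absolute values of coordinates are matched, since norms see nothing else; this lets `y`
    -- and its negative share one bit vector.
    small-cases : ∀ y → Small y →
      (y ≗ λ _ → 0ℤ) ⊎ ∃ λ β → Solution β × ∀ j → ℤ.∣ coord y j ∣ ≡ ℤ.∣ coord (bit ∘ Vec.lookup β) j ∣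
    small-cases y small
      with ∣∣≤1-cases (y unit) (subst (λ z → ℤ.∣ z ∣ ℕ.≤ 1) (coord-unit y) (small (diagonal unit)))
    ... | inj₁ u≡0 = inj₁ λ i → digit-0 (y i)
      (subst (λ z → ℤ.∣ z ∣ ℕ.≤ 1) (trans (coord-diagonal y i) (cong (λ u → + 2 ℤ.* y i ℤ.- u) u≡0))
        (small (diagonal i)))
    ... | inj₂ (inj₁ u≡1)  = inj₂ (small-unit-1 y small u≡1)
    ... | inj₂ (inj₂ u≡-1) =
      let β , sol , abs≡ = small-unit-1 (ℤ.-_ ∘ y) (λ j → subst (ℕ._≤ 1) (∣neg∣ j) (small j))
                             (cong ℤ.-_ u≡-1)
      in inj₂ (β , sol , λ j → trans (∣neg∣ j) (abs≡ j))
      where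
      ∣neg∣ : ∀ j → ℤ.∣ coord y j ∣ ≡ ℤ.∣ coord (ℤ.-_ ∘ y) j ∣
      ∣neg∣ j = trans (sym (ℤ.∣-i∣≡∣i∣ (coord y j))) (cong ℤ.∣_∣ (sym (coord-neg y j)))

    -- The p-th power of the ℓₚ norm of the lattice vector with coefficients `y`.
    weight : ℕ → (Fin N → ℤ) → ℕ
    weight p y = sumℕ (λ j → ℤ.∣ coord y j ∣ ℕ.^ p)

    weight-cong : ∀ p {y z} → (∀ j → ℤ.∣ coord y j ∣ ≡ ℤ.∣ coord z j ∣) → weight p y ≡ weight p z
    weight-cong p eq = sumℕ-cong (λ j → cong (ℕ._^ p) (eq j))
      where
      sumℕ-cong : ∀ {d} {f g : Fin d → ℕ} → f ≗ g → sumℕ f ≡ sumℕ g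
      sumℕ-cong {zero}  f≗g = refl
      sumℕ-cong {suc d} f≗g = cong₂ ℕ._+_ (f≗g Fin.zero) (sumℕ-cong (f≗g ∘ Fin.suc))

    vector : (Fin N → ℤ) → Vector R
    vector y = (ι ∘ y) ∙ basis

    powerSum-weight : ∀ p {v y} → v ≗ vector y → powerSum p v ≡ ι (+ weight p y)
    powerSum-weight p {v} {y} v≗ = trans (sum-cong-≗ λ j → begin
      ℚ.∣ v j ∣ ^ p                    ≡⟨ cong (λ q → ℚ.∣ q ∣ ^ p) (trans (v≗ j) (∙-coord y j)) ⟩
      ℚ.∣ ι (coord y j) ∣ ^ p          ≡⟨ cong (_^ p) (∣ι∣ (coord y j)) ⟩
      ι (+ ℤ.∣ coord y j ∣) ^ p        ≡⟨ ι-^ ℤ.∣ coord y j ∣ p ⟩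
      ι (+ (ℤ.∣ coord y j ∣ ℕ.^ p))    ∎)
      (sum-ι (λ j → ℤ.∣ coord y j ∣ ℕ.^ p))
      where open ≡-Reasoning

    weight-small : ∀ p y → Small y → weight p y ℕ.≤ R
    weight-small p y small = sumℕ-≤ _ λ j →
      ℕ.≤-trans (ℕ.^-monoˡ-≤ p (small j)) (ℕ.≤-reflexive (ℕ.^-zeroˡ p))

    -- The dichotomy behind the gap: one coordinate of absolute value at least 2 already contributes
    -- 2^p, and without one the vector comes from a solution.
    nonzero-cases : ∀ p {v} y → v ≗ vector y → ¬ (v ≗ 0ᵥ) → 2 ℕ.^ p ℕ.≤ weight p y ⊎
      ∃ λ β → Solution β × weight p y ≡ weight p (bit ∘ Vec.lookup β)
    nonzero-cases p {v} y v≗ v≢0 with small? y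
    ... | no ¬small =
      let j , ¬small-j = Fin.¬∀⟶∃¬ R _ (λ j → ℤ.∣ coord y j ∣ ℕ.≤? 1) ¬small
      in inj₁ (ℕ.≤-trans (ℕ.^-monoˡ-≤ p (ℕ.≰⇒> ¬small-j))
           (≤-sumℕ (λ j → ℤ.∣ coord y j ∣ ℕ.^ p) j))
    ... | yes small with small-cases y small
    ...   | inj₂ (β , sol , abs≡) = inj₂ (β , sol , weight-cong p abs≡)
    ...   | inj₁ y≗0 = contradiction
      (λ j → trans (v≗ j) (trans (∙-coord y j) (cong ι (trans (coord-cong y≗0 j) (coord-zero j)))))
      v≢0

    Isλ₁-vector : ∀ p .{{_ : ℕ.NonZero p}} y → ¬ (vector y ≗ 0ᵥ) →
      (∀ {v} z → v ≗ vector z → ¬ (v ≗ 0ᵥ) → weight p y ℕ.≤ weight p z) →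
      Isλ₁ p basis (∥ vector y ∥ p)
    Isλ₁-vector p y y≢0 least = record
      { attained = vector y , (y , λ _ → refl) , y≢0 , (λ _ l → l) , (λ _ l → l)
      ; minimal  = λ v (z , v≗) v≢0 → norm-mono (vector y) v p
          (subst₂ ℚ._≤_ (sym (powerSum-weight p {vector y} {y} λ _ → refl)) (sym (powerSum-weight p {v} {z} v≗))
            (ι-mono-≤ (ℤ.+≤+ (least {v} z v≗ v≢0))))
      }

    -- A small vector weighs at most `R`. By `R ≤ 2 ^ p` no vector with a large coordinate weighs
    -- less, so the lightest solution is shortest in the whole lattice; `R ≤ δ ^ p` then bounds its
    -- norm.
    satisfiable⇒λ₁≤ : ∀ p .{{_ : ℕ.NonZero p}} {δ} → Satisfiable φ → R ℕ.≤ 2 ℕ.^ p →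
      0ℚ ℚ.≤ δ → ι (+ R) ℚ.≤ δ ^ p → ∃ λ r → Isλ₁ p basis r × r ≤ℝ fromℚ δ
    satisfiable⇒λ₁≤ p {δ} sat R≤2^p 0≤δ R≤δ^p =
      [ shortest , (λ none → contradiction (proj₂ (satisfiable⇒solution sat)) (none (proj₁ (satisfiable⇒solution sat)))) ]′
        (argmin N solution? (λ β → weight p (bit ∘ Vec.lookup β)))
      where
      shortest : (∃ λ β → Solution β × ∀ γ → Solution γ →
          weight p (bit ∘ Vec.lookup β) ℕ.≤ weight p (bit ∘ Vec.lookup γ)) →
        ∃ λ r → Isλ₁ p basis r × r ≤ℝ fromℚ δ
      shortest (β , (u , small) , least) = ∥ vector y ∥ p , Isλ₁-vector p y y≢0 (λ {v} → minimal {v})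
        , norm≤ (vector y) p 0≤δ (subst (ℚ._≤ δ ^ p) (sym (powerSum-weight p {vector y} {y} λ _ → refl))
            (ℚ.≤-trans (ι-mono-≤ (ℤ.+≤+ w≤R)) R≤δ^p))
        where
        y : Fin N → ℤ
        y = bit ∘ Vec.lookup β
        w≤R : weight p y ℕ.≤ R
        w≤R = weight-small p y small
        0≢1 : 0ℚ ≢ ι 1ℤ
        0≢1 ()
        y≢0 : ¬ (vector y ≗ 0ᵥ)
        y≢0 y≗0 = 0≢1 (trans (sym (y≗0 (diagonal unit)))
          (trans (∙-coord y (diagonal unit)) (cong ι (trans (coord-unit y) (cong bit u)))))
        minimal : ∀ {v} z → v ≗ vector z → ¬ (v ≗ 0ᵥ) → weight p y ℕ.≤ weight p z
        minimal {v} z v≗ v≢0 = [ (λ 2^p≤ → ℕ.≤-trans w≤R (ℕ.≤-trans R≤2^p 2^p≤))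
          , (λ (γ , sol , eq) → ℕ.≤-trans (least γ sol) (ℕ.≤-reflexive (sym eq))) ]′
          (nonzero-cases p {v} z v≗ v≢0)

    dummyVector : Fin N → ℤ
    dummyVector i = κ (toℕ i) n

    toℕ-dummy : toℕ dummy ≡ n
    toℕ-dummy = trans (Fin.toℕ-↑ʳ n Fin.zero) (ℕ.+-identityʳ n)
    at-other : ∀ i → toℕ i ≢ n → dummyVector i ≡ 0ℤ
    at-other i i≢n = cong bit (dec-false (toℕ i ℕ.≟ n) i≢n)
    at-unit : dummyVector unit ≡ 0ℤ
    at-unit = at-other unit λ eq → ℕ.1+n≢n (trans (sym (toℕ-unit (λ _ → 0ℚ))) eq)
    coord-dummy : coord dummyVector (diagonal dummy) ≡ + 2
    coord-dummy = trans (coord-diagonal dummyVector dummy)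
      (cong₂ (λ a u → + 2 ℤ.* a ℤ.- u) (cong bit (dec-true (toℕ dummy ℕ.≟ n) toℕ-dummy)) at-unit)

    -- The vector is twice a standard basis vector: as z and all variables are 0, only the
    -- coordinate of `dummy` survives.
    weight-dummy : ∀ p .{{_ : ℕ.NonZero p}} → weight p dummyVector ≡ 2 ℕ.^ p
    weight-dummy p = trans
      (sumℕ-single _ (diagonal dummy) λ j j≢ → trans (cong (λ z → ℤ.∣ z ∣ ℕ.^ p) (others j j≢)) (0^ p))
      (cong (λ z → ℤ.∣ z ∣ ℕ.^ p) coord-dummy)
      where
      0^ : ∀ p .{{_ : ℕ.NonZero p}} → 0 ℕ.^ p ≡ 0
      0^ (suc p) = refl
      at-var : ∀ v → dummyVector (var v) ≡ 0ℤ
      at-var v = at-other (var v) λ eq → ℕ.<⇒≢ (Fin.toℕ<n v) (trans (sym (Fin.toℕ-↑ˡ v 2)) eq)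
      at-literal : ∀ l → literalℤ dummyVector l ≡ 0ℤ
      at-literal (v , true)  = at-var v
      at-literal (v , false) = cong₂ ℤ._-_ at-unit (at-var v)
      others : ∀ j → j ≢ diagonal dummy → coord dummyVector j ≡ 0ℤ
      others = every-column
        (λ j j≢ → trans (coord-diagonal dummyVector j)
          (cong₂ (λ a u → + 2 ℤ.* a ℤ.- u)
            (at-other j λ eq → j≢ (cong diagonal (Fin.toℕ-injective (trans eq (sym toℕ-dummy)))))
            at-unit))
        (λ k _ → trans (coord-column dummyVector k)
          (cong₂ (λ a u → a ℤ.- + 2 ℤ.* u)
            (cong₃ (λ a b c → a ℤ.+ b ℤ.+ c) (at-literal (lit₀ k)) (at-literal (lit₁ k)) (at-literal (lit₂ k)))
            at-unit))

    unsatisfiable⇒<λ₁ : ∀ p .{{_ : ℕ.NonZero p}} {x q} → ¬ Satisfiable φ →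
      ℝ.U x q → q ℚ.< ι (+ 2) → ∃ λ r → Isλ₁ p basis r × x <ℝ r
    unsatisfiable⇒<λ₁ p {q = q} unsat x<q q<2 =
      ∥ vector dummyVector ∥ p , Isλ₁-vector p dummyVector nonzero (λ {v} → shortest {v})
      -- In the lower cut of the root, 2 is the weak lower bound above `q`, because its p-th power
      -- is the power sum itself.
      , q , x<q , ι (+ 2) , q<2 , inj₂ (ℚ.≤-reflexive (trans (ι-^ 2 p) (sym power)))
      where
      power : powerSum p (vector dummyVector) ≡ ι (+ (2 ℕ.^ p))
      power = trans (powerSum-weight p {vector dummyVector} {dummyVector} λ _ → refl) (cong (λ w → ι (+ w)) (weight-dummy p))
      nonzero : ¬ (vector dummyVector ≗ 0ᵥ)
      nonzero v≗0 = 0≢2 (trans (sym (v≗0 (diagonal dummy)))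
        (trans (∙-coord dummyVector (diagonal dummy)) (cong ι coord-dummy)))
        where
        0≢2 : 0ℚ ≢ ι (+ 2)
        0≢2 ()
      shortest : ∀ {v} z → v ≗ vector z → ¬ (v ≗ 0ᵥ) → weight p dummyVector ℕ.≤ weight p z
      shortest {v} z v≗ v≢0 = [ ℕ.≤-trans (ℕ.≤-reflexive (weight-dummy p))
        , (λ (γ , sol , _) → contradiction (solution⇒satisfiable {γ} sol) unsat) ]′
        (nonzero-cases p {v} z v≗ v≢0)

open ShortVectors

-- Polynomial bounds and sublinear functions

module Growth where
  open import Data.Nat using (_+_; _*_; _^_; _≤_; _<_; _⊔_)

  -- From 2 on, constant factors and summands can be absorbed into the exponent, so a bare power
  -- bounds every polynomial.
  Polynomial : (ℕ → ℕ) → Set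
  Polynomial h = ∃ λ c → ∀ x → 2 ≤ x → h x ≤ x ^ c

  private
    pos : ∀ {x} → 2 ≤ x → ℕ.NonZero x
    pos 2≤x = ℕ.>-nonZero (ℕ.≤-trans (s≤s z≤n) 2≤x)

  poly-const : ∀ a → Polynomial (λ _ → a)
  poly-const a = a , λ x 2≤x → ℕ.≤-trans (n≤2^n a) (ℕ.^-monoˡ-≤ a 2≤x)

  poly-id : Polynomial (λ x → x)
  poly-id = 1 , λ x _ → ℕ.≤-reflexive (sym (ℕ.^-identityʳ x))

  poly-+ : ∀ {g h} → Polynomial g → Polynomial h → Polynomial (λ x → g x + h x)
  poly-+ {g} {h} (a , g≤) (b , h≤) = 1 + (a + b) , λ x 2≤x → begin
    g x + h x                          ≤⟨ ℕ.+-mono-≤ (g≤ x 2≤x) (h≤ x 2≤x) ⟩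
    x ^ a + x ^ b                      ≤⟨ ℕ.+-mono-≤ (ℕ.^-monoʳ-≤ x {{pos 2≤x}} (ℕ.m≤m+n a b))
                                            (ℕ.^-monoʳ-≤ x {{pos 2≤x}} (ℕ.m≤n+m b a)) ⟩
    x ^ (a + b) + x ^ (a + b)          ≡⟨ cong (λ t → x ^ (a + b) + t) (ℕ.+-identityʳ (x ^ (a + b))) ⟨
    2 * x ^ (a + b)                    ≤⟨ ℕ.*-monoˡ-≤ (x ^ (a + b)) 2≤x ⟩
    x ^ (1 + (a + b))                  ∎
    where open ℕ.≤-Reasoning

  poly-* : ∀ {g h} → Polynomial g → Polynomial h → Polynomial (λ x → g x * h x)
  poly-* (a , g≤) (b , h≤) = a + b , λ x 2≤x →
    ℕ.≤-trans (ℕ.*-mono-≤ (g≤ x 2≤x) (h≤ x 2≤x)) (ℕ.≤-reflexive (sym (ℕ.^-distribˡ-+-* x a b)))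

  poly-^ : ∀ {h} d → Polynomial h → Polynomial (λ x → h x ^ d)
  poly-^ d (a , h≤) = a * d , λ x 2≤x →
    ℕ.≤-trans (ℕ.^-monoˡ-≤ d (h≤ x 2≤x)) (ℕ.≤-reflexive (ℕ.^-*-assoc x a d))

  poly-∘ : ∀ {g h} → Polynomial g → Polynomial h → (∀ x → 2 ≤ h x) → Polynomial (g ∘ h)
  poly-∘ {h = h} (a , g≤) (b , h≤) 2≤h = b * a , λ x 2≤x →
    ℕ.≤-trans (g≤ (h x) (2≤h x)) (proj₂ (poly-^ a (b , h≤)) x 2≤x)

  poly-value : ∀ e → Polynomial (valueBound e)
  poly-value (const z)      = poly-const ℤ.∣ z ∣
  poly-value (a [ e ])      = poly-id
  poly-value (op o e f)     = poly-op o
    where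
    sum-bound : Polynomial (λ B → valueBound e B + valueBound f B)
    sum-bound = poly-+ (poly-value e) (poly-value f)
    poly-op : ∀ o → Polynomial (valueBound (op o e f))
    poly-op add    = sum-bound
    poly-op sub    = sum-bound
    poly-op mul    = poly-* (poly-value e) (poly-value f)
    poly-op div    = sum-bound
    poly-op mod    = sum-bound
    poly-op less   = poly-const 1
    poly-op equal  = poly-const 1
    poly-op band   = sum-bound
    poly-op bor    = sum-bound
    poly-op bxor   = sum-bound
    poly-op shiftˡ = sum-bound
    poly-op shiftʳ = sum-bound

  private
    poly-2+ : ∀ {h} → Polynomial h → Polynomial (λ x → 2 + h x)
    poly-2+ = poly-+ (poly-const 2)

  poly-cost : ∀ e → Polynomial (costBound e)
  poly-cost (const z)     = poly-const (2 + ℤ.∣ z ∣)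
  poly-cost (a [ e ])     =
    poly-+ (poly-+ (poly-cost e) (poly-2+ (poly-value e))) (poly-2+ poly-id)
  poly-cost e@(op o f g)  = poly-+ (poly-+ (poly-+ (poly-+
    (poly-cost f) (poly-cost g)) (poly-2+ (poly-value f))) (poly-2+ (poly-value g)))
    (poly-2+ (poly-value e))

  poly-assign : ∀ e f → Polynomial (assignBound e f)
  poly-assign e f = poly-+ (poly-+ (poly-+
    (poly-cost e) (poly-cost f)) (poly-2+ (poly-value e))) (poly-2+ (poly-value f))

  module _ (k : ℕ) (a b : ℤ) where
    open Build k a b

    private
      poly-loop : ∀ {g h} → Polynomial g → Polynomial h → Polynomial (λ x → suc x * (g x + h x))
      poly-loop p q = poly-* (poly-+ (poly-const 1) poly-id) (poly-+ p q)

    poly-build : Polynomial buildTime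
    poly-build = poly-+
      (poly-+ (poly-assign (# 0) (# 1)) (poly-loop (poly-cost (op less (cell 1) rankᴱ))
        (poly-+ (poly-assign (# 0) (cell 1 ⊞ cell 1)) (poly-assign (# 0) (cell 2 ⊞ # 1)))))
      (poly-+
        (poly-+ (poly-assign (# 0) rankᴱ) (poly-+ (poly-assign (# 1) dimᴱ)
          (poly-+ (poly-assign (# 2) normᴱ) (poly-+ (poly-assign (# 3) (const a))
            (poly-assign (# 4) (const b))))))
        (poly-loop (poly-cost (op less (cell 3) rankᴱ)) (poly-+ (poly-assign (# 0) (# 0))
          (poly-+
            (poly-loop (poly-cost (op less (cell 4) dimᴱ)) (poly-+ (poly-assign (posᴱ 0) entryᴱ)
              (poly-+ (poly-assign (posᴱ 1) (# 1)) (poly-assign (# 0) (cell 4 ⊞ # 1)))))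
            (poly-assign (# 0) (cell 3 ⊞ # 1))))))

  sublinear-+ : ∀ {f g} → Sublinear f → Sublinear g → Sublinear (λ n → f n + g n)
  sublinear-+ {f} {g} f-sub g-sub c =
    let N , f≤ = f-sub (2 * c)
        M , g≤ = g-sub (2 * c)
    in N ⊔ M , λ n N⊔M≤n → ℕ.*-cancelˡ-≤ 2 (begin
      2 * (c * (f n + g n))        ≡⟨ distribute c (f n) (g n) ⟩
      2 * c * f n + 2 * c * g n    ≤⟨ ℕ.+-mono-≤ (f≤ n (ℕ.≤-trans (ℕ.m≤m⊔n N M) N⊔M≤n))
                                        (g≤ n (ℕ.≤-trans (ℕ.m≤n⊔m N M) N⊔M≤n)) ⟩
      n + n                        ≡⟨ cong (λ t → n + t) (ℕ.+-identityʳ n) ⟨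
      2 * n                        ∎)
    where
    open ℕ.≤-Reasoning
    distribute : ∀ c x y → 2 * (c * (x + y)) ≡ 2 * c * x + 2 * c * y
    distribute = solve-∀

  sublinear-* : ∀ C {f} → Sublinear f → Sublinear (λ n → C * f n)
  sublinear-* C {f} f-sub c =
    let N , f≤ = f-sub (c * C)
    in N , λ n N≤n → ℕ.≤-trans (ℕ.≤-reflexive (sym (ℕ.*-assoc c C (f n)))) (f≤ n N≤n)

  n+2≤2*n : ∀ {n} → 2 ≤ n → n + 2 ≤ 2 * n
  n+2≤2*n {n} 2≤n = ℕ.+-monoʳ-≤ n (ℕ.≤-trans 2≤n (ℕ.≤-reflexive (sym (ℕ.+-identityʳ n))))

  sublinear-shift : ∀ {f} → Sublinear f → Sublinear (λ n → f (n + 2))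
  sublinear-shift {f} f-sub c =
    let N , f≤ = f-sub (2 * c)
    in N ⊔ 2 , λ n N⊔2≤n → ℕ.*-cancelˡ-≤ 2 (begin
      2 * (c * f (n + 2))    ≡⟨ ℕ.*-assoc 2 c (f (n + 2)) ⟨
      2 * c * f (n + 2)      ≤⟨ f≤ (n + 2) (ℕ.≤-trans (ℕ.≤-trans (ℕ.m≤m⊔n N 2) N⊔2≤n) (ℕ.m≤m+n n 2)) ⟩
      n + 2                  ≤⟨ n+2≤2*n (ℕ.≤-trans (ℕ.m≤n⊔m N 2) N⊔2≤n) ⟩
      2 * n                  ∎)
    where open ℕ.≤-Reasoning

  -- O(√n) is o(n), without square roots: if n < c h(n), then n² < c² h(n)² ≤ 2 a c² n, which is at
  -- most n² once n ≥ 2 a c².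
  sublinear-√ : ∀ {h} a N → (∀ n → N ≤ n → h n * h n ≤ a * (n + 2)) → Sublinear h
  sublinear-√ {h} a N h²≤ c = N ⊔ 2 ⊔ (c * c * a * 2) , λ n ≤n →
    let N⊔2≤n = ℕ.≤-trans (ℕ.m≤m⊔n (N ⊔ 2) (c * c * a * 2)) ≤n
        2≤n = ℕ.≤-trans (ℕ.m≤n⊔m N 2) N⊔2≤n
    in ℕ.≮⇒≥ λ n<ch → ℕ.<⇒≱ (ℕ.*-mono-< n<ch n<ch) (begin
      c * h n * (c * h n)          ≡⟨ square c (h n) ⟩
      c * c * (h n * h n)          ≤⟨ ℕ.*-monoʳ-≤ (c * c) (h²≤ n (ℕ.≤-trans (ℕ.m≤m⊔n N 2) N⊔2≤n)) ⟩
      c * c * (a * (n + 2))        ≤⟨ ℕ.*-monoʳ-≤ (c * c) (ℕ.*-monoʳ-≤ a (n+2≤2*n 2≤n)) ⟩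
      c * c * (a * (2 * n))        ≡⟨ regroup c a n ⟩
      c * c * a * 2 * n            ≤⟨ ℕ.*-monoˡ-≤ n (ℕ.≤-trans (ℕ.m≤n⊔m (N ⊔ 2) (c * c * a * 2)) ≤n) ⟩
      n * n                        ∎)
    where
    open ℕ.≤-Reasoning
    square : ∀ c x → c * x * (c * x) ≡ c * c * (x * x)
    square = solve-∀
    regroup : ∀ c a n → c * c * (a * (2 * n)) ≡ c * c * a * 2 * n
    regroup = solve-∀

  n²≤2*2^n : ∀ n → n * n ≤ 2 * 2 ^ n
  n²≤2*2^n 0 = z≤n
  n²≤2*2^n 1 = s≤s z≤n
  n²≤2*2^n 2 = ℕ.m≤m+n 4 4
  n²≤2*2^n 3 = ℕ.m≤m+n 9 7
  n²≤2*2^n (suc n@(suc (suc (suc k)))) = begin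
    -- The added term is 2 n² - (n + 1)² for n = 3 + k; it would be negative for n = 2, hence the
    -- four base cases.
    suc n * suc n                  ≤⟨ ℕ.m≤m+n (suc n * suc n) (k * k + 4 * k + 2) ⟩
    suc n * suc n + (k * k + 4 * k + 2)  ≡⟨ expand k ⟩
    2 * (n * n)                    ≤⟨ ℕ.*-monoʳ-≤ 2 (n²≤2*2^n n) ⟩
    2 * 2 ^ suc n                  ∎
    where
    open ℕ.≤-Reasoning
    expand : ∀ k → (4 + k) * (4 + k) + (k * k + 4 * k + 2) ≡ 2 * ((3 + k) * (3 + k))
    expand = solve-∀

  rankLog : ℕ → ℕ
  rankLog n = log (n + 2)

  private
    rank≢0 : ∀ n → ℕ.NonZero (n + 2)
    rank≢0 n = ℕ.>-nonZero (ℕ.≤-trans (s≤s z≤n) (ℕ.m≤n+m 2 n))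

  sublinear-log : Sublinear rankLog
  sublinear-log = sublinear-√ 4 0 λ n _ → begin
    rankLog n * rankLog n    ≤⟨ n²≤2*2^n (rankLog n) ⟩
    2 * 2 ^ rankLog n        ≤⟨ ℕ.*-monoʳ-≤ 2 (2^log≤ (n + 2) {{rank≢0 n}}) ⟩
    2 * (2 * (n + 2))        ≡⟨ ℕ.*-assoc 2 2 (n + 2) ⟨
    4 * (n + 2)              ∎
    where open ℕ.≤-Reasoning

  -- 2 ^ f(p) is O(√n) for p = O(log n), since f(p) is eventually below (log n) / 2.
  sublinear-2^ : ∀ k .{{_ : ℕ.NonZero k}} {f} → Sublinear f →
    Sublinear (λ n → 2 ^ f (k * (3 + 3 * rankLog n)))
  sublinear-2^ k {f} f-sub =
    -- As p = 3 k (1 + L), the inequality 6 k f(p) ≤ p is 2 f(p) ≤ 1 + L, which makes the square of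
    -- 2 ^ f(p) linear in n.
    let P , f≤ = f-sub (6 * k)
    in sublinear-√ 4 (2 ^ P) λ n 2^P≤n →
      let L = rankLog n
          p = k * (3 + 3 * L)
          P≤L : P ≤ L
          -- Otherwise n + 2 ≤ 2 ^ L ≤ 2 ^ P ≤ n.
          P≤L = ℕ.≮⇒≥ λ L<P → ℕ.<⇒≱ (ℕ.m<m+n n (s≤s z≤n))
            (ℕ.≤-trans (≤2^log (n + 2)) (ℕ.≤-trans (ℕ.^-monoʳ-≤ 2 (ℕ.<⇒≤ L<P)) 2^P≤n))
          P≤p : P ≤ p
          P≤p = ℕ.≤-trans P≤L (ℕ.≤-trans (ℕ.m≤m+n L _) (ℕ.≤-trans (ℕ.m≤n+m (3 * L) 3) (ℕ.m≤n*m (3 + 3 * L) k)))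
          2f≤1+L : f p + f p ≤ 1 + L
          2f≤1+L = ℕ.*-cancelˡ-≤ 3 (ℕ.*-cancelˡ-≤ k (begin
            k * (3 * (f p + f p))    ≡⟨ regroup k (f p) ⟩
            6 * k * f p              ≤⟨ f≤ p P≤p ⟩
            k * (3 + 3 * L)          ≡⟨ cong (k *_) (ℕ.*-suc 3 L) ⟨
            k * (3 * (1 + L))        ∎))
      in begin
        2 ^ f p * 2 ^ f p      ≡⟨ ℕ.^-distribˡ-+-* 2 (f p) (f p) ⟨
        2 ^ (f p + f p)        ≤⟨ ℕ.^-monoʳ-≤ 2 2f≤1+L ⟩
        2 * 2 ^ L              ≤⟨ ℕ.*-monoʳ-≤ 2 (2^log≤ (n + 2) {{rank≢0 n}}) ⟩
        2 * (2 * (n + 2))      ≡⟨ ℕ.*-assoc 2 2 (n + 2) ⟨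
        4 * (n + 2)            ∎
    where
    open ℕ.≤-Reasoning
    regroup : ∀ k x → k * (3 * (x + x)) ≡ 6 * k * x
    regroup = solve-∀

  -- Moves polynomial overhead into the exponent, where it is sublinear.
  poly-log : ∀ {h} → Polynomial h → ∃ λ c → ∀ n → h (n + 2) ≤ 2 ^ (c * rankLog n)
  poly-log {h} (c , h≤) = c , λ n → begin
    h (n + 2)                ≤⟨ h≤ (n + 2) (ℕ.m≤n+m 2 n) ⟩
    (n + 2) ^ c              ≤⟨ ℕ.^-monoˡ-≤ c (≤2^log (n + 2)) ⟩
    (2 ^ rankLog n) ^ c      ≡⟨ ℕ.^-*-assoc 2 (rankLog n) c ⟩
    2 ^ (rankLog n * c)      ≡⟨ cong (2 ^_) (ℕ.*-comm (rankLog n) c) ⟩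
    2 ^ (c * rankLog n)      ∎
    where open ℕ.≤-Reasoning

open Growth

-- Rational approximation of the approximation factor and the choice of the threshold

module Thresholds where
  open import Algebra.Definitions.RawSemiring ℚ.+-*-rawSemiring using (_^_)

  bernoulli : ∀ {h} → 0ℚ ℚ.≤ h → ∀ k → 1ℚ ℚ.+ ι (+ k) ℚ.* h ℚ.≤ (1ℚ ℚ.+ h) ^ k
  bernoulli {h} 0≤h zero = ℚ.≤-reflexive (trans (cong (1ℚ ℚ.+_) (ℚ.*-zeroˡ h)) (ℚ.+-identityʳ 1ℚ))
  bernoulli {h} 0≤h (suc k) = begin
    1ℚ ℚ.+ ι (+ suc k) ℚ.* h
      ≡⟨ cong (λ t → 1ℚ ℚ.+ t ℚ.* h) (ι-+ 1ℤ (+ k)) ⟩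
    1ℚ ℚ.+ (1ℚ ℚ.+ ι (+ k)) ℚ.* h
      ≡⟨ ℚ.+-identityʳ _ ⟨
    1ℚ ℚ.+ (1ℚ ℚ.+ ι (+ k)) ℚ.* h ℚ.+ 0ℚ
      -- The loss in Bernoulli's inequality is k h², added here to complete the product.
      ≤⟨ ℚ.+-monoʳ-≤ (1ℚ ℚ.+ (1ℚ ℚ.+ ι (+ k)) ℚ.* h) 0≤khh ⟩
    1ℚ ℚ.+ (1ℚ ℚ.+ ι (+ k)) ℚ.* h ℚ.+ ι (+ k) ℚ.* h ℚ.* h
      ≡⟨ factor h (ι (+ k)) ⟩
    (1ℚ ℚ.+ h) ℚ.* (1ℚ ℚ.+ ι (+ k) ℚ.* h)
      ≤⟨ ℚ.*-monoˡ-≤-nonNeg (1ℚ ℚ.+ h)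
           {{ℚ.nonNegative (ℚ.+-mono-≤ (ℚ.nonNegative⁻¹ 1ℚ) 0≤h)}} (bernoulli 0≤h k) ⟩
    (1ℚ ℚ.+ h) ℚ.* (1ℚ ℚ.+ h) ^ k ∎
    where
    open ℚ.≤-Reasoning
    open +-*-Solver
    factor : ∀ h k → 1ℚ ℚ.+ (1ℚ ℚ.+ k) ℚ.* h ℚ.+ k ℚ.* h ℚ.* h ≡ (1ℚ ℚ.+ h) ℚ.* (1ℚ ℚ.+ k ℚ.* h)
    factor = solve 2 (λ h k → con 1ℚ :+ (con 1ℚ :+ k) :* h :+ k :* h :* h
      := (con 1ℚ :+ h) :* (con 1ℚ :+ k :* h)) refl
    0≤* : ∀ {x y} → 0ℚ ℚ.≤ x → 0ℚ ℚ.≤ y → 0ℚ ℚ.≤ x ℚ.* y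
    0≤* {x} {y} 0≤x 0≤y = subst (ℚ._≤ x ℚ.* y) (ℚ.*-zeroʳ x)
      (ℚ.*-monoˡ-≤-nonNeg x {{ℚ.nonNegative 0≤x}} 0≤y)
    0≤khh : 0ℚ ℚ.≤ ι (+ k) ℚ.* h ℚ.* h
    0≤khh = 0≤* (0≤* (ι-mono-≤ (ℤ.+≤+ (z≤n {k}))) 0≤h) 0≤h

  record UnitFraction (q : ℚ) : Set where
    field
      k         : ℕ
      {{k≢0}}   : ℕ.NonZero k
      h         : ℚ
      0<h       : 0ℚ ℚ.< h
      k*h≡1     : ι (+ k) ℚ.* h ≡ 1ℚ
      h+h<q     : h ℚ.+ h ℚ.< q

  unitFraction : ∀ q → 0ℚ ℚ.< q → UnitFraction q
  -- In this form positivity computes on the numerator and leaves only the case of a positive one.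
  unitFraction q 0<q with ℚ.positive 0<q
  unitFraction q@(ℚ.mkℚ ℤ.+[1+ a ] d _) 0<q | _ = record
    { k = k ; h = h ; 0<h = ℚ.positive⁻¹ h {{ℚ.normalize-pos 1 k}} ; k*h≡1 = k*h≡1
    ; h+h<q = ℚ.*-cancelʳ-<-nonNeg (ι (+ k)) {{ℚ.nonNegative (ι-mono-≤ (ℤ.+≤+ (z≤n {k})))}}
        (ℚ.≤-<-trans (ℚ.≤-reflexive (double (ι (+ k)) h k*h≡1))
          (subst (ℚ._< q ℚ.* ι (+ k)) (ℚ.+-identityʳ (1ℚ ℚ.+ 1ℚ)) 2+0<))
    }
    where
    k : ℕ
    -- With q = (a + 1) / (d + 1) this gives q k = 4 (a + 1) > 2 = (h + h) k.
    k = 4 ℕ.* suc d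
    h : ℚ
    h = + 1 ℚ./ k
    k*h≡1 : ι (+ k) ℚ.* h ≡ 1ℚ
    k*h≡1 = ℚ.toℚᵘ-injective (begin
      ℚ.toℚᵘ (ι (+ k) ℚ.* h)               ≈⟨ ℚ.toℚᵘ-homo-* (ι (+ k)) h ⟩
      ℚ.toℚᵘ (ι (+ k)) ℚᵘ.* ℚ.toℚᵘ h      ≈⟨ ℚᵘ.*-cong (toℚᵘ-ι (+ k)) (ℚ.toℚᵘ-fromℚᵘ (ℚᵘ.mkℚᵘ (+ 1) (ℕ.pred k))) ⟩
      ℚᵘ.mkℚᵘ (+ k) 0 ℚᵘ.* ℚᵘ.mkℚᵘ (+ 1) (ℕ.pred k)  ≈⟨ ℚᵘ.*≡* (arith (+ k)) ⟩
      ℚᵘ.1ℚᵘ                              ∎)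
      where
      open import Relation.Binary.Reasoning.Setoid ℚᵘ.≃-setoid
      arith : ∀ k → k ℤ.* + 1 ℤ.* + 1 ≡ + 1 ℤ.* (+ 1 ℤ.* k)
      arith = solve-ℤ
    q*d : q ℚ.* ι (+ suc d) ≡ ι (+ suc a)
    q*d = ℚ.toℚᵘ-injective (begin
      ℚ.toℚᵘ (q ℚ.* ι (+ suc d))                      ≈⟨ ℚ.toℚᵘ-homo-* q (ι (+ suc d)) ⟩
      ℚ.toℚᵘ q ℚᵘ.* ℚ.toℚᵘ (ι (+ suc d))             ≈⟨ ℚᵘ.*-cong (ℚᵘ.≃-refl {ℚᵘ.mkℚᵘ (+ suc a) d}) (toℚᵘ-ι (+ suc d)) ⟩
      ℚᵘ.mkℚᵘ (+ suc a) d ℚᵘ.* ℚᵘ.mkℚᵘ (+ suc d) 0    ≈⟨ ℚᵘ.*≡* (arith (+ suc a) (+ suc d)) ⟩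
      ℚᵘ.mkℚᵘ (+ suc a) 0                            ≈⟨ toℚᵘ-ι (+ suc a) ⟨
      ℚ.toℚᵘ (ι (+ suc a))                           ∎)
      where
      open import Relation.Binary.Reasoning.Setoid ℚᵘ.≃-setoid
      arith : ∀ a d → a ℤ.* d ℤ.* + 1 ≡ a ℤ.* (d ℤ.* + 1)
      arith = solve-ℤ
    double : ∀ k h → k ℚ.* h ≡ 1ℚ → (h ℚ.+ h) ℚ.* k ≡ 1ℚ ℚ.+ 1ℚ
    double k h kh≡1 = trans (ℚ.*-comm (h ℚ.+ h) k)
      (trans (ℚ.*-distribˡ-+ k h h) (cong₂ ℚ._+_ kh≡1 kh≡1))
    q*k : q ℚ.* ι (+ k) ≡ ι (+ (4 ℕ.* suc a))
    q*k = begin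
      q ℚ.* ι (+ (4 ℕ.* suc d))               ≡⟨ cong (λ t → q ℚ.* ι t) (ℤ.pos-* 4 (suc d)) ⟩
      q ℚ.* ι (+ 4 ℤ.* + suc d)               ≡⟨ cong (q ℚ.*_) (ι-* (+ 4) (+ suc d)) ⟩
      q ℚ.* (ι (+ 4) ℚ.* ι (+ suc d))         ≡⟨ swap q (ι (+ 4)) (ι (+ suc d)) ⟩
      ι (+ 4) ℚ.* (q ℚ.* ι (+ suc d))         ≡⟨ cong (ι (+ 4) ℚ.*_) q*d ⟩
      ι (+ 4) ℚ.* ι (+ suc a)                 ≡⟨ ι-* (+ 4) (+ suc a) ⟨
      ι (+ 4 ℤ.* + suc a)                     ≡⟨ cong ι (ℤ.pos-* 4 (suc a)) ⟨
      ι (+ (4 ℕ.* suc a))                     ∎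
      where
      open ≡-Reasoning
      open +-*-Solver
      swap : ∀ x y z → x ℚ.* (y ℚ.* z) ≡ y ℚ.* (x ℚ.* z)
      swap = solve 3 (λ x y z → x :* (y :* z) := y :* (x :* z)) refl
    2+0< : 1ℚ ℚ.+ 1ℚ ℚ.+ 0ℚ ℚ.< q ℚ.* ι (+ k)
    2+0< = ℚ.<-≤-trans (ℚ.*<* (ℤ.+<+ (s≤s (s≤s (s≤s z≤n)))))
      (ℚ.≤-trans (ι-mono-≤ {+ 3} (ℤ.+≤+ (ℕ.≤-trans (ℕ.m≤m+n 3 1) (ℕ.m≤m*n 4 (suc a)))))
        (ℚ.≤-reflexive (sym q*k)))

  -- All that the reduction needs to know about `ε`. The rational `gap` separates γ δ from 2, as a
  -- strict inequality of cuts requires, and `k` converts powers of 2 into powers of `δ`.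
  record Threshold (ε : ℝ) : Set where
    field
      δ         : ℚ
      {{δ>0}}   : Positive δ
      k         : ℕ
      {{k≢0}}   : ℕ.NonZero k
      2^≤δ^     : ∀ e → ι (+ (2 ℕ.^ e)) ℚ.≤ δ ^ (k ℕ.* e)
      gap       : ℚ
      gap<2     : gap ℚ.< ι (+ 2)
      γδ<gap    : ℝ.U (((1ℚ ℚ.+ 1ℚ) ⊝ ε) ⊛ δ) gap

  module _ {q} (u : UnitFraction q) where
    open UnitFraction u

    private
      δ : ℚ
      δ = 1ℚ ℚ.+ h

      0<δ : 0ℚ ℚ.< δ
      0<δ = ℚ.+-mono-< (ℚ.positive⁻¹ 1ℚ) 0<h

      instance
        δ-positive : Positive δ
        δ-positive = ℚ.positive 0<δ

        δ-nonZero : ℚ.NonZero δ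
        δ-nonZero = ℚ.pos⇒nonZero δ

      2^≤δ^ : ∀ e → ι (+ (2 ℕ.^ e)) ℚ.≤ δ ^ (k ℕ.* e)
      2^≤δ^ e = begin
        ι (+ (2 ℕ.^ e))    ≡⟨ ι-^ 2 e ⟨
        ι (+ 2) ^ e        ≤⟨ ^-mono-≤ e (ι-mono-≤ {+ 0} {+ 2} (ℤ.+≤+ z≤n)) 2≤δ^k ⟩
        (δ ^ k) ^ e        ≡⟨ ^-assocʳ δ k e ⟩
        δ ^ (k ℕ.* e)      ∎
        where
        open ℚ.≤-Reasoning
        2≤δ^k : ι (+ 2) ℚ.≤ δ ^ k
        2≤δ^k = ℚ.≤-trans (ℚ.≤-reflexive (cong (1ℚ ℚ.+_) (sym k*h≡1))) (bernoulli (ℚ.<⇒≤ 0<h) k)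

      -- (2 − 2h)(1 + h) = 2 − 2h²
      gap : ℚ
      gap = (1ℚ ℚ.+ 1ℚ ℚ.- (h ℚ.+ h)) ℚ.* δ

      gap<2 : gap ℚ.< ι (+ 2)
      gap<2 = ℚ.≤-<-trans (ℚ.≤-reflexive (expand h))
        (subst (1ℚ ℚ.+ 1ℚ ℚ.- (h ℚ.* h ℚ.+ h ℚ.* h) ℚ.<_) (ℚ.+-identityʳ (1ℚ ℚ.+ 1ℚ))
          (ℚ.+-monoʳ-< (1ℚ ℚ.+ 1ℚ) (ℚ.neg-antimono-< (ℚ.+-mono-< 0<h² 0<h²))))
        where
        open +-*-Solver
        expand : ∀ h → (1ℚ ℚ.+ 1ℚ ℚ.- (h ℚ.+ h)) ℚ.* (1ℚ ℚ.+ h) ≡ 1ℚ ℚ.+ 1ℚ ℚ.- (h ℚ.* h ℚ.+ h ℚ.* h)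
        expand = solve 1 (λ h → (con 1ℚ :+ con 1ℚ :- (h :+ h)) :* (con 1ℚ :+ h)
          := con 1ℚ :+ con 1ℚ :- (h :* h :+ h :* h)) refl
        0<h² : 0ℚ ℚ.< h ℚ.* h
        0<h² = subst (ℚ._< h ℚ.* h) (ℚ.*-zeroʳ h) (ℚ.*-monoʳ-<-pos h {{ℚ.positive 0<h}} 0<h)

      -- Unfolding the cuts leaves `L ε (2 − gap ÷ δ)`, whose argument is h + h, below q and hence
      -- below `ε`.
      γδ<gap : ∀ ε → ℝ.L ε q → ℝ.U (((1ℚ ℚ.+ 1ℚ) ⊝ ε) ⊛ δ) gap
      γδ<gap ε q<ε = subst (ℝ.L ε) (sym (trans (cong (λ t → 1ℚ ℚ.+ 1ℚ ℚ.- t) cancel) (flip h)))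
        (ℝ.L-lower ε h+h<q q<ε)
        where
        open +-*-Solver
        cancel : gap ÷ δ ≡ 1ℚ ℚ.+ 1ℚ ℚ.- (h ℚ.+ h)
        cancel = trans (ℚ.*-assoc (1ℚ ℚ.+ 1ℚ ℚ.- (h ℚ.+ h)) δ (1/ δ))
          (trans (cong ((1ℚ ℚ.+ 1ℚ ℚ.- (h ℚ.+ h)) ℚ.*_) (ℚ.*-inverseʳ δ)) (ℚ.*-identityʳ _))
        flip : ∀ h → 1ℚ ℚ.+ 1ℚ ℚ.- (1ℚ ℚ.+ 1ℚ ℚ.- (h ℚ.+ h)) ≡ h ℚ.+ h
        flip = solve 1 (λ h → con 1ℚ :+ con 1ℚ :- (con 1ℚ :+ con 1ℚ :- (h :+ h)) := h :+ h) refl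

    fromUnitFraction : ∀ ε → ℝ.L ε q → Threshold ε
    fromUnitFraction ε q<ε = record
      { δ = δ ; k = k ; 2^≤δ^ = 2^≤δ^ ; gap = gap ; gap<2 = gap<2 ; γδ<gap = γδ<gap ε q<ε }

  threshold : ∀ ε → fromℚ 0ℚ <ℝ ε → Threshold ε
  threshold ε (q , 0<q , q<ε) = fromUnitFraction (unitFraction q 0<q) ε q<ε

open Thresholds

-- The reduction from 3-SAT and its running time

module GapReduction where
  open import Data.Nat using (_+_; _*_; _^_; _≤_; _<_; _⊔_)

  Unique-lookup-injective : ∀ {A : Set} {xs : List A} → Unique xs →
    ∀ {i j} → List.lookup xs i ≡ List.lookup xs j → i ≡ j
  Unique-lookup-injective (_ ∷ _)   {Fin.zero}  {Fin.zero}  _  = refl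
  Unique-lookup-injective (x∉ ∷ _)  {Fin.zero}  {Fin.suc j} eq = contradiction eq (All-lookup x∉ j)
  Unique-lookup-injective (x∉ ∷ _)  {Fin.suc i} {Fin.zero}  eq = contradiction (sym eq) (All-lookup x∉ i)
  Unique-lookup-injective (_ ∷ xs!) {Fin.suc i} {Fin.suc j} eq =
    cong Fin.suc (Unique-lookup-injective xs! eq)

  literalIx : ∀ {n} → Literal n → Fin (n * 2)
  literalIx (v , b) = Fin.combine v (boolIx b)
    where
    boolIx : Bool → Fin 2
    boolIx true  = Fin.zero
    boolIx false = Fin.suc Fin.zero

  literalIx-injective : ∀ {n} (l l′ : Literal n) → literalIx l ≡ literalIx l′ → l ≡ l′
  literalIx-injective (v , b) (v′ , b′) eq with Fin.combine-injective v _ v′ _ eq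
  literalIx-injective (v , true)  (v , true)  eq | refl , _ = refl
  literalIx-injective (v , false) (v , false) eq | refl , _ = refl
  literalIx-injective (v , true)  (v , false) eq | refl , ()
  literalIx-injective (v , false) (v , true)  eq | refl , ()

  -- An injective numbering: as clauses do not repeat, there are at most (2 n)³ of them.
  clauseIx : ∀ {n} → Clause n → Fin (n * 2 * (n * 2 * (n * 2)))
  clauseIx (l₀ ∷ l₁ ∷ l₂ ∷ []) =
    Fin.combine (literalIx l₀) (Fin.combine (literalIx l₁) (literalIx l₂))

  clauseIx-injective : ∀ {n} (c c′ : Clause n) → clauseIx c ≡ clauseIx c′ → c ≡ c′
  clauseIx-injective (l₀ ∷ l₁ ∷ l₂ ∷ []) (l₀′ ∷ l₁′ ∷ l₂′ ∷ []) eq =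
    let eq₀ , eq₁₂ = Fin.combine-injective (literalIx l₀) _ (literalIx l₀′) _ eq
        eq₁ , eq₂ = Fin.combine-injective (literalIx l₁) _ (literalIx l₁′) _ eq₁₂
    in cong₂ _∷_ (literalIx-injective l₀ l₀′ eq₀) (cong₂ _∷_ (literalIx-injective l₁ l₁′ eq₁)
         (cong₂ _∷_ (literalIx-injective l₂ l₂′ eq₂) refl))

  dim≤ : ∀ φ → let open Formula φ; N = vars + 2 in N + length clauses ≤ 8 * (N * N * N)
  dim≤ φ = begin
    n + 2 + length clauses               ≤⟨ ℕ.+-monoʳ-≤ (n + 2) count ⟩
    -- The added term is the difference 8 (n + 2)³ - 8 n³ - (n + 2).
    n + 2 + n * 2 * (n * 2 * (n * 2))    ≤⟨ ℕ.m≤m+n _ (48 * n * n + 95 * n + 62) ⟩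
    n + 2 + n * 2 * (n * 2 * (n * 2)) + (48 * n * n + 95 * n + 62)
      ≡⟨ expand n ⟩
    8 * ((n + 2) * (n + 2) * (n + 2))    ∎
    where
    open Formula φ renaming (vars to n)
    open ℕ.≤-Reasoning
    count : length clauses ≤ n * 2 * (n * 2 * (n * 2))
    count = Fin.injective⇒≤ {f = clauseIx ∘ List.lookup clauses} λ {i} {j} eq →
      Unique-lookup-injective unique
        (clauseIx-injective (List.lookup clauses i) (List.lookup clauses j) eq)
    expand : ∀ n → n + 2 + n * 2 * (n * 2 * (n * 2)) + (48 * n * n + 95 * n + 62)
      ≡ 8 * ((n + 2) * (n + 2) * (n + 2))
    expand = solve-∀

  private variable
    P : ℤ → Set
    zs : List ℤ

  nth-All : P 0ℤ → All P zs → ∀ t → P (nth zs t)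
  nth-All p0 []       t       = p0
  nth-All p0 (p ∷ ps) zero    = p
  nth-All p0 (p ∷ ps) (suc t) = nth-All p0 ps t

  All-nth : ∀ zs → (∀ t → P (nth zs t)) → All P zs
  All-nth []       p = []
  All-nth (z ∷ zs) p = p zero ∷ All-nth zs (p ∘ suc)

  load-bounded : ∀ {B zs} → All (λ z → ℤ.∣ z ∣ ≤ B) zs → Bounded B (load zs)
  load-bounded b zero    (+ i)     = nth-All z≤n b i
  load-bounded b zero    -[1+ _ ]  = z≤n
  load-bounded b (suc _) _         = z≤n

  wordLength-bound : ∀ {B zs} → All (λ z → ℤ.∣ z ∣ ≤ B) zs → wordLength zs ≤ 2 + B
  wordLength-bound b = s≤s (go b)
    where
    go : ∀ {B zs} → All (λ z → ℤ.∣ z ∣ ≤ B) zs → List.foldr _⊔_ 0 (List.map bits zs) ≤ suc B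
    go []                = z≤n
    go (_∷_ {z} z≤B b)   = ℕ.⊔-lub (ℕ.≤-trans (bits≤ z) (s≤s z≤B)) (go b)

  totalLength-bound : ∀ {B zs} → All (λ z → ℤ.∣ z ∣ ≤ B) zs → totalLength zs ≤ length zs * (2 + B)
  totalLength-bound []              = z≤n
  totalLength-bound (_∷_ {z} z≤B b) =
    ℕ.+-mono-≤ (s≤s (ℕ.≤-trans (bits≤ z) (s≤s z≤B))) (totalLength-bound b)

  encode-bounded : ∀ φ {B} → Formula.vars φ ≤ B → length (Formula.clauses φ) ≤ B →
    All (λ z → ℤ.∣ z ∣ ≤ B) (PromiseProblem.encode 3-SAT φ)
  encode-bounded φ {B} n≤B m≤B = n≤B ∷ m≤B ∷ go clauses
    where
    open Formula φ
    literal≤ : ∀ (l : Literal vars) → ℤ.∣ encodeLiteral l ∣ ≤ B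
    literal≤ (v , true)  = ℕ.≤-trans (Fin.toℕ<n v) n≤B
    literal≤ (v , false) = ℕ.≤-trans (Fin.toℕ<n v) n≤B
    go : ∀ cs → All (λ z → ℤ.∣ z ∣ ≤ B)
      (List.concatMap (λ c → List.map encodeLiteral (Vec.toList {n = 3} c)) cs)
    go [] = []
    go ((l₀ ∷ l₁ ∷ l₂ ∷ []) ∷ cs) = literal≤ l₀ ∷ literal≤ l₁ ∷ literal≤ l₂ ∷ go cs

  svpTime-bound : ∀ x y d {l l′} → l ≤ l′ → 2 ^ x * 2 ^ y * l ^ d ≤ 2 ^ (x + y) * l′ ^ d
  svpTime-bound x y d l≤l′ =
    ℕ.*-mono-≤ (ℕ.≤-reflexive (sym (ℕ.^-distribˡ-+-* 2 x y))) (ℕ.^-monoˡ-≤ d l≤l′)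

  -- `u` stands for the exponential factor; being at least 1, it can be pulled out of the polynomial
  -- summands as well.
  collect-times : ∀ {t₁ t₂ t₃ t a v w u s e} → 1 ≤ u → t₁ ≤ a → t₂ ≤ v * t → v ≤ w →
    t ≤ u * s → t₃ ≤ 14 → a + (14 + w * s) ≤ e → t₁ + (t₂ + t₃) ≤ u * e
  collect-times {t₁} {t₂} {t₃} {t} {a} {v} {w} {u@(suc o)} {s} {e} _ t₁≤ t₂≤ v≤w t≤ t₃≤ e≤ = begin
    t₁ + (t₂ + t₃)
      ≤⟨ ℕ.+-mono-≤ t₁≤ (ℕ.+-mono-≤ (ℕ.≤-trans t₂≤ (ℕ.*-mono-≤ v≤w t≤)) t₃≤) ⟩
    a + (w * (u * s) + 14)
      ≤⟨ ℕ.m≤m+n _ (o * a + o * 14) ⟩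
    a + (w * (u * s) + 14) + (o * a + o * 14)
      ≡⟨ arith a w o s ⟩
    u * (a + (14 + w * s))
      ≤⟨ ℕ.*-monoʳ-≤ u e≤ ⟩
    u * e ∎
    where
    open ℕ.≤-Reasoning
    arith : ∀ a w o s → a + (w * ((1 + o) * s) + 14) + (o * a + o * 14) ≡ (1 + o) * (a + (14 + w * s))
    arith = solve-∀

  module Reduction {ε} (θ : Threshold ε) (A : Program) (f g : ℕ → ℕ) (d : ℕ) where
    open Threshold θ
    open Build k (ℚ.↥ δ) (ℚ.↧ δ)

    reduction : Program
    reduction = build ⨾ shiftᴾ 5 A ⨾ 1 [ # 0 ]≔ cell 6

    exponent norm : ℕ → ℕ
    exponent n = 3 + 3 * rankLog n
    norm n = k * exponent n

    -- One bound, in terms of the rank, for every integer in memory while the lattice is written;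
    -- each summand discharges one of the size hypotheses of `Correct`.
    size : ℕ → ℕ
    size x = 25 + 2 * x + 8 * (x * x * x) + k * (3 + 3 * x) + ℤ.∣ ℚ.↥ δ ∣ + ℤ.∣ ℚ.↧ δ ∣

    lengthBound overhead : ℕ → ℕ
    lengthBound x = 5 + x * (8 * (x * x * x) * 2)
    overhead x = buildTime (size x) + (14 + (2 + size x) * (lengthBound x * (2 + size x)) ^ d)

    poly-size : Polynomial size
    poly-size = poly-+ (poly-+ (poly-+ (poly-+ (poly-+ (poly-const 25) (poly-* (poly-const 2) poly-id))
      (poly-* (poly-const 8) (poly-* (poly-* poly-id poly-id) poly-id)))
      (poly-* (poly-const k) (poly-+ (poly-const 3) (poly-* (poly-const 3) poly-id))))
      (poly-const ℤ.∣ ℚ.↥ δ ∣)) (poly-const ℤ.∣ ℚ.↧ δ ∣)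

    poly-overhead : Polynomial overhead
    poly-overhead = poly-+
      (poly-∘ (poly-build k (ℚ.↥ δ) (ℚ.↧ δ)) poly-size (λ x → s≤s (s≤s z≤n)))
      (poly-+ (poly-const 14) (poly-* (poly-+ (poly-const 2) poly-size)
        (poly-^ d (poly-* (poly-+ (poly-const 5) (poly-* poly-id
          (poly-* (poly-* (poly-const 8) (poly-* (poly-* poly-id poly-id) poly-id)) (poly-const 2))))
          (poly-+ (poly-const 2) poly-size)))))

    abstract
      -- Abstract, to keep the large exponent assembled by `poly-overhead` from being unfolded.
      overhead-log : ∃ λ c → ∀ n → overhead (n + 2) ≤ 2 ^ (c * rankLog n)
      overhead-log = poly-log poly-overhead

    degree : ℕ
    degree = proj₁ overhead-log

    time : ℕ → ℕ
    time n = 2 ^ f (norm n) + g (n + 2) + degree * rankLog n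

    sublinear-time : Sublinear f → Sublinear g → Sublinear time
    sublinear-time f-sub g-sub = sublinear-+ (sublinear-+ (sublinear-2^ k f-sub) (sublinear-shift g-sub))
      (sublinear-* degree sublinear-log)

    module _ (φ : Formula) where
      open Formula φ renaming (vars to n)
      open Rows φ

      private
        N M B p : ℕ
        N = n + 2
        M = N + m
        B = size N
        p = norm n

        instance
          p≢0 : ℕ.NonZero p
          p≢0 = ℕ.m*n≢0 k (exponent n)

      M≤8N³ : M ≤ 8 * (N * N * N)
      M≤8N³ = dim≤ φ

      M≤2^exponent : M ≤ 2 ^ exponent n
      M≤2^exponent = begin
        M                              ≤⟨ M≤8N³ ⟩
        8 * (N * N * N)                ≤⟨ ℕ.*-monoʳ-≤ 8 (ℕ.*-mono-≤ (ℕ.*-mono-≤ N≤ N≤) N≤) ⟩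
        8 * (x * x * x)                ≡⟨ cube x ⟩
        8 * (x ^ 3)                    ≡⟨ cong (8 *_) (trans (ℕ.^-*-assoc 2 (rankLog n) 3) (cong (2 ^_) (ℕ.*-comm (rankLog n) 3))) ⟩
        2 ^ 3 * 2 ^ (3 * rankLog n)    ≡⟨ ℕ.^-distribˡ-+-* 2 3 (3 * rankLog n) ⟨
        2 ^ exponent n                 ∎
        where
        open ℕ.≤-Reasoning
        x : ℕ
        x = 2 ^ rankLog n
        N≤ : N ≤ x
        N≤ = ≤2^log N
        cube : ∀ x → 8 * (x * x * x) ≡ 8 * (x * (x * (x * 1)))
        cube = solve-∀

      instanceOf : SVPInstance
      instanceOf = record
        { rank = N ; dim = M ; basis = basis ; independent = independent ; δ = δ ; p = p }

      yes-instance : ∀ {γ} → Satisfiable φ → PromiseProblem.Yes (GapSVPpar γ) instanceOf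
      yes-instance sat = satisfiable⇒λ₁≤ p sat
        -- With e = `exponent n` and p = k e, the bound M ≤ 2 ^ e gives both M ≤ 2 ^ p and, by the
        -- choice of k, M ≤ δ ^ p.
        (ℕ.≤-trans M≤2^exponent (ℕ.^-monoʳ-≤ 2 (ℕ.m≤n*m (exponent n) k)))
        (ℚ.<⇒≤ (ℚ.positive⁻¹ δ))
        (ℚ.≤-trans (ι-mono-≤ (ℤ.+≤+ M≤2^exponent)) (2^≤δ^ (exponent n)))

      no-instance : ¬ Satisfiable φ →
        PromiseProblem.No (GapSVPpar ((1ℚ ℚ.+ 1ℚ) ⊝ ε)) instanceOf
      no-instance unsat =
        unsatisfiable⇒<λ₁ p {((1ℚ ℚ.+ 1ℚ) ⊝ ε) ⊛ δ} {gap} unsat γδ<gap gap<2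

      25≤B : 25 ≤ B
      25≤B = ℕ.m≤m+n 25 _

      2N≤B : 2 * N ≤ B
      2N≤B = begin
        2 * N                          ≤⟨ ℕ.m≤n+m (2 * N) 25 ⟩
        25 + 2 * N                     ≤⟨ ℕ.m≤m+n (25 + 2 * N) (8 * (N * N * N)) ⟩
        _                              ≤⟨ ℕ.m≤m+n (25 + 2 * N + 8 * (N * N * N)) (k * (3 + 3 * N)) ⟩
        _                              ≤⟨ ℕ.m≤m+n (25 + 2 * N + 8 * (N * N * N) + k * (3 + 3 * N)) ℤ.∣ ℚ.↥ δ ∣ ⟩
        _                              ≤⟨ ℕ.m≤m+n _ ℤ.∣ ℚ.↧ δ ∣ ⟩
        B                              ∎
        where open ℕ.≤-Reasoning

      M≤B : M ≤ B
      M≤B = begin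
        M                              ≤⟨ M≤8N³ ⟩
        8 * (N * N * N)                ≤⟨ ℕ.m≤n+m (8 * (N * N * N)) (25 + 2 * N) ⟩
        _                              ≤⟨ ℕ.m≤m+n (25 + 2 * N + 8 * (N * N * N)) (k * (3 + 3 * N)) ⟩
        _                              ≤⟨ ℕ.m≤m+n (25 + 2 * N + 8 * (N * N * N) + k * (3 + 3 * N)) ℤ.∣ ℚ.↥ δ ∣ ⟩
        _                              ≤⟨ ℕ.m≤m+n _ ℤ.∣ ℚ.↧ δ ∣ ⟩
        B                              ∎
        where open ℕ.≤-Reasoning

      p≤B : p ≤ B
      p≤B = begin
        p                              ≤⟨ ℕ.*-monoʳ-≤ k (ℕ.+-monoʳ-≤ 3 (ℕ.*-monoʳ-≤ 3 (log≤ N {{N≢0}}))) ⟩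
        k * (3 + 3 * N)                ≤⟨ ℕ.m≤n+m (k * (3 + 3 * N)) (25 + 2 * N + 8 * (N * N * N)) ⟩
        _                              ≤⟨ ℕ.m≤m+n (25 + 2 * N + 8 * (N * N * N) + k * (3 + 3 * N)) ℤ.∣ ℚ.↥ δ ∣ ⟩
        _                              ≤⟨ ℕ.m≤m+n _ ℤ.∣ ℚ.↧ δ ∣ ⟩
        B                              ∎
        where
        open ℕ.≤-Reasoning
        N≢0 : ℕ.NonZero N
        N≢0 = ℕ.>-nonZero (ℕ.≤-trans (s≤s z≤n) (ℕ.m≤n+m 2 n))

      ↥δ≤B : ℤ.∣ ℚ.↥ δ ∣ ≤ B
      ↥δ≤B = ℕ.≤-trans (ℕ.m≤n+m ℤ.∣ ℚ.↥ δ ∣ (25 + 2 * N + 8 * (N * N * N) + k * (3 + 3 * N)))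
        (ℕ.m≤m+n _ ℤ.∣ ℚ.↧ δ ∣)

      ↧δ≤B : ℤ.∣ ℚ.↧ δ ∣ ≤ B
      ↧δ≤B = ℕ.m≤n+m ℤ.∣ ℚ.↧ δ ∣ (25 + 2 * N + 8 * (N * N * N) + k * (3 + 3 * N) + ℤ.∣ ℚ.↥ δ ∣)

      input-bounded : Bounded B (load input)
      input-bounded = load-bounded (encode-bounded φ
        (ℕ.≤-trans (ℕ.m≤m+n n 2) (ℕ.≤-trans (ℕ.m≤m+n N (N + 0)) 2N≤B))
        (ℕ.≤-trans (ℕ.m≤n+m m N) M≤B))

      private
        V W : ℕ
        V = wordLength input
        W = wordLength (encodeSVP instanceOf)

      open Correct V input n m B refl refl input-bounded 25≤B 2N≤B M≤B p≤B ↥δ≤B ↧δ≤B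
        using (rowᴸ; header; output; length-row; build-correct)
      open Rules V using (Run; seq; assign; charge; charge≤)

      output≡ : output ≡ encodeSVP instanceOf
      output≡ = cong (header ++_) (concats-tabulate N (λ i → rowᴸ i M) _ λ i →
        concats-tabulate M _ _ λ j → sym (encodeℚ-ι (entry input n (toℕ i) (toℕ j))))

      length-output : length output ≡ 5 + N * (M * 2)
      length-output = cong (λ l → 5 + l) (length-concats (λ i → rowᴸ i M) (λ i → length-row i M) N)

      length≤ : length (encodeSVP instanceOf) ≤ lengthBound N
      length≤ = ℕ.≤-trans (ℕ.≤-reflexive (trans (cong length (sym output≡)) length-output))
        (ℕ.+-monoʳ-≤ 5 (ℕ.*-monoʳ-≤ N (ℕ.*-monoˡ-≤ 2 M≤8N³)))

      time-bound : ∀ {t₁ t₂ t₃ t} → All (λ z → ℤ.∣ z ∣ ≤ B) (encodeSVP instanceOf) →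
        t₁ ≤ buildTime B → t₂ ≤ W * t → t ≤ svpTime f g d instanceOf → t₃ ≤ 14 →
        t₁ + (t₂ + t₃) ≤ 2 ^ time n
      time-bound bounded t₁≤ t₂≤ t≤ t₃≤ = ℕ.≤-trans
        (collect-times (ℕ.m^n>0 2 (2 ^ f p + g N)) t₁≤ t₂≤ (wordLength-bound bounded)
          (ℕ.≤-trans t≤ (svpTime-bound (2 ^ f p) (g N) d
            (ℕ.≤-trans (totalLength-bound bounded) (ℕ.*-monoˡ-≤ (2 + B) length≤)))) t₃≤
          (proj₂ overhead-log n))
        (ℕ.≤-reflexive (sym (ℕ.^-distribˡ-+-* 2 (2 ^ f p + g N) (degree * rankLog n))))

      -- The shifted program leaves its answer in array 5 + 1. A charge is at most 2 for 0 and 3 for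
      -- the answer; index, right-hand side and the two final charges add up to 2 + 7 + 2 + 3 = 14.
      copy-output : ∀ {z} σ → ℤ.∣ z ∣ ≤ 1 → σ 6 0ℤ ≡ z →
        ∃₂ λ σ′ t → Run (1 [ # 0 ]≔ cell 6) σ σ′ t × σ′ 1 0ℤ ≡ z × t ≤ 14
      copy-output {z} σ z≤1 eq = _ , _ , assign , eq
        , ℕ.+-mono-≤ (ℕ.+-mono-≤ (ℕ.+-mono-≤ (charge≤ 0ℤ)
            (ℕ.+-mono-≤ (ℕ.+-mono-≤ (charge≤ 0ℤ) (charge≤ 0ℤ)) c≤)) (charge≤ 0ℤ)) c≤
        where
        c≤ : charge (σ 6 0ℤ) ≤ 3
        c≤ = subst (λ y → charge y ≤ 3) (sym eq) (ℕ.≤-trans (charge≤ z) (s≤s (s≤s z≤1)))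

      outputs : ∀ {z} → ℤ.∣ z ∣ ≤ 1 →
        Outputs_within A (encodeSVP instanceOf) z (svpTime f g d instanceOf) →
        Outputs_within reduction input z (2 ^ time n)
      outputs {z} z≤1 (τ , t , run , τ≡z , t≤) = after-build build-correct
        where
        Result : Set
        Result = Outputs_within reduction input z (2 ^ time n)

        after-copy : ∀ {σ₁ t₁ σ₂ t₂} → Bounded B σ₁ → Embeds 5 σ₁ (load (encodeSVP instanceOf)) →
          Run build (load input) σ₁ t₁ → t₁ ≤ buildTime B →
          Run (shiftᴾ 5 A) σ₁ σ₂ t₂ → t₂ ≤ W * t →
          (∃₂ λ σ′ t → Run (1 [ # 0 ]≔ cell 6) σ₂ σ′ t × σ′ 1 0ℤ ≡ z × t ≤ 14) → Result
        after-copy {σ₁} bounded embeds run₁ t₁≤ run₂ t₂≤ (σ₃ , t₃ , run₃ , σ₃≡z , t₃≤) =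
          σ₃ , _ , seq run₁ (seq run₂ run₃) , σ₃≡z
          -- The integers of the encoding need no bound of their own: array 5 holds them, and all of
          -- memory is bounded.
          , time-bound (All-nth (encodeSVP instanceOf) λ i →
                subst (λ y → ℤ.∣ y ∣ ≤ B) (embeds 0 (+ i)) (bounded 5 (+ i)))
              t₁≤ t₂≤ t≤ t₃≤

        after-shift : ∀ {σ₁ t₁} → Bounded B σ₁ → Embeds 5 σ₁ (load (encodeSVP instanceOf)) →
          Run build (load input) σ₁ t₁ → t₁ ≤ buildTime B →
          (∃₂ λ σ₂ t₂ → Run (shiftᴾ 5 A) σ₁ σ₂ t₂ × t₂ ≤ W * t × Embeds 5 σ₂ τ) → Result
        after-shift bounded embeds run₁ t₁≤ (σ₂ , t₂ , run₂ , t₂≤ , embeds₂) =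
          after-copy bounded embeds run₁ t₁≤ run₂ t₂≤
            (copy-output σ₂ z≤1 (trans (embeds₂ 1 0ℤ) τ≡z))

        after-build : Rules.Reaches V build (load input) (buildTime B)
          (λ σ → Bounded B σ × Embeds 5 σ (load output)) → Result
        after-build (σ₁ , t₁ , run₁ , t₁≤ , bounded , embeds) =
          after-shift bounded embeds₁ run₁ t₁≤ (Run-shift V W 5 {σ = σ₁} embeds₁ run)
          where
          embeds₁ : Embeds 5 σ₁ (load (encodeSVP instanceOf))
          embeds₁ = subst (λ zs → Embeds 5 σ₁ (load zs)) output≡ embeds

    solves : SolvesInTime A (GapSVPpar ((1ℚ ℚ.+ 1ℚ) ⊝ ε)) (svpTime f g d) →
      SolvesInTime reduction 3-SAT (λ φ → 2 ^ time (Formula.vars φ))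
    solves A-solves φ =
      let yes-out , no-out = A-solves (instanceOf φ)
      in (λ sat → outputs φ (s≤s z≤n) (yes-out (yes-instance φ {(1ℚ ℚ.+ 1ℚ) ⊝ ε} sat)))
       , (λ unsat → outputs φ z≤n (no-out (no-instance φ unsat)))

open GapReduction

open import Data.Rational using (_+_)

theorem1p4 : (ε : ℝ) → fromℚ 0ℚ <ℝ ε → ε ≤ℝ fromℚ 1ℚ →
    ETH →
    ¬ (∃ λ (A : Program) → ∃₂ λ (f g : ℕ → ℕ) → ∃ λ (d : ℕ) →
    Sublinear f × Sublinear g ×
    SolvesInTime A (GapSVPpar ((1ℚ + 1ℚ) ⊝ ε)) (svpTime f g d))
theorem1p4 ε 0<ε _ eth (A , f , g , d , f-sub , g-sub , A-solves) =
  eth (reduction , time , sublinear-time f-sub g-sub , solves A-solves)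
  where open Reduction (threshold ε 0<ε) A f g d
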